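{- The bounded theory of $\mathbb R_C$ is at least as difficult as arithmetic: $\mathbf 0^{(\omega)}\le_m\mathrm{Th}_B(\mathbb R_C)$.
   Context: A name of $x\in\mathbb R$ is a sequence $(q_i)_i$ of rationals with $|q_i-x|<2^{ -i}$ for all $i$; similarly for $\mathbb R^n$ with the Euclidean norm. A function $f:\mathbb R\to\mathbb R$ is (Type-Two) computable if there is an oracle Turing machine $M$ such that for all $x\in\mathbb R$ and every name $p$ of $x$, the sequence $(M^p(i))_i$ is a name of $f(x)$. $\mathbb R_C$ is the ordered field $\mathbb R$ expanded by all (total) univariate Type-Two computable functions $\mathbb R\to\mathbb R$, and $\mathcal L_C$ is its language (rational constants, $+,\cdot,\ge,>$ and a unary symbol for each such function, the symbols being coded by indices of oracle machines computing them), so sentences are coded by natural numbers. A bounded formula is $Q_1^{[a_1,b_1]}y_1\cdots Q_n^{[a_n,b_n]}y_n\,\psi$ with $Q_i\in\{\exists,\forall\}$, $\psi$ quantifier-free (in conjunctive normal form), and $[a_i,b_i]$ closed intervals whose endpoints are terms that may depend on the free variables and on $y_1,\dots,y_{i-1}$; here $\exists^{[a,b]}y\,\chi:=\exists y(a\le y\wedge y\le b\wedge\chi)$ and $\forall^{[a,b]}y\,\chi:=\forall y(a\le y\wedge y\le b\to\chi)$. $\mathrm{Th}_B(\mathbb R_C)$ is the set of (codes of) bounded $\mathcal L_C$-sentences true in $\mathbb R_C$. $\mathbf 0^{(k)}$ is the $k$-th iterated Turing jump and $\mathbf 0^{(\omega)}=\{\langle n,k\rangle : n\in\mathbf 0^{(k)}\}$,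 with $\langle\cdot,\cdot\rangle$ a standard computable pairing. For $A,B\subseteq\mathbb N$, $A\le_mB$ means there is a computable $g:\mathbb N\to\mathbb N$ with $n\in A\iff g(n)\in B$ for all $n$. -}

module Defs where

open import Data.Bool.Base using (Bool; true; false; if_then_else_)
open import Data.Empty using (⊥)
open import Data.Fin.Base using (Fin; zero; suc; toℕ)
open import Data.Integer.Base as ℤ using (ℤ)
open import Data.List.Base using (List; []; _∷_; replicate; foldr; map)
open import Data.List.Relation.Unary.All using (All)
open import Data.Maybe.Base using (Maybe; just; nothing)
open import Data.Nat.Base as ℕ using (ℕ; zero; suc)
import Data.Nat.Properties as ℕₚ
open import Data.Product.Base using (∃-syntax; Σ-syntax; _×_; _,_)
open import Data.Rational.Unnormalised.Base as ℚ
  using (ℚᵘ; mkℚᵘ; 0ℚᵘ; 1ℚᵘ; ½; *≤*; *≡*)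
import Data.Rational.Unnormalised.Properties as ℚₚ
open import Data.Vec.Base as Vec using (Vec; []; _∷_; lookup; _[_]≔_)
open import Function.Bundles using (_⇔_)
open import Relation.Binary.Construct.Closure.ReflexiveTransitive using (Star)
open import Relation.Binary.PropositionalEquality using (_≡_; refl; sym; cong; subst)
open import Relation.Nullary.Negation using (¬_)
open import Relation.Unary using (Pred)
open import Level using (0ℓ)

-- Truth in the structure of real numbers and the Turing jump are meant
-- classically.  In their definitions existential quantifiers and
-- disjunctions are therefore rendered by ¬ ∀ ¬ (or ¬ ¬ ∃), which under
-- excluded middle is the usual meaning.

------------------------------------------------------------------------
-- Codings by natural numbers

triangle : ℕ → ℕ
triangle zero    = 0
triangle (suc n) = suc n ℕ.+ triangle n

-- Cantor's pairing bijection ℕ × ℕ → ℕ.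
⟨_,_⟩ : ℕ → ℕ → ℕ
⟨ m , n ⟩ = triangle (m ℕ.+ n) ℕ.+ n

codeList : List ℕ → ℕ
codeList = foldr (λ a c → suc ⟨ a , c ⟩) 0

codeBool : Bool → ℕ
codeBool false = 0
codeBool true  = 1

codeℤ : ℤ → ℕ
codeℤ (ℤ.+ n)      = 2 ℕ.* n
codeℤ (ℤ.-[1+ n ]) = suc (2 ℕ.* n)

-- Rationals are handled as (not necessarily reduced) fractions; equal
-- fractions with different numerators have different codes.
codeℚ : ℚᵘ → ℕ
codeℚ (mkℚᵘ p d-1) = ⟨ codeℤ p , d-1 ⟩

------------------------------------------------------------------------
-- Multi-tape oracle Turing machines over the alphabet {blank, mark}

-- A two-way infinite tape: the cells to the left of the head (nearest
-- first), the scanned cell, and the cells to the right (nearest first).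
-- true is a mark, false a blank; cells beyond the lists are blank.
record Tape : Set where
  constructor tape
  field
    left    : List Bool
    scanned : Bool
    right   : List Bool
open Tape public

data Move : Set where
  L R stay : Move

moveHead : Move → Tape → Tape
moveHead stay t                   = t
moveHead L    (tape []       b r) = tape [] false (b ∷ r)
moveHead L    (tape (a ∷ l)  b r) = tape l a (b ∷ r)
moveHead R    (tape l b [])       = tape (b ∷ l) false []
moveHead R    (tape l b (a ∷ r))  = tape (b ∷ l) a r

marks : List Bool → ℕ
marks = foldr (λ b n → codeBool b ℕ.+ n) 0

-- The number held by a tape is the number of marks on it.
value : Tape → ℕ
value (tape l b r) = marks l ℕ.+ (codeBool b ℕ.+ marks r)

-- n as a block of n marks, the head on the blank just after the block.
unary : ℕ → Tape
unary n = tape (replicate n true) false []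

-- Write a symbol, move the head, go to a state.
record Action : Set where
  constructor action
  field
    write : Bool
    move  : Move
    next  : ℕ
open Action public

-- A row of the transition table: either inspect one tape and act on it
-- according to the scanned symbol (blank or mark), or query the oracle.
data Row (k : ℕ) : Set where
  inspect : (t : Fin k) (onBlank onMark : Action) → Row k
  query   : (next : ℕ) → Row k

-- Tape 0 is the input/output tape, tape 1 the oracle tape.  State q is
-- governed by row q of the table; states without a row are halting.
record Machine : Set where
  constructor machine
  field
    workTapes : ℕ
    table     : List (Row (2 ℕ.+ workTapes))

  tapes : ℕ
  tapes = 2 ℕ.+ workTapes

  io oracle : Fin tapes
  io     = zero
  oracle = suc zero
open Machine public

rowAt : ∀ {k} → List (Row k) → ℕ → Maybe (Row k)
rowAt []       _       = nothing
rowAt (r ∷ _)  zero    = just r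
rowAt (_ ∷ rs) (suc q) = rowAt rs q

-- An oracle is given by its graph: O n a means "the answer to n is a".
Oracle : Set₁
Oracle = ℕ → ℕ → Set

graph : (ℕ → ℕ) → Oracle
graph p n a = a ≡ p n

χ : Pred ℕ 0ℓ → Oracle
χ A n zero          = ¬ A n
χ A n (suc zero)    = A n
χ A n (suc (suc _)) = ⊥

record Config (k : ℕ) : Set where
  constructor config
  field
    state    : ℕ
    contents : Vec Tape k
open Config public

act : Action → Tape → Tape
act a t = moveHead (move a) (record t { scanned = write a })

data Step (M : Machine) (O : Oracle) : Config (tapes M) → Config (tapes M) → Set where
  inspecting : ∀ {q ts t a₀ a₁} → rowAt (table M) q ≡ just (inspect t a₀ a₁) →
    let a = if scanned (lookup ts t) then a₁ else a₀ in
    Step M O (config q ts) (config (next a) (ts [ t ]≔ act a (lookup ts t)))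
  querying : ∀ {q ts q′ a} → rowAt (table M) q ≡ just (query q′) →
    O (value (lookup ts (oracle M))) a →
    Step M O (config q ts) (config q′ (ts [ oracle M ]≔ unary a))

initial : (M : Machine) → ℕ → Config (tapes M)
initial M n = config 0 (unary n ∷ Vec.replicate _ (unary 0))

-- M [ O ] n ⇓ m : started on input n, M with oracle O halts with output m.
_[_]_⇓_ : Machine → Oracle → ℕ → ℕ → Set
M [ O ] n ⇓ m = ∃[ c ] (Star (Step M O) (initial M n) c
                        × rowAt (table M) (state c) ≡ nothing
                        × value (lookup (contents c) (io M)) ≡ m)

codeMove : Move → ℕ
codeMove L    = 0
codeMove R    = 1
codeMove stay = 2

codeAction : Action → ℕ
codeAction (action w m q) = ⟨ codeBool w , ⟨ codeMove m , q ⟩ ⟩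

codeRow : ∀ {k} → Row k → ℕ
codeRow (inspect t a₀ a₁) = ⟨ 0 , ⟨ toℕ t , ⟨ codeAction a₀ , codeAction a₁ ⟩ ⟩ ⟩
codeRow (query q)         = ⟨ 1 , q ⟩

index : Machine → ℕ
index (machine k rows) = ⟨ k , codeList (map codeRow rows) ⟩

------------------------------------------------------------------------
-- Many-one reducibility, jumps

∅ : Pred ℕ 0ℓ
∅ _ = ⊥

Computable : (ℕ → ℕ) → Set
Computable g = ∃[ M ] ∀ n → M [ χ ∅ ] n ⇓ g n

infix 4 _≤ₘ_
_≤ₘ_ : Pred ℕ 0ℓ → Pred ℕ 0ℓ → Set
A ≤ₘ B = ∃[ g ] (Computable g × ∀ n → A n ⇔ B (g n))

-- The machine with index e halts on input e with oracle A.
Jump : Pred ℕ 0ℓ → Pred ℕ 0ℓ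
Jump A e = ¬ ¬ (∃[ M ] (index M ≡ e × ∃[ m ] (M [ χ A ] e ⇓ m)))

𝟎^⟨_⟩ : ℕ → Pred ℕ 0ℓ
𝟎^⟨ zero ⟩  = ∅
𝟎^⟨ suc k ⟩ = Jump 𝟎^⟨ k ⟩

𝟎^ω : Pred ℕ 0ℓ
𝟎^ω m = ∃[ n ] ∃[ k ] (m ≡ ⟨ n , k ⟩ × 𝟎^⟨ k ⟩ n)

------------------------------------------------------------------------
-- The ordered field of real numbers (Cauchy sequences of rationals)

½^_ : ℕ → ℚᵘ
½^ zero  = 1ℚᵘ
½^ suc k = ½ ℚ.* ½^ k

IsCauchy : (ℕ → ℚᵘ) → Set
IsCauchy x = ∀ k → ∃[ N ] ∀ m n → N ℕ.≤ m → N ℕ.≤ n → ℚ.∣ x m ℚ.- x n ∣ ℚ.≤ ½^ k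

record ℝ : Set where
  constructor real
  field
    seq    : ℕ → ℚᵘ
    cauchy : IsCauchy seq
open ℝ public

infix 4 _≤_ _<_ _≈_
_≤_ _<_ _≈_ : ℝ → ℝ → Set
x ≤ y = ∀ k → ∃[ N ] ∀ n → N ℕ.≤ n → seq x n ℚ.≤ seq y n ℚ.+ ½^ k
x < y = ∃[ k ] ∃[ N ] ∀ n → N ℕ.≤ n → seq x n ℚ.+ ½^ k ℚ.≤ seq y n
x ≈ y = x ≤ y × y ≤ x

module CauchyLemmas where

  open ℚₚ.≤-Reasoning

  half+half : ∀ p → ½ ℚ.* p ℚ.+ ½ ℚ.* p ℚ.≃ p
  half+half p = ℚₚ.≃-trans (ℚₚ.≃-sym (ℚₚ.*-distribʳ-+ p ½ ½))
                  (ℚₚ.≃-trans (ℚₚ.*-congʳ {p} {½ ℚ.+ ½} {1ℚᵘ} (*≡* refl)) (ℚₚ.*-identityˡ p))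

  ½^-nonNeg : ∀ k → ℚ.NonNegative (½^ k)
  ½^-nonNeg zero    = _
  ½^-nonNeg (suc k) = ℚₚ.nonNeg*nonNeg⇒nonNeg ½ (½^ k) {{½^-nonNeg k}}

  ½^-≤1 : ∀ k → ½^ k ℚ.≤ 1ℚᵘ
  ½^-≤1 zero    = ℚₚ.≤-refl
  ½^-≤1 (suc k) = begin
    ½ ℚ.* ½^ k                ≤⟨ ℚₚ.*-monoʳ-≤-nonNeg ½ (½^-≤1 k) ⟩
    ½ ℚ.* 1ℚᵘ                 ≤⟨ *≤* (ℤ.+≤+ (ℕ.s≤s ℕ.z≤n)) ⟩
    1ℚᵘ                       ∎

  ½^-+ : ∀ m k → ½^ (m ℕ.+ k) ℚ.≃ ½^ m ℚ.* ½^ k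
  ½^-+ zero    k = ℚₚ.≃-sym (ℚₚ.*-identityˡ (½^ k))
  ½^-+ (suc m) k = ℚₚ.≃-trans (ℚₚ.*-congˡ {½} (½^-+ m k)) (ℚₚ.≃-sym (ℚₚ.*-assoc ½ (½^ m) (½^ k)))

  fromℕ : ℕ → ℚᵘ
  fromℕ zero    = 0ℚᵘ
  fromℕ (suc n) = 1ℚᵘ ℚ.+ fromℕ n

  fromℕ-½^ : ∀ n → fromℕ n ℚ.* ½^ n ℚ.≤ 1ℚᵘ
  fromℕ-½^ zero    = ℚₚ.≤-trans (ℚₚ.≤-reflexive (ℚₚ.*-zeroˡ 1ℚᵘ)) (*≤* (ℤ.+≤+ ℕ.z≤n))
  fromℕ-½^ (suc n) = begin
    (1ℚᵘ ℚ.+ fromℕ n) ℚ.* h                     ≃⟨ ℚₚ.*-distribʳ-+ h 1ℚᵘ (fromℕ n) ⟩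
    1ℚᵘ ℚ.* h ℚ.+ fromℕ n ℚ.* h                 ≃⟨ ℚₚ.+-cong (ℚₚ.*-identityˡ h) swap ⟩
    ½ ℚ.* ½^ n ℚ.+ ½ ℚ.* (fromℕ n ℚ.* ½^ n)     ≤⟨ ℚₚ.+-mono-≤ (ℚₚ.*-monoʳ-≤-nonNeg ½ (½^-≤1 n))
                                                               (ℚₚ.*-monoʳ-≤-nonNeg ½ (fromℕ-½^ n)) ⟩
    ½ ℚ.* 1ℚᵘ ℚ.+ ½ ℚ.* 1ℚᵘ                     ≃⟨ half+half 1ℚᵘ ⟩
    1ℚᵘ                                         ∎
    where
    h = ½^ suc n
    swap : fromℕ n ℚ.* (½ ℚ.* ½^ n) ℚ.≃ ½ ℚ.* (fromℕ n ℚ.* ½^ n)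
    swap = begin-equality
      fromℕ n ℚ.* (½ ℚ.* ½^ n)  ≃⟨ ℚₚ.*-assoc (fromℕ n) ½ (½^ n) ⟨
      fromℕ n ℚ.* ½ ℚ.* ½^ n    ≃⟨ ℚₚ.*-congʳ {½^ n} (ℚₚ.*-comm (fromℕ n) ½) ⟩
      ½ ℚ.* fromℕ n ℚ.* ½^ n    ≃⟨ ℚₚ.*-assoc ½ (fromℕ n) (½^ n) ⟩
      ½ ℚ.* (fromℕ n ℚ.* ½^ n)  ∎

  ceil : ∀ q → ∃[ n ] q ℚ.≤ fromℕ n
  ceil (mkℚᵘ (ℤ.+ n) d) = n , ℚₚ.≤-trans (shrink d) (lift n)
    where
    shrink : ∀ d → mkℚᵘ (ℤ.+ n) d ℚ.≤ mkℚᵘ (ℤ.+ n) 0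
    shrink d = *≤* (ℤₚ-mono n d)
      where
      open import Data.Integer.Properties using (*-monoˡ-≤-nonNeg)
      ℤₚ-mono : ∀ n d → ℤ.+ n ℤ.* ℤ.+ 1 ℤ.≤ ℤ.+ n ℤ.* ℤ.+ suc d
      ℤₚ-mono n d = *-monoˡ-≤-nonNeg (ℤ.+ n) (ℤ.+≤+ (ℕ.s≤s ℕ.z≤n))
    lift : ∀ n → mkℚᵘ (ℤ.+ n) 0 ℚ.≤ fromℕ n
    lift zero    = ℚₚ.≤-refl
    lift (suc n) = ℚₚ.≤-trans (ℚₚ.≤-reflexive (*≡* (cong (λ i → i ℤ.* ℤ.+ 1) eq)))
                              (ℚₚ.+-monoʳ-≤ 1ℚᵘ (lift n))
      where
      open import Data.Integer.Properties using (*-identityʳ)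
      eq : ℤ.+ suc n ≡ ℤ.+ 1 ℤ.+ ℤ.+ n ℤ.* ℤ.+ 1
      eq = sym (cong (λ i → ℤ.+ 1 ℤ.+ i) (*-identityʳ (ℤ.+ n)))
  ceil (mkℚᵘ ℤ.-[1+ n ] d) = 0 , *≤* ℤ.-≤+

  shrink : ∀ q k → ∃[ j ] q ℚ.* ½^ j ℚ.≤ ½^ k
  shrink q k with ceil q
  ... | n , q≤n = n ℕ.+ k , (begin
    q ℚ.* ½^ (n ℕ.+ k)             ≤⟨ ℚₚ.*-monoˡ-≤-nonNeg (½^ (n ℕ.+ k)) {{½^-nonNeg (n ℕ.+ k)}} q≤n ⟩
    fromℕ n ℚ.* ½^ (n ℕ.+ k)       ≃⟨ ℚₚ.*-congˡ {fromℕ n} (½^-+ n k) ⟩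
    fromℕ n ℚ.* (½^ n ℚ.* ½^ k)    ≃⟨ ℚₚ.*-assoc (fromℕ n) (½^ n) (½^ k) ⟨
    fromℕ n ℚ.* ½^ n ℚ.* ½^ k      ≤⟨ ℚₚ.*-monoˡ-≤-nonNeg (½^ k) {{½^-nonNeg k}} (fromℕ-½^ n) ⟩
    1ℚᵘ ℚ.* ½^ k                   ≃⟨ ℚₚ.*-identityˡ (½^ k) ⟩
    ½^ k                           ∎)

  open import Data.Rational.Unnormalised.Solver using (module +-*-Solver)
  open +-*-Solver using (solve; _:+_; _:*_; _:-_; _:=_)

  bounded : ∀ x → IsCauchy x → ∃[ q ] ∃[ N ] ∀ n → N ℕ.≤ n → ℚ.∣ x n ∣ ℚ.≤ q
  bounded x c with c 0
  ... | N , h = 1ℚᵘ ℚ.+ ℚ.∣ x N ∣ , N , λ n N≤n → begin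
    ℚ.∣ x n ∣                            ≃⟨ ℚₚ.∣-∣-cong (solve 2 (λ a b → a := (a :- b) :+ b) ℚₚ.≃-refl (x n) (x N)) ⟩
    ℚ.∣ (x n ℚ.- x N) ℚ.+ x N ∣          ≤⟨ ℚₚ.∣p+q∣≤∣p∣+∣q∣ (x n ℚ.- x N) (x N) ⟩
    ℚ.∣ x n ℚ.- x N ∣ ℚ.+ ℚ.∣ x N ∣      ≤⟨ ℚₚ.+-monoˡ-≤ ℚ.∣ x N ∣ (h n N N≤n ℕₚ.≤-refl) ⟩
    1ℚᵘ ℚ.+ ℚ.∣ x N ∣                    ∎

  +-cauchy : ∀ x y → IsCauchy x → IsCauchy y → IsCauchy (λ n → x n ℚ.+ y n)
  +-cauchy x y c d k with c (suc k) | d (suc k)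
  ... | N , h | N′ , h′ = N ℕ.⊔ N′ , λ m n N≤m N≤n → begin
    ℚ.∣ x m ℚ.+ y m ℚ.- (x n ℚ.+ y n) ∣
      ≃⟨ ℚₚ.∣-∣-cong (solve 4 (λ a b c d → a :+ b :- (c :+ d) := (a :- c) :+ (b :- d)) ℚₚ.≃-refl (x m) (y m) (x n) (y n)) ⟩
    ℚ.∣ (x m ℚ.- x n) ℚ.+ (y m ℚ.- y n) ∣
      ≤⟨ ℚₚ.∣p+q∣≤∣p∣+∣q∣ (x m ℚ.- x n) (y m ℚ.- y n) ⟩
    ℚ.∣ x m ℚ.- x n ∣ ℚ.+ ℚ.∣ y m ℚ.- y n ∣
      ≤⟨ ℚₚ.+-mono-≤ (h m n (ℕₚ.m⊔n≤o⇒m≤o N N′ N≤m) (ℕₚ.m⊔n≤o⇒m≤o N N′ N≤n))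
                     (h′ m n (ℕₚ.m⊔n≤o⇒n≤o N N′ N≤m) (ℕₚ.m⊔n≤o⇒n≤o N N′ N≤n)) ⟩
    ½ ℚ.* ½^ k ℚ.+ ½ ℚ.* ½^ k
      ≃⟨ half+half (½^ k) ⟩
    ½^ k ∎

  scaled : ∀ {p q r s} → ℚ.∣ p ∣ ℚ.≤ q → ℚ.∣ r ∣ ℚ.≤ s → ℚ.∣ p ℚ.* r ∣ ℚ.≤ q ℚ.* s
  scaled {p} {q} {r} {s} p≤q r≤s = begin
    ℚ.∣ p ℚ.* r ∣         ≃⟨ ℚₚ.∣p*q∣≃∣p∣*∣q∣ p r ⟩
    ℚ.∣ p ∣ ℚ.* ℚ.∣ r ∣   ≤⟨ ℚₚ.*-mono-≤-nonNeg {{ℚₚ.∣-∣-nonNeg p}} {{ℚₚ.∣-∣-nonNeg r}} p≤q r≤s ⟩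
    q ℚ.* s               ∎

  *-cauchy : ∀ x y → IsCauchy x → IsCauchy y → IsCauchy (λ n → x n ℚ.* y n)
  *-cauchy x y c d k with bounded x c | bounded y d
  ... | B , M , b | B′ , M′ , b′ with shrink B (suc k) | shrink B′ (suc k)
  ... | j , e | j′ , e′ with d j | c j′
  ... | N , h | N′ , h′ = (M ℕ.⊔ M′) ℕ.⊔ (N ℕ.⊔ N′) , λ m n ≤m ≤n → begin
    ℚ.∣ x m ℚ.* y m ℚ.- x n ℚ.* y n ∣
      ≃⟨ ℚₚ.∣-∣-cong (solve 4 (λ a b c d → a :* b :- c :* d := a :* (b :- d) :+ d :* (a :- c)) ℚₚ.≃-refl (x m) (y m) (x n) (y n)) ⟩
    ℚ.∣ x m ℚ.* (y m ℚ.- y n) ℚ.+ y n ℚ.* (x m ℚ.- x n) ∣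
      ≤⟨ ℚₚ.∣p+q∣≤∣p∣+∣q∣ (x m ℚ.* (y m ℚ.- y n)) (y n ℚ.* (x m ℚ.- x n)) ⟩
    ℚ.∣ x m ℚ.* (y m ℚ.- y n) ∣ ℚ.+ ℚ.∣ y n ℚ.* (x m ℚ.- x n) ∣
      ≤⟨ ℚₚ.+-mono-≤ (scaled {x m} (b m (l₁ ≤m)) (h m n (l₃ ≤m) (l₃ ≤n)))
                     (scaled {y n} (b′ n (l₂ ≤n)) (h′ m n (l₄ ≤m) (l₄ ≤n))) ⟩
    B ℚ.* ½^ j ℚ.+ B′ ℚ.* ½^ j′
      ≤⟨ ℚₚ.+-mono-≤ e e′ ⟩
    ½ ℚ.* ½^ k ℚ.+ ½ ℚ.* ½^ k
      ≃⟨ half+half (½^ k) ⟩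
    ½^ k ∎
    where
    l₁₂ : ∀ {m} → (M ℕ.⊔ M′) ℕ.⊔ (N ℕ.⊔ N′) ℕ.≤ m → M ℕ.⊔ M′ ℕ.≤ m
    l₁₂ = ℕₚ.m⊔n≤o⇒m≤o (M ℕ.⊔ M′) (N ℕ.⊔ N′)
    l₃₄ : ∀ {m} → (M ℕ.⊔ M′) ℕ.⊔ (N ℕ.⊔ N′) ℕ.≤ m → N ℕ.⊔ N′ ℕ.≤ m
    l₃₄ = ℕₚ.m⊔n≤o⇒n≤o (M ℕ.⊔ M′) (N ℕ.⊔ N′)
    l₁ : ∀ {m} → (M ℕ.⊔ M′) ℕ.⊔ (N ℕ.⊔ N′) ℕ.≤ m → M ℕ.≤ m
    l₁ p = ℕₚ.m⊔n≤o⇒m≤o M M′ (l₁₂ p)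
    l₂ : ∀ {m} → (M ℕ.⊔ M′) ℕ.⊔ (N ℕ.⊔ N′) ℕ.≤ m → M′ ℕ.≤ m
    l₂ p = ℕₚ.m⊔n≤o⇒n≤o M M′ (l₁₂ p)
    l₃ : ∀ {m} → (M ℕ.⊔ M′) ℕ.⊔ (N ℕ.⊔ N′) ℕ.≤ m → N ℕ.≤ m
    l₃ p = ℕₚ.m⊔n≤o⇒m≤o N N′ (l₃₄ p)
    l₄ : ∀ {m} → (M ℕ.⊔ M′) ℕ.⊔ (N ℕ.⊔ N′) ℕ.≤ m → N′ ℕ.≤ m
    l₄ p = ℕₚ.m⊔n≤o⇒n≤o N N′ (l₃₄ p)

  const-cauchy : ∀ q → IsCauchy (λ _ → q)
  const-cauchy q k = 0 , λ m n _ _ → begin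
    ℚ.∣ q ℚ.- q ∣  ≃⟨ ℚₚ.∣-∣-cong (ℚₚ.+-inverseʳ q) ⟩
    0ℚᵘ            ≤⟨ ℚₚ.nonNegative⁻¹ (½^ k) {{½^-nonNeg k}} ⟩
    ½^ k           ∎

  neg-cauchy : ∀ x → IsCauchy x → IsCauchy (λ n → ℚ.- x n)
  neg-cauchy x c k with c k
  ... | N , h = N , λ m n N≤m N≤n → begin
    ℚ.∣ ℚ.- x m ℚ.- (ℚ.- x n) ∣  ≃⟨ ℚₚ.∣-∣-cong (ℚₚ.≃-sym (ℚₚ.≃-reflexive (ℚₚ.neg-distrib-+ (x m) (ℚ.- x n)))) ⟩
    ℚ.∣ ℚ.- (x m ℚ.- x n) ∣      ≃⟨ ℚₚ.∣-p∣≃∣p∣ (x m ℚ.- x n) ⟩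
    ℚ.∣ x m ℚ.- x n ∣            ≤⟨ h m n N≤m N≤n ⟩
    ½^ k                         ∎

  abs-cauchy : ∀ x → IsCauchy x → IsCauchy (λ n → ℚ.∣ x n ∣)
  abs-cauchy x c k with c k
  ... | N , h = N , λ m n N≤m N≤n → below (λ r → r ℚ.≤ ½^ k)
                      (ℚ.∣ x m ∣ ℚ.- ℚ.∣ x n ∣)
                      (ℚₚ.≤-trans (reverse (x m) (x n)) (h m n N≤m N≤n))
                      (ℚₚ.≤-trans (ℚₚ.≤-reflexive (flip ℚ.∣ x m ∣ ℚ.∣ x n ∣))
                        (ℚₚ.≤-trans (reverse (x n) (x m)) (h n m N≤n N≤m)))
    where
    open import Data.Sum.Base using (inj₁; inj₂)
    below : ∀ (P : ℚᵘ → Set) p → P p → P (ℚ.- p) → P ℚ.∣ p ∣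
    below P p P+ P- with ℚₚ.∣p∣≡p∨∣p∣≡-p p
    ... | inj₁ eq = subst P (sym eq) P+
    ... | inj₂ eq = subst P (sym eq) P-
    flip : ∀ p q → ℚ.- (p ℚ.- q) ℚ.≃ q ℚ.- p
    flip p q = solve 2 (λ p q → +-*-Solver.:- (p :- q) := q :- p) ℚₚ.≃-refl p q
    reverse : ∀ p q → ℚ.∣ p ∣ ℚ.- ℚ.∣ q ∣ ℚ.≤ ℚ.∣ p ℚ.- q ∣
    reverse p q = begin
      ℚ.∣ p ∣ ℚ.- ℚ.∣ q ∣
        ≃⟨ ℚₚ.+-congˡ (ℚ.- ℚ.∣ q ∣) (ℚₚ.∣-∣-cong (solve 2 (λ a b → a := (a :- b) :+ b) ℚₚ.≃-refl p q)) ⟩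
      ℚ.∣ (p ℚ.- q) ℚ.+ q ∣ ℚ.- ℚ.∣ q ∣
        ≤⟨ ℚₚ.+-monoˡ-≤ (ℚ.- ℚ.∣ q ∣) (ℚₚ.∣p+q∣≤∣p∣+∣q∣ (p ℚ.- q) q) ⟩
      ℚ.∣ p ℚ.- q ∣ ℚ.+ ℚ.∣ q ∣ ℚ.- ℚ.∣ q ∣
        ≃⟨ solve 2 (λ a b → a :+ b :- b := a) ℚₚ.≃-refl ℚ.∣ p ℚ.- q ∣ ℚ.∣ q ∣ ⟩
      ℚ.∣ p ℚ.- q ∣ ∎

open CauchyLemmas using (const-cauchy; +-cauchy; *-cauchy; neg-cauchy; abs-cauchy)

fromℚ : ℚᵘ → ℝ
fromℚ q = real (λ _ → q) (const-cauchy q)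

infixl 6 _+_ _-_
infixl 7 _*_
_+_ _*_ _-_ : ℝ → ℝ → ℝ
x + y = real (λ n → seq x n ℚ.+ seq y n) (+-cauchy (seq x) (seq y) (cauchy x) (cauchy y))
x * y = real (λ n → seq x n ℚ.* seq y n) (*-cauchy (seq x) (seq y) (cauchy x) (cauchy y))
x - y = real (λ n → seq x n ℚ.- seq y n) (+-cauchy (seq x) _ (cauchy x) (neg-cauchy (seq y) (cauchy y)))

∣_∣ : ℝ → ℝ
∣ x ∣ = real (λ n → ℚ.∣ seq x n ∣) (abs-cauchy (seq x) (cauchy x))

------------------------------------------------------------------------
-- Type-Two computable functions

_IsNameOf_ : (ℕ → ℚᵘ) → ℝ → Set
p IsNameOf x = ∀ i → ∣ fromℚ (p i) - x ∣ < fromℚ (½^ i)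

Computes : Machine → (ℝ → ℝ) → Set
Computes M f = ∀ x p → p IsNameOf x →
  ∃[ q ] (q IsNameOf f x × ∀ i → M [ graph (λ n → codeℚ (p n)) ] i ⇓ codeℚ (q i))

-- A unary function symbol: a machine together with the total function on
-- the reals that it computes (a function being compatible with _≈_).
record FunctionSymbol : Set where
  field
    program   : Machine
    function  : ℝ → ℝ
    function-cong : ∀ {x y} → x ≈ y → function x ≈ function y
    computes  : Computes program function
open FunctionSymbol public

------------------------------------------------------------------------
-- Syntax (de Bruijn indices: Term n has the free variables 0, …, n-1)

data Term (n : ℕ) : Set where
  var       : Fin n → Term n
  const     : ℚᵘ → Term n
  _⊕_ _⊗_   : Term n → Term n → Term n
  app       : FunctionSymbol → Term n → Term n

data Atom (n : ℕ) : Set where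
  _≐_ _≥′_ _>′_ : Term n → Term n → Atom n

data Literal (n : ℕ) : Set where
  pos neg : Atom n → Literal n

-- Conjunctions of disjunctions of literals.
Clause CNF : ℕ → Set
Clause n = List (Literal n)
CNF n    = List (Clause n)

-- The variable bound by a quantifier is number 0 in its scope; the
-- endpoints of its interval lie outside that scope.
data BoundedFormula (n : ℕ) : Set where
  matrix : CNF n → BoundedFormula n
  ∃[_,_]_ ∀[_,_]_ : (a b : Term n) → BoundedFormula (suc n) → BoundedFormula n

BoundedSentence : Set
BoundedSentence = BoundedFormula 0

codeTerm : ∀ {n} → Term n → ℕ
codeTerm (var i)   = ⟨ 0 , toℕ i ⟩
codeTerm (const q) = ⟨ 1 , codeℚ q ⟩
codeTerm (s ⊕ t)   = ⟨ 2 , ⟨ codeTerm s , codeTerm t ⟩ ⟩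
codeTerm (s ⊗ t)   = ⟨ 3 , ⟨ codeTerm s , codeTerm t ⟩ ⟩
codeTerm (app f t) = ⟨ 4 , ⟨ index (program f) , codeTerm t ⟩ ⟩

codeAtom : ∀ {n} → Atom n → ℕ
codeAtom (s ≐ t)  = ⟨ 0 , ⟨ codeTerm s , codeTerm t ⟩ ⟩
codeAtom (s ≥′ t) = ⟨ 1 , ⟨ codeTerm s , codeTerm t ⟩ ⟩
codeAtom (s >′ t) = ⟨ 2 , ⟨ codeTerm s , codeTerm t ⟩ ⟩

codeLiteral : ∀ {n} → Literal n → ℕ
codeLiteral (pos α) = ⟨ 0 , codeAtom α ⟩
codeLiteral (neg α) = ⟨ 1 , codeAtom α ⟩

codeClause : ∀ {n} → Clause n → ℕ
codeClause c = codeList (map codeLiteral c)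

codeFormula : ∀ {n} → BoundedFormula n → ℕ
codeFormula (matrix ψ)     = ⟨ 0 , codeList (map codeClause ψ) ⟩
codeFormula (∃[ a , b ] φ) = ⟨ 1 , ⟨ codeTerm a , ⟨ codeTerm b , codeFormula φ ⟩ ⟩ ⟩
codeFormula (∀[ a , b ] φ) = ⟨ 2 , ⟨ codeTerm a , ⟨ codeTerm b , codeFormula φ ⟩ ⟩ ⟩

------------------------------------------------------------------------
-- Truth in the expansion of the ordered field ℝ by all function symbols

⟦_⟧ : ∀ {n} → Term n → Vec ℝ n → ℝ
⟦ var i ⟧   ρ = lookup ρ i
⟦ const q ⟧ ρ = fromℚ q
⟦ s ⊕ t ⟧   ρ = ⟦ s ⟧ ρ + ⟦ t ⟧ ρ
⟦ s ⊗ t ⟧   ρ = ⟦ s ⟧ ρ * ⟦ t ⟧ ρ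
⟦ app f t ⟧ ρ = function f (⟦ t ⟧ ρ)

TrueAtom : ∀ {n} → Vec ℝ n → Atom n → Set
TrueAtom ρ (s ≐ t)  = ⟦ s ⟧ ρ ≈ ⟦ t ⟧ ρ
TrueAtom ρ (s ≥′ t) = ⟦ t ⟧ ρ ≤ ⟦ s ⟧ ρ
TrueAtom ρ (s >′ t) = ⟦ t ⟧ ρ < ⟦ s ⟧ ρ

TrueLiteral : ∀ {n} → Vec ℝ n → Literal n → Set
TrueLiteral ρ (pos α) = TrueAtom ρ α
TrueLiteral ρ (neg α) = ¬ TrueAtom ρ α

-- A disjunction is true when its disjuncts are not all false.
TrueClause : ∀ {n} → Vec ℝ n → Clause n → Set
TrueClause ρ c = ¬ All (λ l → ¬ TrueLiteral ρ l) c

infix 4 _⊨_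
_⊨_ : ∀ {n} → Vec ℝ n → BoundedFormula n → Set
ρ ⊨ matrix ψ       = All (TrueClause ρ) ψ
ρ ⊨ (∃[ a , b ] φ) = ¬ (∀ y → ¬ (⟦ a ⟧ ρ ≤ y × y ≤ ⟦ b ⟧ ρ × y ∷ ρ ⊨ φ))
ρ ⊨ (∀[ a , b ] φ) = ∀ y → ⟦ a ⟧ ρ ≤ y × y ≤ ⟦ b ⟧ ρ → y ∷ ρ ⊨ φ

-- The set of codes of true bounded sentences.
Th-B : Pred ℕ 0ℓ
Th-B c = Σ[ φ ∈ BoundedSentence ] (codeFormula φ ≡ c × [] ⊨ φ)

{-# OPTIONS --safe #-}

module Submission where

-- Membership in the jumps is decided by a game.  To show that machine e halts
-- with the oracle 𝟎^⟨ k ⟩, that is e ∈ 𝟎^⟨ suc k ⟩, a player names a number of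
-- steps and the answers of the oracle; the opponent objects to a row of e or to
-- one of the answers, which leaves a claim about 𝟎^⟨ k ⟩, made by one player or
-- the other.  As either player may be the claimant, a round takes moves in the
-- order ∃ ∀ ∃, and ⟨ n , k ⟩ ≥ k rounds settle whether n lies in 𝟎^⟨ k ⟩; the
-- winner is computable from the moves.
--
-- A bounded sentence plays this game with reals, the number K being represented
-- by 1 / K ∈ [0 , 1].  For a computable r, the supremum F of 0 and the tents of
-- slope 1 and height 1 / 2K² at 1 / K, r K ≢ 0, is computable and 1-Lipschitz,
-- and for y > 0, ½ y² ≤ F y holds exactly if y = 1 / K with r K ≢ 0.  With r = 1
-- this restricts a quantifier to 0 and the reciprocals; with r the verdict on a
-- coded history it judges the game.  The history is carried as a single real:
-- 1 / ⟨ K , b ⟩ solves a polynomial equation over 1 / K and 1 / b.  A player who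
-- moves 0 forfeits.
--
-- A code may belong to many formulas, as function symbols enter only through
-- their machines; machines being deterministic, these formulas are equivalent.
-- Existence and the jump are double negations, so the equivalence can be argued
-- classically.

-- Bounded quantifiers range over compact intervals, so infinitely many numbers must accumulate
-- somewhere; reciprocals accumulate at 0. A comparison of two continuous functions such as ½ y² ≤ F
-- y defines a closed set, which therefore cannot avoid 0. This is why 0 passes every such test, has
-- to be read as a forfeit, and is excluded only by the strict atom in the matrix; most of the care
-- in the moves goes into carrying a forfeit along unchanged. The curve ½ y² is chosen because on
-- [0 , 1] a tent of slope 1 with its apex on this parabola stays below it elsewhere, by ½ of the
-- squared distance from the apex. Hence infinitely many tents can be superposed without creating
-- further contacts. Function symbols are unary and division is not a term: several moves must be
-- packed into one real before a symbol can judge them, and the packing is stated as an equation.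
-- Side conditions are written as intervals that may be empty, so the prefix absorbs them and the
-- matrix is the same for all inputs. The two function symbols are fixed as well; only the number of
-- rounds depends on the input.

-- Cantor pairing and list codes

module Pairing where

  open import Data.Nat.Base
  open import Data.Nat.Properties
  open import Data.List.Base using ([]; _∷_)
  open import Data.Product.Base using (∃-syntax; _×_; _,_)
  open import Data.Sum.Base using (inj₁; inj₂)
  open import Relation.Binary.PropositionalEquality
  open import Defs using (triangle; ⟨_,_⟩; codeList)

  -- The counter passed to the step runs downwards to 0, because a counter program decrements the
  -- loop register before each pass and the body can then read that register as the counter.
  loop : ℕ → ℕ → (ℕ → ℕ → ℕ) → ℕ
  loop zero    acc s = acc
  loop (suc n) acc s = loop n (s n acc) s

  ifz : ℕ → ℕ → ℕ → ℕ
  ifz zero    a b = a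
  ifz (suc _) a b = b

  triangle-mono : ∀ {m n} → m ≤ n → triangle m ≤ triangle n
  triangle-mono z≤n     = z≤n
  triangle-mono (s≤s p) = +-mono-≤ (s≤s p) (triangle-mono p)

  n≤triangle : ∀ n → n ≤ triangle n
  n≤triangle zero    = z≤n
  n≤triangle (suc n) = m≤m+n (suc n) (triangle n)

  opaque
    -- Search for the largest d with `triangle d` ≤ k: d grows as long as the next triangular number
    -- still fits. Since d ≤ `triangle d`, k rounds are enough.
    diagonal : ℕ → ℕ
    diagonal k = loop k 0 (λ _ d → ifz (triangle (suc d) ∸ k) (suc d) d)

    pair : ℕ → ℕ → ℕ
    pair = ⟨_,_⟩

    pair-def : ∀ m n → pair m n ≡ ⟨ m , n ⟩
    pair-def m n = refl

    first second : ℕ → ℕ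
    second k = k ∸ triangle (diagonal k)
    first  k = diagonal k ∸ second k

    diagonal-unique : ∀ k D → triangle D ≤ k → k < triangle (suc D) → diagonal k ≡ D
    diagonal-unique k D low high = go k 0 z≤n (≤-trans (n≤triangle D) low)
      where
      go : ∀ i d → d ≤ D → D ≤ d + i → loop i d (λ _ d → ifz (triangle (suc d) ∸ k) (suc d) d) ≡ D
      go zero    d d≤D D≤d = ≤-antisym d≤D (subst (D ≤_) (+-identityʳ d) D≤d)
      go (suc i) d d≤D D≤d with m≤n⇒m<n∨m≡n d≤D
      ... | inj₁ d<D rewrite m≤n⇒m∸n≡0 (≤-trans (triangle-mono d<D) low) =
            go i (suc d) d<D (subst (D ≤_) (+-suc d i) D≤d)
      ... | inj₂ refl with triangle (suc d) ∸ k | m<n⇒0<n∸m high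
      ...   | suc _ | _ = go i d d≤D (m≤m+n d i)

    diagonal-pair : ∀ m n → diagonal (pair m n) ≡ m + n
    diagonal-pair m n = diagonal-unique (pair m n) (m + n) (m≤m+n _ n)
      (subst (pair m n <_) (+-comm (triangle (m + n)) (suc (m + n)))
        (+-monoʳ-< (triangle (m + n)) (s≤s (m≤n+m n m))))

    second-pair : ∀ m n → second (pair m n) ≡ n
    second-pair m n rewrite diagonal-pair m n = m+n∸m≡n (triangle (m + n)) n

    first-pair : ∀ m n → first (pair m n) ≡ m
    first-pair m n rewrite second-pair m n | diagonal-pair m n = m+n∸n≡m m n

    pair-injective : ∀ {m n m′ n′} → pair m n ≡ pair m′ n′ → m ≡ m′ × n ≡ n′
    pair-injective {m} {n} {m′} {n′} eq =
      trans (sym (first-pair m n)) (trans (cong first eq) (first-pair m′ n′)) ,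
      trans (sym (second-pair m n)) (trans (cong second eq) (second-pair m′ n′))

    -- Follows Cantor's enumeration: the successor of `pair (suc m) n` is `pair m (suc n)`, and from
    -- the end `pair 0 n` of a diagonal it jumps to `pair (suc n) 0`.
    pair-surjective : ∀ k → ∃[ m ] ∃[ n ] k ≡ pair m n
    pair-surjective zero    = 0 , 0 , refl
    pair-surjective (suc k) with pair-surjective k
    ... | zero  , n , refl = suc n , 0 , cong suc (trans (+-comm (triangle n) n)
            (sym (trans (+-identityʳ _) (cong (λ i → i + triangle i) (+-identityʳ n)))))
    ... | suc m , n , refl = m , suc n , trans (cong (λ i → suc (triangle i + n)) (sym (+-suc m n))) (sym (+-suc _ n))

    pair-eta : ∀ k → pair (first k) (second k) ≡ k
    pair-eta k with pair-surjective k
    ... | m , n , refl = cong₂ pair (first-pair m n) (second-pair m n)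

  ⟨⟩-injective : ∀ {m n m′ n′} → ⟨ m , n ⟩ ≡ ⟨ m′ , n′ ⟩ → m ≡ m′ × n ≡ n′
  ⟨⟩-injective {m} {n} {m′} {n′} eq = pair-injective (trans (pair-def m n) (trans eq (sym (pair-def m′ n′))))

  first≤pair : ∀ m n → m ≤ ⟨ m , n ⟩
  first≤pair m n = ≤-trans (≤-trans (m≤m+n m n) (n≤triangle (m + n))) (m≤m+n _ n)

  second≤pair : ∀ m n → n ≤ ⟨ m , n ⟩
  second≤pair m n = m≤n+m n _

  opaque
    cons : ℕ → ℕ → ℕ
    cons a l = suc (pair a l)

    head tail : ℕ → ℕ
    head l = first (pred l)
    tail l = second (pred l)

    head-cons : ∀ a l → head (cons a l) ≡ a
    head-cons = first-pair

    tail-cons : ∀ a l → tail (cons a l) ≡ l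
    tail-cons = second-pair

    cons-def : ∀ a l → cons a l ≡ suc ⟨ a , l ⟩
    cons-def a l = cong suc (pair-def a l)

  codeList-injective : ∀ {xs ys} → codeList xs ≡ codeList ys → xs ≡ ys
  codeList-injective {[]}     {[]}     eq = refl
  codeList-injective {x ∷ xs} {y ∷ ys} eq with ⟨⟩-injective {x} {codeList xs} {y} {codeList ys} (suc-injective eq)
  ... | refl , eq′ = cong (x ∷_) (codeList-injective eq′)

  codeList-surjective : ∀ k → ∃[ xs ] k ≡ codeList xs
  codeList-surjective k = go k k ≤-refl
    where
    go : ∀ b k → k ≤ b → ∃[ xs ] k ≡ codeList xs
    go b       zero    _       = [] , refl
    go (suc b) (suc k) (s≤s k≤b) with pair-surjective k
    ... | m , n , eq with trans eq (pair-def m n)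
    ...   | refl with go b n (≤-trans (second≤pair m n) k≤b)
    ...     | xs , refl = m ∷ xs , refl

-- Counter programs as transition tables of Turing machines

module Counter where

  open import Data.Bool.Base using (Bool; true; false; if_then_else_)
  open import Data.Fin.Base using (Fin; zero; suc; toℕ)
  import Data.Fin.Properties as Fin
  open import Data.List.Base using (List; []; _∷_; _++_; length; replicate)
  open import Data.List.Properties using (length-++)
  open import Data.List.Relation.Unary.All using (All; []; _∷_)
  open import Data.Maybe.Base using (just; nothing)
  open import Data.Nat.Base
  open import Data.Nat.Properties
  open import Data.Product.Base using (∃-syntax; _×_; _,_; proj₁; proj₂)
  open import Data.Unit.Base using (⊤; tt)
  open import Data.Vec.Base using (Vec; lookup; _[_]≔_)
  open import Data.Vec.Properties using (lookup∘update; lookup∘update′; []≔-idempotent)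
  open import Relation.Binary.Construct.Closure.ReflexiveTransitive using (Star; ε; _◅_; _◅◅_)
  open import Relation.Binary.PropositionalEquality hiding (inspect)
  open import Relation.Nullary using (yes; no)
  open import Defs using (Tape; tape; left; scanned; right; L; R; stay; marks; value; unary; Action; action; act; Row; inspect; query; Machine; machine; table; tapes; rowAt; Oracle; config; Step; inspecting; querying)

  infixr 5 _⨾_

  -- while r c decrements register r before every execution of c.
  data Cmd : Set where
    skip  : Cmd
    inc   : ℕ → Cmd
    while : ℕ → Cmd → Cmd
    _⨾_   : Cmd → Cmd → Cmd
    ask   : Cmd

  size width : Cmd → ℕ
  size skip        = 0
  size (inc r)     = 1
  size (while r c) = suc (size c + 2)
  size (c ⨾ d)     = size c + size d
  size ask         = 1
  width skip        = 0
  width (inc r)     = suc r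
  width (while r c) = suc r ⊔ width c
  width (c ⨾ d)     = width c ⊔ width d
  width ask         = 2

  -- Out-of-range registers are sent to the last tape. This never happens in a run, as `Runs` asks
  -- for at least `width c` tapes.
  clamp : ∀ n → ℕ → Fin (suc n)
  clamp n       zero    = zero
  clamp zero    (suc r) = zero
  clamp (suc n) (suc r) = suc (clamp n r)

  toℕ-clamp : ∀ {n r} → r < suc n → toℕ (clamp n r) ≡ r
  toℕ-clamp {n}     {zero}  _         = refl
  toℕ-clamp {suc n} {suc r} (s≤s r<n) = cong suc (toℕ-clamp r<n)

  enter leave : ℕ → Action
  enter e = action false L (suc e)
  leave q = action false R q

  -- The head of a register rests on the blank behind its block of marks, so a test for zero must
  -- move left before looking. In a loop, row `o` does this on entry and row `e` after each pass of
  -- the body; both lead to row `suc e`. There a mark is erased, which is the decrement and leaves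
  -- the head in resting position, while a blank makes the head step back and leave.
  rows : ∀ w → ℕ → Cmd → List (Row (2 + w))
  rows w o skip        = []
  rows w o (inc r)     = inspect (clamp _ r) (action true R (o + 1)) (action true R (o + 1)) ∷ []
  rows w o (while r c) = inspect t (enter e) (enter e) ∷ rows w (suc o) c ++
      inspect t (enter e) (enter e) ∷
      inspect t (leave (o + size (while r c))) (action false stay (suc o)) ∷ []
    where
    t = clamp _ r
    e = suc o + size c
  rows w o (c ⨾ d)     = rows w o c ++ rows w (o + size c) d
  rows w o ask         = query (o + 1) ∷ []

  length-rows : ∀ w o c → length (rows w o c) ≡ size c
  length-rows w o skip        = refl
  length-rows w o (inc r)     = refl
  length-rows w o (while r c) = cong suc (trans (length-++ (rows w (suc o) c)) (cong (_+ 2) (length-rows w (suc o) c)))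
  length-rows w o (c ⨾ d)     = trans (length-++ (rows w o c)) (cong₂ _+_ (length-rows w o c) (length-rows w _ d))
  length-rows w o ask         = refl

  Located : ∀ {k} → List (Row k) → ℕ → List (Row k) → Set
  Located table o []       = ⊤
  Located table o (r ∷ rs) = rowAt table o ≡ just r × Located table (suc o) rs

  located-++ : ∀ {k} {table : List (Row k)} o rs {rs′} → Located table o (rs ++ rs′) →
    Located table o rs × Located table (o + length rs) rs′
  located-++ {table = table} o [] {rs′} l = tt , subst (λ o → Located table o rs′) (sym (+-identityʳ o)) l
  located-++ {table = table} o (r ∷ rs) {rs′} (eq , l) with located-++ (suc o) rs l
  ... | l₁ , l₂ = (eq , l₁) , subst (λ o → Located table o rs′) (sym (+-suc o (length rs))) l₂

  rowAt-here : ∀ {k} (pre : List (Row k)) r rs → rowAt (pre ++ r ∷ rs) (length pre) ≡ just r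
  rowAt-here []        r rs = refl
  rowAt-here (_ ∷ pre) r rs = rowAt-here pre r rs

  located-after : ∀ {k} (pre rs : List (Row k)) → Located (pre ++ rs) (length pre) rs
  located-after pre []       = tt
  located-after pre (r ∷ rs) = rowAt-here pre r rs ,
    subst₂ (λ t o → Located t o rs) (assoc pre) (trans (length-++ pre) (+-comm (length pre) 1))
      (located-after (pre ++ r ∷ []) rs)
    where
    assoc : ∀ pre → (pre ++ r ∷ []) ++ rs ≡ pre ++ r ∷ rs
    assoc []        = refl
    assoc (_ ∷ pre) = cong (_ ∷_) (assoc pre)

  rowAt-length : ∀ {k} (rs : List (Row k)) → rowAt rs (length rs) ≡ nothing
  rowAt-length []       = refl
  rowAt-length (_ ∷ rs) = rowAt-length rs

  Blank : List Bool → Set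
  Blank = All (_≡ false)

  data Ones : ℕ → List Bool → Set where
    blank : ∀ {l} → Blank l → Ones 0 l
    one   : ∀ {n l} → Ones n l → Ones (suc n) (true ∷ l)

  -- Equality with `unary n` would be too strong: head movements leave explicit blank cells in the
  -- two lists.
  record Holds (n : ℕ) (t : Tape) : Set where
    constructor holds
    field
      ones  : Ones n (left t)
      empty : scanned t ≡ false
      rest  : Blank (right t)

  HoldsAll : ∀ {k} → (ℕ → ℕ) → Vec Tape k → Set
  HoldsAll σ ts = ∀ i → Holds (σ (toℕ i)) (lookup ts i)

  holds-unary : ∀ n → Holds n (unary n)
  holds-unary n = holds (go n) refl []
    where
    go : ∀ n → Ones n (replicate n true)
    go zero    = blank []
    go (suc n) = one (go n)

  marks-blank : ∀ {l} → Blank l → marks l ≡ 0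
  marks-blank []         = refl
  marks-blank (refl ∷ b) = marks-blank b

  value-holds : ∀ {n t} → Holds n t → value t ≡ n
  value-holds {n} {tape l false r} (holds o refl b) rewrite marks-blank b = trans (+-identityʳ (marks l)) (go o)
    where
    go : ∀ {n l} → Ones n l → marks l ≡ n
    go (blank b) = marks-blank b
    go (one o)   = cong suc (go o)

  holds-inc : ∀ {n t q} → Holds n t → Holds (suc n) (act (action true R q) t)
  holds-inc {t = tape l b []}         (holds o e [])         = holds (one o) refl []
  holds-inc {t = tape l b (.false ∷ r)} (holds o e (refl ∷ bs)) = holds (one o) refl bs

  entered : ∀ {n t q} → Holds (suc n) t → scanned (act (enter q) t) ≡ true
  entered {t = tape (true ∷ l) b r} (holds (one o) _ _) = refl

  entered-zero : ∀ {t q} → Holds 0 t → scanned (act (enter q) t) ≡ false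
  entered-zero {t = tape [] b r}          (holds _ _ _)                  = refl
  entered-zero {t = tape (.false ∷ l) b r} (holds (blank (refl ∷ _)) _ _) = refl

  holds-dec : ∀ {n t q q′} → Holds (suc n) t → Holds n (act (action false stay q′) (act (enter q) t))
  holds-dec {t = tape (true ∷ l) b r} (holds (one o) e bs) = holds o refl (refl ∷ bs)

  holds-zero : ∀ {t q q′} → Holds 0 t → Holds 0 (act (leave q′) (act (enter q) t))
  holds-zero {t = tape [] b r}           (holds _ e bs)                  = holds (blank (refl ∷ [])) refl bs
  holds-zero {t = tape (.false ∷ l) b r} (holds (blank (refl ∷ z)) e bs) = holds (blank (refl ∷ z)) refl bs

  Sets : (ℕ → ℕ) → ℕ → ℕ → (ℕ → ℕ) → Set
  Sets σ r v σ′ = σ′ r ≡ v × ∀ x → x ≢ r → σ′ x ≡ σ x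

  holdsAll-set : ∀ {n σ r v σ′ t} (ts : Vec Tape (suc n)) → r < suc n → Sets σ r v σ′ →
    HoldsAll σ ts → Holds v t → HoldsAll σ′ (ts [ clamp n r ]≔ t)
  holdsAll-set {n} {r = r} {t = t} ts r<n (eq , same) h ht i with i Fin.≟ clamp n r
  ... | yes refl rewrite lookup∘update i ts t | toℕ-clamp r<n | eq = ht
  ... | no i≢ rewrite lookup∘update′ i≢ ts t | same (toℕ i) (λ e → i≢ (Fin.toℕ-injective (trans e (sym (toℕ-clamp r<n))))) = h i

  module _ {M : Machine} {O : Oracle} {q : ℕ} {ts : Vec Tape (tapes M)} {t : Fin (tapes M)} {a₀ a₁ : Action} where

    step-blank : rowAt (table M) q ≡ just (inspect t a₀ a₁) → scanned (lookup ts t) ≡ false →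
      Step M O (config q ts) (config (Action.next a₀) (ts [ t ]≔ act a₀ (lookup ts t)))
    step-blank row eq = subst
      (λ b → let a = if b then a₁ else a₀ in
        Step M O (config q ts) (config (Action.next a) (ts [ t ]≔ act a (lookup ts t)))) eq (inspecting row)

    step-mark : rowAt (table M) q ≡ just (inspect t a₀ a₁) → scanned (lookup ts t) ≡ true →
      Step M O (config q ts) (config (Action.next a₁) (ts [ t ]≔ act a₁ (lookup ts t)))
    step-mark row eq = subst
      (λ b → let a = if b then a₁ else a₀ in
        Step M O (config q ts) (config (Action.next a) (ts [ t ]≔ act a (lookup ts t)))) eq (inspecting row)

  module _ (O : Oracle) where

    Reaches : ∀ {w} → List (Row (2 + w)) → ℕ → (ℕ → ℕ) → ℕ → (ℕ → ℕ) → Set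
    Reaches {w} table q σ q′ σ′ = ∀ ts → HoldsAll σ ts →
      ∃[ ts′ ] (HoldsAll σ′ ts′ × Star (Step (machine w table) O) (config q ts) (config q′ ts′))

    -- The quantification over all tables containing the rows of c at any address, with any number
    -- of further tapes, is what makes runs of parts compose inside a larger program.
    record Runs (c : Cmd) (σ σ′ : ℕ → ℕ) : Set where
      constructor runs
      field
        run : ∀ {w table o} → width c ≤ 2 + w → Located table o (rows w o c) →
          Reaches table o σ (o + size c) σ′
    open Runs public

    -- The loop is entered from two places, its first row and the row behind its body. Leaving the
    -- row q open, up to its content, gives a statement that can be proved by induction on the
    -- passes.
    record Repeats (r : ℕ) (c : Cmd) (σ σ′ : ℕ → ℕ) : Set where
      constructor repeats
      field
        repeat : ∀ {w table o q} → width (while r c) ≤ 2 + w → Located table o (rows w o (while r c)) →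
          rowAt table q ≡ just (inspect (clamp _ r) (enter (suc o + size c)) (enter (suc o + size c))) →
          Reaches table q σ (o + size (while r c)) σ′
    open Repeats public

    runs-skip : ∀ {σ σ′} → (∀ x → σ′ x ≡ σ x) → Runs skip σ σ′
    runs-skip {σ} {σ′} eq = runs λ {w} {table} {o} _ _ ts h →
      ts , (λ i → subst (λ n → Holds n _) (sym (eq (toℕ i))) (h i)) ,
      subst (λ q → Star (Step (machine w table) O) (config o ts) (config q ts)) (sym (+-identityʳ o)) ε

    runs-inc : ∀ {r σ σ′} → Sets σ r (suc (σ r)) σ′ → Runs (inc r) σ σ′
    runs-inc {r} {σ} set = runs λ {w} {table} {o} w≤ (row , _) ts h →
      let h′ = subst (λ x → Holds (σ x) (lookup ts (clamp _ r))) (toℕ-clamp w≤) (h (clamp _ r))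
      in _ , holdsAll-set ts w≤ set h (holds-inc {q = o + 1} h′) ,
         step-blank row (Holds.empty {t = lookup ts (clamp _ r)} h′) ◅ ε

    runs-⨾ : ∀ {c d σ σ′ σ″} → Runs c σ σ′ → Runs d σ′ σ″ → Runs (c ⨾ d) σ σ″
    runs-⨾ {c} {d} {σ} {σ′} {σ″} f g = runs go
      where
      go : ∀ {w table o} → width (c ⨾ d) ≤ 2 + w → Located table o (rows w o (c ⨾ d)) →
        Reaches table o σ (o + size (c ⨾ d)) σ″
      go {w} {table} {o} w≤ l ts h with located-++ o (rows w o c) l
      ... | l₁ , l₂ with run f (m⊔n≤o⇒m≤o (width c) (width d) w≤) l₁ ts h
      ...   | ts′ , h′ , s with run g (m⊔n≤o⇒n≤o (width c) (width d) w≤)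
                (subst (λ n → Located table (o + n) (rows w (o + size c) d)) (length-rows w o c) l₂) ts′ h′
      ...     | ts″ , h″ , s′ rewrite +-assoc o (size c) (size d) = ts″ , h″ , s ◅◅ s′

    runs-ask : ∀ {σ σ′ a} → O (σ 1) a → Sets σ 1 a σ′ → Runs ask σ σ′
    runs-ask {σ} {σ′} {a} answer set = runs λ w≤ (row , _) ts h →
      _ , holdsAll-set ts (s≤s (s≤s z≤n)) set h (holds-unary a) ,
      querying row (subst (λ n → O n a) (sym (value-holds (h (suc zero)))) answer) ◅ ε

    module _ {r : ℕ} {c : Cmd} {w : ℕ} {table : List (Row (2 + w))} {o q : ℕ} (w≤ : width (while r c) ≤ 2 + w) (l : Located table o (rows w o (while r c)))
      (row : rowAt table q ≡ just (inspect (clamp _ r) (enter (suc o + size c)) (enter (suc o + size c))))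
      (ts : Vec Tape (2 + w)) where

      private
        t = clamp (suc w) r
        e = suc o + size c
        ts₁ = ts [ t ]≔ act (enter e) (lookup ts t)

        r<w : r < 2 + w
        r<w = m⊔n≤o⇒m≤o (suc r) (width c) w≤

        stay′ = action false stay (suc o)

        test : Located table e (inspect t (enter e) (enter e) ∷ inspect t (leave (o + size (while r c))) stay′ ∷ [])
        test = subst (λ n → Located table (suc o + n) (inspect t (enter e) (enter e) ∷ inspect t (leave (o + size (while r c))) stay′ ∷ [])) (length-rows w (suc o) c)
                 (proj₂ (located-++ (suc o) (rows w (suc o) c) (proj₂ l)))

        look : lookup ts₁ t ≡ act (enter e) (lookup ts t)
        look = lookup∘update t ts _

        here : ∀ {n σ} → σ r ≡ n → HoldsAll σ ts → Holds n (lookup ts t)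
        here {σ = σ} eq h = subst (λ x → Holds x (lookup ts t)) (trans (cong σ (toℕ-clamp r<w)) eq) (h t)

        again : ∀ {v σ σ′} a → Sets σ r v σ′ → HoldsAll σ ts → Holds v (act a (act (enter e) (lookup ts t))) →
          HoldsAll σ′ (ts₁ [ t ]≔ act a (lookup ts₁ t))
        again {σ′ = σ′} a set h hv rewrite look =
          subst (HoldsAll σ′) (sym ([]≔-idempotent ts t)) (holdsAll-set ts r<w set h hv)

      while-exit : ∀ {σ} → σ r ≡ 0 → HoldsAll σ ts →
        ∃[ ts′ ] (HoldsAll σ ts′ × Star (Step (machine w table) O) (config q ts) (config (o + size (while r c)) ts′))
      while-exit {σ} eq h = _ , again (leave (o + size (while r c))) (eq , λ _ _ → refl) h (holds-zero {lookup ts t} {e} {o + size (while r c)} (here eq h)) ,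
        step-blank row (Holds.empty {t = lookup ts t} (here eq h)) ◅
        step-blank (proj₁ (proj₂ test)) (trans (cong scanned look) (entered-zero {lookup ts t} {e} (here eq h))) ◅ ε

      while-enter : ∀ {n σ σ′} → σ r ≡ suc n → Sets σ r n σ′ → HoldsAll σ ts →
        ∃[ ts′ ] (HoldsAll σ′ ts′ × Star (Step (machine w table) O) (config q ts) (config (suc o) ts′))
      while-enter {σ} eq set h = _ , again stay′ set h (holds-dec {t = lookup ts t} {e} {suc o} (here eq h)) ,
        step-blank row (Holds.empty {t = lookup ts t} (here eq h)) ◅
        step-mark (proj₁ (proj₂ test)) (trans (cong scanned look) (entered {t = lookup ts t} {e} (here eq h))) ◅ ε

    repeats-zero : ∀ {r c σ} → σ r ≡ 0 → Repeats r c σ σ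
    repeats-zero {c = c} eq = repeats λ w≤ l row ts h → while-exit {c = c} w≤ l row ts eq h

    repeats-suc : ∀ {r c n σ σ₁ σ₂ σ₃} → σ r ≡ suc n → Sets σ r n σ₁ → Runs c σ₁ σ₂ → Repeats r c σ₂ σ₃ →
      Repeats r c σ σ₃
    repeats-suc {r} {c} {n} {σ} {σ₁} {σ₂} {σ₃} eq set f rep = repeats go
      where
      go : ∀ {w table o q} → width (while r c) ≤ 2 + w → Located table o (rows w o (while r c)) →
        rowAt table q ≡ just (inspect (clamp _ r) (enter (suc o + size c)) (enter (suc o + size c))) →
        Reaches table q σ (o + size (while r c)) σ₃
      go {w} {table} {o} w≤ l row ts h with while-enter {c = c} w≤ l row ts eq set h
                                          | located-++ (suc o) (rows w (suc o) c) (proj₂ l)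
      ... | ts₁ , h₁ , s₁ | l₁ , l₂ with run f (m⊔n≤o⇒n≤o (suc r) (width c) w≤) l₁ ts₁ h₁
      ...   | ts₂ , h₂ , s₂ with repeat rep w≤ l
                (subst (λ n → rowAt table (suc o + n) ≡ just (inspect (clamp _ r) (enter (suc o + size c)) (enter (suc o + size c))))
                  (length-rows w (suc o) c) (proj₁ l₂)) ts₂ h₂
      ...     | ts₃ , h₃ , s₃ = ts₃ , h₃ , s₁ ◅◅ s₂ ◅◅ s₃

    runs-while : ∀ {r c σ σ′} → Repeats r c σ σ′ → Runs (while r c) σ σ′
    runs-while rep = runs λ w≤ l → repeat rep w≤ l (proj₁ l)

-- A language of bounded iteration and its compiler

module Program where

  open import Data.Fin.Base using (Fin; zero; suc)
  open import Data.Nat.Base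
  open import Data.Nat.Properties
  open import Data.Product.Base using (∃-syntax; _×_; _,_; proj₁; proj₂)
  open import Data.Vec.Base using (Vec; []; _∷_; lookup; map)
  open import Relation.Binary.PropositionalEquality
  open import Relation.Binary.Definitions using (tri<; tri≈; tri>)
  open import Relation.Nullary using (yes; no; contradiction)
  open import Defs using (Oracle)
  open Pairing using (loop)
  open Counter

  mutual
    -- In iter e₁ e₂ b the body b sees the accumulator as variable 0 and the
    -- number of iterations still to come as variable 1.  A call carries the
    -- function f that its body e is known to compute, so that evaluation
    -- does not unfold e.
    data Exp : ℕ → Set where
      var  : ∀ {n} → Fin n → Exp n
      lit  : ∀ {n} → ℕ → Exp n
      succ : ∀ {n} → Exp n → Exp n
      iter : ∀ {n} → Exp n → Exp n → Exp (2 + n) → Exp n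
      call : ∀ {m n} (f : Vec ℕ m → ℕ) (e : Exp m) → (∀ ρ → eval e ρ ≡ f ρ) → Vec (Exp n) m → Exp n

    eval : ∀ {n} → Exp n → Vec ℕ n → ℕ
    eval (var i)        ρ = lookup ρ i
    eval (lit k)        ρ = k
    eval (succ e)       ρ = suc (eval e ρ)
    eval (iter e₁ e₂ b) ρ = loop (eval e₁ ρ) (eval e₂ ρ) (λ n acc → eval b (acc ∷ n ∷ ρ))
    eval (call f e _ es) ρ = f (evals es ρ)

    evals : ∀ {m n} → Vec (Exp n) m → Vec ℕ n → Vec ℕ m
    evals []       ρ = []
    evals (e ∷ es) ρ = eval e ρ ∷ evals es ρ

  clear : ℕ → Cmd
  clear r = while r skip

  transfer : ℕ → ℕ → Cmd
  transfer r s = while r (inc s)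

  clearFrom : ℕ → ℕ → Cmd
  clearFrom d zero    = skip
  clearFrom d (suc m) = clear d ⨾ clearFrom (suc d) m

  incs : ℕ → ℕ → Cmd
  incs zero    d = skip
  incs (suc k) d = inc d ⨾ incs k d

  interval : ℕ → ∀ m → Vec ℕ m
  interval d zero    = []
  interval d (suc m) = d ∷ interval (suc d) m

  -- compile e env d puts the value of e into register d, using registers
  -- from d on (initially zero) and reading variables from registers env.
  compile  : ∀ {n} → Exp n → Vec ℕ n → ℕ → Cmd
  compiles : ∀ {m n} → Vec (Exp n) m → Vec ℕ n → ℕ → Cmd
  -- Reading a register empties it, so the value is written twice and one copy is moved back.
  compile (var i)        env d = while (lookup env i) (inc d ⨾ inc (suc d)) ⨾ transfer (suc d) (lookup env i)
  compile (lit k)        env d = incs k d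
  compile (succ e)       env d = compile e env d ⨾ inc d
  -- Register `d` counts down, `suc d` holds the accumulator and `2 + d` receives its next value;
  -- the old accumulator is cleared only after the body has read it.
  compile (iter e₁ e₂ b) env d = compile e₁ env d ⨾ compile e₂ env (suc d) ⨾
    while d (compile b (suc d ∷ d ∷ env) (2 + d) ⨾ clear (suc d) ⨾ transfer (2 + d) (suc d)) ⨾
    transfer (suc d) d
  -- The arguments fill `d` to `m + d - 1`. The result goes one register further than the first free
  -- one, so that it differs from `d` even when m = 0.
  compile (call {m} f e _ es) env d =
    compiles es env d ⨾ compile e (interval d m) (suc (m + d)) ⨾ clearFrom d m ⨾ transfer (suc (m + d)) d
  compiles []       env d = skip
  compiles (e ∷ es) env d = compile e env d ⨾ compiles es env (suc d)

  set : (ℕ → ℕ) → ℕ → ℕ → ℕ → ℕ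
  set σ r v x with x ≟ r
  ... | yes _ = v
  ... | no _  = σ x

  sets : ∀ σ r v → Sets σ r v (set σ r v)
  sets σ r v = same , other
    where
    same : set σ r v r ≡ v
    same with r ≟ r
    ... | yes _  = refl
    ... | no r≢r = contradiction refl r≢r
    other : ∀ x → x ≢ r → set σ r v x ≡ σ x
    other x x≢r with x ≟ r
    ... | yes x≡r = contradiction x≡r x≢r
    ... | no _    = refl

  Fresh : (ℕ → ℕ) → ℕ → Set
  Fresh σ d = ∀ x → d ≤ x → σ x ≡ 0

  Below : ∀ {n} → Vec ℕ n → ℕ → Set
  Below env d = ∀ i → lookup env i < d

  map-agree : ∀ {n} (env : Vec ℕ n) {d} {σ σ′ : ℕ → ℕ} → Below env d → (∀ x → x < d → σ′ x ≡ σ x) → map σ′ env ≡ map σ env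
  map-agree []        below eq = refl
  map-agree (x ∷ env) below eq = cong₂ _∷_ (eq x (below zero)) (map-agree env (λ i → below (suc i)) eq)

  lookup-map′ : ∀ {n} (env : Vec ℕ n) {σ : ℕ → ℕ} i → lookup (map σ env) i ≡ σ (lookup env i)
  lookup-map′ (x ∷ env) zero    = refl
  lookup-map′ (x ∷ env) (suc i) = lookup-map′ env i

  fresh-set : ∀ {σ σ′ d v} → Fresh σ d → Sets σ d v σ′ → Fresh σ′ (suc d)
  fresh-set fresh (_ , other) x d<x = trans (other x (λ { refl → <-irrefl refl d<x })) (fresh x (<⇒≤ d<x))

  agree-set : ∀ {σ σ′ d v} → Sets σ d v σ′ → ∀ x → x < d → σ′ x ≡ σ x
  agree-set (_ , other) x x<d = other x (λ { refl → <-irrefl refl x<d })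

  below-suc : ∀ {n} {env : Vec ℕ n} {d} → Below env d → Below env (suc d)
  below-suc b i = m≤n⇒m≤1+n (b i)

  module _ (O : Oracle) where

    Sends : Cmd → (ℕ → ℕ) → ((ℕ → ℕ) → Set) → Set
    Sends c σ P = ∃[ σ′ ] (Runs O c σ σ′ × P σ′)

    -- A Hoare rule with an invariant indexed by the passes still to come. The body has to return
    -- the loop register as it found it.
    sends-while : ∀ {r c} (P : ℕ → (ℕ → ℕ) → Set) →
      (∀ n σ → σ r ≡ suc n → P (suc n) σ → Sends c (set σ r n) (λ σ′ → σ′ r ≡ n × P n σ′)) →
      ∀ σ → P (σ r) σ → Sends (while r c) σ (λ σ′ → σ′ r ≡ 0 × P 0 σ′)
    sends-while {r} {c} P body σ p with go (σ r) σ refl p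
      where
      go : ∀ n σ → σ r ≡ n → P n σ → ∃[ σ′ ] (Repeats O r c σ σ′ × σ′ r ≡ 0 × P 0 σ′)
      go zero    σ eq p = σ , repeats-zero O eq , eq , p
      go (suc n) σ eq p with body n σ eq p
      ... | σ₁ , run , eq₁ , p₁ with go n σ₁ eq₁ p₁
      ...   | σ₂ , rep , eq₂ , p₂ = σ₂ , repeats-suc O eq (sets σ r n) run rep , eq₂ , p₂
    ... | σ′ , rep , eq , q = σ′ , runs-while O rep , eq , q

    sends-⨾ : ∀ {c d σ P Q} → Sends c σ P → (∀ {σ′} → P σ′ → Sends d σ′ Q) → Sends (c ⨾ d) σ Q
    sends-⨾ (σ′ , run , p) next with next p
    ... | σ″ , run′ , q = σ″ , runs-⨾ O run run′ , q

    sends-weaken : ∀ {c σ P Q} → Sends c σ P → (∀ {σ′} → P σ′ → Q σ′) → Sends c σ Q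
    sends-weaken (σ′ , run , p) f = σ′ , run , f p

    sends-inc : ∀ r σ → Sends (inc r) σ (Sets σ r (suc (σ r)))
    sends-inc r σ = set σ r (suc (σ r)) , runs-inc O {r} (sets σ r _) , sets σ r _

    sends-clear : ∀ r σ → Sends (clear r) σ (Sets σ r 0)
    sends-clear r σ = sends-weaken (sends-while (λ _ σ′ → ∀ x → x ≢ r → σ′ x ≡ σ x)
      (λ n σ′ eq p → set σ′ r n , runs-skip O (λ _ → refl) , proj₁ (sets σ′ r n) ,
        λ x x≢r → trans (proj₂ (sets σ′ r n) x x≢r) (p x x≢r)) σ (λ _ _ → refl)) λ p → p

    Transferred : (ℕ → ℕ) → ℕ → ℕ → (ℕ → ℕ) → Set
    Transferred σ r s σ′ = σ′ r ≡ 0 × σ′ s ≡ σ s + σ r × ∀ x → x ≢ r → x ≢ s → σ′ x ≡ σ x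

    sends-transfer : ∀ r s σ → s ≢ r → Sends (transfer r s) σ (Transferred σ r s)
    sends-transfer r s σ s≢r = sends-weaken (sends-while
        (λ n σ′ → σ′ s + n ≡ σ s + σ r × ∀ x → x ≢ r → x ≢ s → σ′ x ≡ σ x)
        (λ n σ′ eq p → sends-weaken (sends-inc s (set σ′ r n)) λ q → body n σ′ p q)
        σ (refl , λ _ _ _ → refl))
      λ (z , eq , p) → z , trans (sym (+-identityʳ _)) eq , p
      where
      body : ∀ n σ′ {σ″} → σ′ s + suc n ≡ σ s + σ r × (∀ x → x ≢ r → x ≢ s → σ′ x ≡ σ x) →
        Sets (set σ′ r n) s (suc (set σ′ r n s)) σ″ →
        σ″ r ≡ n × σ″ s + n ≡ σ s + σ r × ∀ x → x ≢ r → x ≢ s → σ″ x ≡ σ x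
      body n σ′ (sum , other) (eq , same) =
        trans (same r (λ e → s≢r (sym e))) (proj₁ (sets σ′ r n)) ,
        trans (cong (_+ n) (trans eq (cong suc (proj₂ (sets σ′ r n) s s≢r)))) (trans (sym (+-suc _ n)) sum) ,
        λ x x≢r x≢s → trans (same x x≢s) (trans (proj₂ (sets σ′ r n) x x≢r) (other x x≢r x≢s))

    sends-incs : ∀ k d σ → Sends (incs k d) σ (Sets σ d (k + σ d))
    sends-incs zero    d σ = σ , runs-skip O (λ _ → refl) , refl , λ _ _ → refl
    sends-incs (suc k) d σ = sends-⨾ (sends-inc d σ) λ {σ₁} (eq , same) →
      sends-weaken (sends-incs k d σ₁) λ (eq′ , same′) →
        trans eq′ (trans (cong (k +_) eq) (+-suc k (σ d))) , λ x x≢d → trans (same′ x x≢d) (same x x≢d)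

    sends-clearFrom : ∀ d m σ → Sends (clearFrom d m) σ
      (λ σ′ → (∀ x → d ≤ x → x < m + d → σ′ x ≡ 0) × (∀ x → x < d → σ′ x ≡ σ x) × (∀ x → m + d ≤ x → σ′ x ≡ σ x))
    sends-clearFrom d zero    σ = σ , runs-skip O (λ _ → refl) ,
      (λ x d≤x x<d → contradiction (<-≤-trans x<d d≤x) (<-irrefl refl)) , (λ _ _ → refl) , (λ _ _ → refl)
    sends-clearFrom d (suc m) σ = sends-⨾ (sends-clear d σ) λ {σ₁} (eq , same) →
      sends-weaken (sends-clearFrom (suc d) m σ₁) λ {σ₂} (mid , low , high) →
        (λ x d≤x x< → middle σ₁ σ₂ eq mid low x d≤x x<) ,
        (λ x x<d → trans (low x (m≤n⇒m≤1+n x<d)) (same x (<⇒≢ x<d))) ,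
        (λ x ≤x → trans (high x (subst (_≤ x) (sym (+-suc m d)) ≤x))
                    (same x (λ { refl → <-irrefl refl (≤-trans (s≤s (m≤n+m d m)) ≤x) })))
      where
      middle : ∀ σ₁ σ₂ → σ₁ d ≡ 0 → (∀ x → suc d ≤ x → x < m + suc d → σ₂ x ≡ 0) →
        (∀ x → x < suc d → σ₂ x ≡ σ₁ x) → ∀ x → d ≤ x → x < suc m + d → σ₂ x ≡ 0
      middle σ₁ σ₂ eq mid low x d≤x x< with x ≟ d
      ... | yes refl = trans (low x (n<1+n x)) eq
      ... | no x≢d   = mid x (≤∧≢⇒< d≤x (λ e → x≢d (sym e))) (subst (x <_) (sym (+-suc m d)) x<)

    interval-range : ∀ d m i → d ≤ lookup (interval d m) i × lookup (interval d m) i < m + d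
    interval-range d (suc m) zero    = ≤-refl , s≤s (m≤n+m d m)
    interval-range d (suc m) (suc i) with interval-range (suc d) m i
    ... | l , u = ≤-trans (n≤1+n d) l , subst (lookup (interval (suc d) m) i <_) (+-suc m d) u

    Evaluated : ∀ {m} → (ℕ → ℕ) → ℕ → Vec ℕ m → (ℕ → ℕ) → Set
    Evaluated {m} σ d vs σ′ = map σ′ (interval d m) ≡ vs × (∀ x → x < d → σ′ x ≡ σ x) × Fresh σ′ (m + d)

    -- That no register but d changes includes the scratch registers above d, which return to zero;
    -- this hands `Fresh` on to whatever code follows.
    sends-compile : ∀ {n} (e : Exp n) env d σ → Fresh σ d → Below env d →
      Sends (compile e env d) σ (Sets σ d (eval e (map σ env)))
    sends-compiles : ∀ {m n} (es : Vec (Exp n) m) env d σ → Fresh σ d → Below env d →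
      Sends (compiles es env d) σ (Evaluated σ d (evals es (map σ env)))

    sends-compile (var i) env d σ fresh below = sends-⨾ (sends-while {c = inc d ⨾ inc (suc d)} P
        (λ n σ′ eq p → sends-⨾ (sends-inc d (set σ′ x n)) λ {σ₁} q →
          sends-weaken (sends-inc (suc d) σ₁) λ q′ → body n σ′ p q q′)
        σ (cong (_+ σ x) (fresh d ≤-refl) , cong (_+ σ x) (fresh (suc d) (n≤1+n d)) , λ _ _ _ _ → refl))
      λ {σ₁} (z , eq , eq′ , same) → sends-weaken (sends-transfer (suc d) x σ₁ x≢d+1)
        λ {σ₂} (z′ , eqx , same′) → finish σ₁ σ₂ z eq eq′ same z′ eqx same′
      where
      x = lookup env i
      x≢d : x ≢ d
      x≢d = <⇒≢ (below i)
      x≢d+1 : x ≢ suc d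
      x≢d+1 = <⇒≢ (m≤n⇒m≤1+n (below i))
      P : ℕ → (ℕ → ℕ) → Set
      P n σ′ = σ′ d + n ≡ σ x × σ′ (suc d) + n ≡ σ x × ∀ y → y ≢ x → y ≢ d → y ≢ suc d → σ′ y ≡ σ y
      body : ∀ n σ′ {σ₁ σ₂} → P (suc n) σ′ → Sets (set σ′ x n) d (suc (set σ′ x n d)) σ₁ →
        Sets σ₁ (suc d) (suc (σ₁ (suc d))) σ₂ → σ₂ x ≡ n × P n σ₂
      body n σ′ (eq , eq′ , same) (v , o) (v′ , o′) =
        trans (o′ x x≢d+1) (trans (o x x≢d) (proj₁ (sets σ′ x n))) ,
        trans (cong (_+ n) (trans (o′ d (<⇒≢ (n<1+n d))) (trans v (cong suc (proj₂ (sets σ′ x n) d (≢-sym x≢d))))))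
          (trans (sym (+-suc _ n)) eq) ,
        trans (cong (_+ n) (trans v′ (cong suc (trans (o (suc d) (≢-sym (<⇒≢ (n<1+n d))))
            (proj₂ (sets σ′ x n) (suc d) (≢-sym x≢d+1))))))
          (trans (sym (+-suc _ n)) eq′) ,
        λ y y≢x y≢d y≢d+1 → trans (o′ y y≢d+1) (trans (o y y≢d) (trans (proj₂ (sets σ′ x n) y y≢x) (same y y≢x y≢d y≢d+1)))
      finish : ∀ σ₁ σ₂ → σ₁ x ≡ 0 → σ₁ d + 0 ≡ σ x → σ₁ (suc d) + 0 ≡ σ x →
        (∀ y → y ≢ x → y ≢ d → y ≢ suc d → σ₁ y ≡ σ y) → σ₂ (suc d) ≡ 0 → σ₂ x ≡ σ₁ x + σ₁ (suc d) →
        (∀ y → y ≢ suc d → y ≢ x → σ₂ y ≡ σ₁ y) → Sets σ d (lookup (map σ env) i) σ₂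
      finish σ₁ σ₂ z eq eq′ same z′ eqx same′ =
        trans (same′ d (<⇒≢ (n<1+n d)) (≢-sym x≢d)) (trans (sym (+-identityʳ _)) (trans eq (sym (lookup-map′ env i)))) , other
        where
        other : ∀ y → y ≢ d → σ₂ y ≡ σ y
        other y y≢d with y ≟ x | y ≟ suc d
        ... | yes refl | _ = trans eqx (trans (cong (_+ σ₁ (suc d)) z) (trans (sym (+-identityʳ _)) eq′))
        ... | no _ | yes refl = trans z′ (sym (fresh (suc d) (n≤1+n d)))
        ... | no y≢x | no y≢d+1 = trans (same′ y y≢d+1 y≢x) (same y y≢x y≢d y≢d+1)
    sends-compile (lit k) env d σ fresh below = sends-weaken (sends-incs k d σ)
      λ (eq , same) → trans eq (trans (cong (k +_) (fresh d ≤-refl)) (+-identityʳ k)) , same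
    sends-compile (succ e) env d σ fresh below = sends-⨾ (sends-compile e env d σ fresh below)
      λ {σ₁} (eq , same) → sends-weaken (sends-inc d σ₁)
      λ (eq′ , same′) → trans eq′ (cong suc eq) , λ x x≢d → trans (same′ x x≢d) (same x x≢d)
    sends-compile (iter e₁ e₂ b) env d σ fresh below =
      sends-⨾ (sends-compile e₁ env d σ fresh below) λ {σ₁} p₁ →
      sends-⨾ (sends-compile e₂ env (suc d) σ₁ (fresh-set fresh p₁) (below-suc {env = env} below)) λ {σ₂} p₂ →
      sends-⨾ (sends-while {c = body} P step σ₂ (start σ₁ σ₂ p₁ p₂)) λ {σ₃} p₃ →
      sends-weaken (sends-transfer (suc d) d σ₃ (<⇒≢ (n<1+n d))) λ {σ₄} p₄ → finish σ₃ σ₄ p₃ p₄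
      where
      body = compile b (suc d ∷ d ∷ env) (2 + d) ⨾ clear (suc d) ⨾ transfer (2 + d) (suc d)
      s : ℕ → ℕ → ℕ
      s n acc = eval b (acc ∷ n ∷ map σ env)
      v = eval (iter e₁ e₂ b) (map σ env)
      -- Invariant: the passes still to come, started from the present accumulator, lead to the
      -- final value v.
      P : ℕ → (ℕ → ℕ) → Set
      P n σ′ = loop n (σ′ (suc d)) s ≡ v × Fresh σ′ (2 + d) × ∀ x → x < d → σ′ x ≡ σ x
      d<2+d : d < 2 + d
      d<2+d = m≤n⇒m≤1+n (n<1+n d)
      start : ∀ σ₁ σ₂ → Sets σ d (eval e₁ (map σ env)) σ₁ → Sets σ₁ (suc d) (eval e₂ (map σ₁ env)) σ₂ → P (σ₂ d) σ₂
      start σ₁ σ₂ p₁ p₂ =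
        cong₂ (λ n acc → loop n acc s)
          (trans (agree-set p₂ d (n<1+n d)) (proj₁ p₁))
          (trans (proj₁ p₂) (cong (eval e₂) (map-agree env below (agree-set p₁)))) ,
        fresh-set (fresh-set fresh p₁) p₂ ,
        λ x x<d → trans (agree-set p₂ x (m≤n⇒m≤1+n x<d)) (agree-set p₁ x x<d)
      step : ∀ n σ′ → σ′ d ≡ suc n → P (suc n) σ′ → Sends body (set σ′ d n) (λ σ″ → σ″ d ≡ n × P n σ″)
      step n σ′ eq (val , fresh′ , low) =
        sends-⨾ (sends-compile b (suc d ∷ d ∷ env) (2 + d) σ₀
            (λ x ≤x → trans (proj₂ (sets σ′ d n) x (≢-sym (<⇒≢ (≤-trans d<2+d ≤x)))) (fresh′ x ≤x))
            (λ { zero → ≤-refl ; (suc zero) → d<2+d ; (suc (suc i)) → m≤n⇒m≤1+n (m≤n⇒m≤1+n (below i)) })) λ {σ₁} q₁ →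
        sends-⨾ (sends-clear (suc d) σ₁) λ {σ₂} q₂ →
        sends-weaken (sends-transfer (2 + d) (suc d) σ₂ (<⇒≢ (n<1+n (suc d)))) λ {σ₃} q₃ →
        done σ₁ σ₂ σ₃ q₁ q₂ q₃
        where
        σ₀ = set σ′ d n
        args : map σ₀ (suc d ∷ d ∷ env) ≡ σ′ (suc d) ∷ n ∷ map σ env
        args = cong₂ _∷_ (proj₂ (sets σ′ d n) (suc d) (≢-sym (<⇒≢ (n<1+n d))))
          (cong₂ _∷_ (proj₁ (sets σ′ d n))
            (map-agree env below (λ x x<d → trans (proj₂ (sets σ′ d n) x (<⇒≢ x<d)) (low x x<d))))
        done : ∀ σ₁ σ₂ σ₃ → Sets σ₀ (2 + d) (eval b (map σ₀ (suc d ∷ d ∷ env))) σ₁ → Sets σ₁ (suc d) 0 σ₂ →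
          Transferred σ₂ (2 + d) (suc d) σ₃ → σ₃ d ≡ n × P n σ₃
        done σ₁ σ₂ σ₃ q₁ q₂ (z , sum , same) =
          trans (lower d ≤-refl) (proj₁ (sets σ′ d n)) ,
          trans (cong (λ acc → loop n acc s) acc) val ,
          above ,
          λ x x<d → trans (lower x (<⇒≤ x<d)) (trans (proj₂ (sets σ′ d n) x (<⇒≢ x<d)) (low x x<d))
          where
          lower : ∀ x → x ≤ d → σ₃ x ≡ σ₀ x
          lower x x≤d = trans (same x (<⇒≢ (s≤s (m≤n⇒m≤1+n x≤d))) (<⇒≢ (s≤s x≤d)))
            (trans (agree-set q₂ x (s≤s x≤d)) (agree-set q₁ x (s≤s (m≤n⇒m≤1+n x≤d))))
          acc : σ₃ (suc d) ≡ s n (σ′ (suc d))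
          acc = trans sum (trans (cong₂ _+_ (proj₁ q₂) (proj₂ q₂ (2 + d) (≢-sym (<⇒≢ (n<1+n (suc d))))))
            (trans (proj₁ q₁) (cong (eval b) args)))
          above : Fresh σ₃ (2 + d)
          above x ≤x with x ≟ 2 + d
          ... | yes refl = z
          ... | no x≢ = trans (same x x≢ (≢-sym (<⇒≢ ≤x))) (trans (proj₂ q₂ x (≢-sym (<⇒≢ ≤x)))
                (trans (proj₂ q₁ x x≢) (trans (proj₂ (sets σ′ d n) x (≢-sym (<⇒≢ (≤-trans d<2+d ≤x)))) (fresh′ x ≤x))))
      finish : ∀ σ₃ σ₄ → σ₃ d ≡ 0 × P 0 σ₃ → Transferred σ₃ (suc d) d σ₄ → Sets σ d v σ₄
      finish σ₃ σ₄ (z , val , fresh′ , low) (z′ , sum , same) =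
        trans sum (trans (cong (_+ σ₃ (suc d)) z) val) , other
        where
        other : ∀ x → x ≢ d → σ₄ x ≡ σ x
        other x x≢d with x ≟ suc d | <-cmp x d
        ... | yes refl | _ = trans z′ (sym (fresh (suc d) (n≤1+n d)))
        ... | no x≢ | tri< x<d _ _ = trans (same x x≢ x≢d) (low x x<d)
        ... | no x≢ | tri≈ _ x≡d _ = contradiction x≡d x≢d
        ... | no x≢ | tri> _ _ d<x = trans (same x x≢ x≢d)
                (trans (fresh′ x (≤∧≢⇒< d<x (≢-sym x≢))) (sym (fresh x (<⇒≤ d<x))))
    sends-compile (call {m} f e correct es) env d σ fresh below =
      sends-⨾ (sends-compiles es env d σ fresh below) λ {σ₁} p₁ →
      sends-⨾ (sends-compile e (interval d m) (suc (m + d)) σ₁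
          (λ x ≤x → proj₂ (proj₂ p₁) x (<⇒≤ ≤x)) (λ i → m≤n⇒m≤1+n (proj₂ (interval-range d m i)))) λ {σ₂} p₂ →
      sends-⨾ (sends-clearFrom d m σ₂) λ {σ₃} p₃ →
      last σ₁ σ₂ σ₃ p₁ p₂ p₃
      where
      last : ∀ σ₁ σ₂ σ₃ → Evaluated σ d (evals es (map σ env)) σ₁ → Sets σ₁ (suc (m + d)) (eval e (map σ₁ (interval d m))) σ₂ →
        (∀ x → d ≤ x → x < m + d → σ₃ x ≡ 0) × (∀ x → x < d → σ₃ x ≡ σ₂ x) × (∀ x → m + d ≤ x → σ₃ x ≡ σ₂ x) →
        Sends (transfer (suc (m + d)) d) σ₃ (Sets σ d (f (evals es (map σ env))))
      last σ₁ σ₂ σ₃ (vals , low , fresh₁) p₂ (mid , low₃ , high₃) =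
        sends-weaken (sends-transfer (suc (m + d)) d σ₃ d≢) λ {σ₄} (z , sum , same) →
          trans sum (trans (cong₂ _+_ (zero₃ d ≤-refl d≢) result)
            (trans (cong (eval e) vals) (correct _))) , other σ₄ z same
        where
        d≢ : d ≢ suc (m + d)
        d≢ = <⇒≢ (s≤s (m≤n+m d m))
        result : σ₃ (suc (m + d)) ≡ eval e (map σ₁ (interval d m))
        result = trans (high₃ (suc (m + d)) (n≤1+n _)) (proj₁ p₂)
        zero₃ : ∀ x → d ≤ x → x ≢ suc (m + d) → σ₃ x ≡ 0
        zero₃ x d≤x x≢ with x <? m + d
        ... | yes x< = mid x d≤x x<
        ... | no x≮  = trans (high₃ x (≮⇒≥ x≮)) (trans (proj₂ p₂ x x≢) (fresh₁ x (≮⇒≥ x≮)))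
        other : ∀ σ₄ → σ₄ (suc (m + d)) ≡ 0 → (∀ x → x ≢ suc (m + d) → x ≢ d → σ₄ x ≡ σ₃ x) → ∀ x → x ≢ d → σ₄ x ≡ σ x
        other σ₄ z same x x≢d with x ≟ suc (m + d) | x <? d
        ... | yes refl | _ = trans z (sym (fresh _ (<⇒≤ (s≤s (m≤n+m d m)))))
        ... | no x≢ | yes x<d = trans (same x x≢ x≢d) (trans (low₃ x x<d)
                (trans (agree-set p₂ x (<-trans x<d (s≤s (m≤n+m d m)))) (low x x<d)))
        ... | no x≢ | no x≮d = trans (same x x≢ x≢d) (trans (zero₃ x (≮⇒≥ x≮d) x≢) (sym (fresh x (≮⇒≥ x≮d))))
    sends-compiles []       env d σ fresh below = σ , runs-skip O (λ _ → refl) , refl , (λ _ _ → refl) , fresh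
    sends-compiles {suc m} (e ∷ es) env d σ fresh below =
      sends-⨾ (sends-compile e env d σ fresh below) λ {σ₁} p₁ →
      sends-weaken
        (sends-compiles es env (suc d) σ₁ (fresh-set fresh p₁) (below-suc {env = env} below)) λ {σ₂} (vals , low , fresh₂) →
        cong₂ _∷_ (trans (low d (n<1+n d)) (proj₁ p₁))
          (trans vals (cong (evals es) (map-agree env below (agree-set p₁)))) ,
        (λ x x<d → trans (low x (m≤n⇒m≤1+n x<d)) (agree-set p₁ x x<d)) ,
        subst (Fresh σ₂) (+-suc m d) fresh₂

-- Machines for functions on numbers and on oracle answers

module Machines where

  open import Data.Fin.Base using (zero; suc)
  open import Data.List.Base using ([])
  open import Data.Nat.Base
  open import Data.Nat.Properties
  open import Data.Product.Base using (∃-syntax; _×_; _,_; proj₁; proj₂)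
  open import Data.Vec.Base using (Vec; []; _∷_)
  open import Data.Vec.Properties using (lookup-replicate)
  open import Relation.Binary.PropositionalEquality hiding (inspect)
  open import Defs using (graph; χ; ∅; Machine; machine; unary; rowAt; _[_]_⇓_; Computable)
  open Counter
  open Program

  record Fun₁ (f : ℕ → ℕ) : Set where
    constructor fun₁
    field
      body    : Exp 1
      correct : ∀ a → eval body (a ∷ []) ≡ f a

  record Fun₂ (f : ℕ → ℕ → ℕ) : Set where
    constructor fun₂
    field
      body    : Exp 2
      correct : ∀ a b → eval body (a ∷ b ∷ []) ≡ f a b

  record Fun₃ (f : ℕ → ℕ → ℕ → ℕ) : Set where
    constructor fun₃
    field
      body    : Exp 3
      correct : ∀ a b c → eval body (a ∷ b ∷ c ∷ []) ≡ f a b c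

  infixl 10 _$₁_ _$₂_ _$₃_
  _$₁_ : ∀ {n f} → Fun₁ f → Exp n → Exp n
  _$₁_ {f = f} F a = call (λ { (a ∷ []) → f a }) (Fun₁.body F) (λ { (a ∷ []) → Fun₁.correct F a }) (a ∷ [])

  _$₂_ : ∀ {n f} → Fun₂ f → Exp n × Exp n → Exp n
  _$₂_ {f = f} F (a , b) =
    call (λ { (a ∷ b ∷ []) → f a b }) (Fun₂.body F) (λ { (a ∷ b ∷ []) → Fun₂.correct F a b }) (a ∷ b ∷ [])

  _$₃_ : ∀ {n f} → Fun₃ f → Exp n × Exp n × Exp n → Exp n
  _$₃_ {f = f} F (a , b , c) =
    call (λ { (a ∷ b ∷ c ∷ []) → f a b c }) (Fun₃.body F) (λ { (a ∷ b ∷ c ∷ []) → Fun₃.correct F a b c })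
      (a ∷ b ∷ c ∷ [])

  machineOf : Cmd → Machine
  machineOf c = machine (width c) (rows (width c) 0 c)

  input : ℕ → ℕ → ℕ
  input n zero    = n
  input n (suc _) = 0

  runs⇒⇓ : ∀ {O c n σ v} → Runs O c (input n) σ → σ 0 ≡ v → machineOf c [ O ] n ⇓ v
  runs⇒⇓ {O} {c} {n} r eq
    with run r (m≤n+m (width c) 2) (located-after [] (rows (width c) 0 c)) _ start
    where
    start : HoldsAll (input n) (unary n ∷ Data.Vec.Base.replicate (suc (width c)) (unary 0))
    start zero    = holds-unary n
    start (suc i) rewrite lookup-replicate i (unary 0) = holds-unary 0
  ... | ts , h , steps = _ , steps ,
        subst (λ q → rowAt (rows (width c) 0 c) q ≡ _) (length-rows (width c) 0 c) (rowAt-length (rows (width c) 0 c)) ,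
        trans (value-holds (h zero)) eq

  module _ {f : ℕ → ℕ} (F : Fun₁ f) where
    open Fun₁ F

    computeCmd queryCmd : Cmd
    computeCmd = compile body (0 ∷ []) 1 ⨾ clear 0 ⨾ transfer 1 0
    queryCmd   = transfer 0 1 ⨾ ask ⨾ compile body (1 ∷ []) 2 ⨾ transfer 2 0

    computes : ∀ n O → machineOf computeCmd [ O ] n ⇓ f n
    computes n O with sends-compile O body (0 ∷ []) 1 (input n) (λ { (suc x) _ → refl }) (λ { zero → s≤s z≤n })
    ... | σ₁ , r₁ , eq₁ , same₁ with sends-clear O 0 σ₁
    ...   | σ₂ , r₂ , eq₂ , same₂ with sends-transfer O 1 0 σ₂ (λ ())
    ...     | σ₃ , r₃ , _ , eq₃ , _ = runs⇒⇓ (runs-⨾ O r₁ (runs-⨾ O r₂ r₃))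
              (trans eq₃ (trans (cong₂ _+_ eq₂ (trans (same₂ 1 (λ ())) eq₁)) (correct n)))

    -- The i-th output depends on the i-th oracle answer alone. For real functions this suffices
    -- when they are 1-Lipschitz, since no extra precision of the argument is then called for.
    queries : ∀ p i → machineOf queryCmd [ graph p ] i ⇓ f (p i)
    queries p i with sends-transfer (graph p) 0 1 (input i) (λ ())
    ... | σ₁ , r₁ , zero₁ , eq₁ , same₁
        with sends-compile (graph p) body (1 ∷ []) 2 (set σ₁ 1 (p i)) fresh (λ { zero → s≤s (s≤s z≤n) })
      where
      fresh : Fresh (set σ₁ 1 (p i)) 2
      fresh (suc (suc x)) _ = trans (proj₂ (sets σ₁ 1 (p i)) (2 + x) (λ ())) (same₁ (2 + x) (λ ()) (λ ()))
      fresh (suc zero) (s≤s ())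
    ...   | σ₃ , r₃ , eq₃ , same₃ with sends-transfer (graph p) 2 0 σ₃ (λ ())
    ...     | σ₄ , r₄ , _ , eq₄ , _ = runs⇒⇓
              (runs-⨾ (graph p) r₁ (runs-⨾ (graph p) (runs-ask (graph p) answer (sets σ₁ 1 (p i))) (runs-⨾ (graph p) r₃ r₄)))
              (trans eq₄ (trans (cong₂ _+_ (trans (same₃ 0 (λ ())) (trans (proj₂ (sets σ₁ 1 (p i)) 0 (λ ())) zero₁)) eq₃)
                (trans (cong (λ v → eval body (v ∷ [])) (proj₁ (sets σ₁ 1 (p i)))) (correct (p i)))))
              where
              answer : p i ≡ p (σ₁ 1)
              answer = cong p (sym eq₁)

  computable : ∀ {f} → Fun₁ f → Computable f
  computable F = machineOf (computeCmd F) , λ n → computes F n (χ ∅)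

-- Programs for arithmetic and for the simulation of machines

module Functions where

  open import Data.Fin.Base using (zero; suc)
  open import Data.Nat.Base
  open import Data.Nat.Properties
  open import Data.Product.Base using (_,_)
  open import Relation.Binary.PropositionalEquality
  open import Defs using (triangle)
  open Pairing
  open Program
  open Machines

  v0 : ∀ {n} → Exp (1 + n)
  v0 = var zero
  v1 : ∀ {n} → Exp (2 + n)
  v1 = var (suc zero)
  v2 : ∀ {n} → Exp (3 + n)
  v2 = var (suc (suc zero))
  v3 : ∀ {n} → Exp (4 + n)
  v3 = var (suc (suc (suc zero)))
  v4 : ∀ {n} → Exp (5 + n)
  v4 = var (suc (suc (suc (suc zero))))

  addF : Fun₂ _+_
  addF = fun₂ (iter v0 v1 (succ v0)) go
    where
    go : ∀ a b → loop a b (λ _ acc → suc acc) ≡ a + b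
    go zero    b = refl
    go (suc a) b = trans (go a (suc b)) (+-suc a b)

  ifzF : Fun₃ ifz
  ifzF = fun₃ (iter v0 v1 v4) go
    where
    const-loop : ∀ n b → loop n b (λ _ _ → b) ≡ b
    const-loop zero    b = refl
    const-loop (suc n) b = const-loop n b
    go : ∀ n a b → loop n a (λ _ _ → b) ≡ ifz n a b
    go zero    a b = refl
    go (suc n) a b = const-loop n b

  -- Counts all passes except the last, the only one whose counter is 0.
  predF : Fun₁ pred
  predF = fun₁ (iter v0 (lit 0) (ifzF $₃ (v1 , v0 , succ v0))) (λ n → trans (go n 0) (+-identityʳ (pred n)))
    where
    go : ∀ n acc → loop n acc (λ c acc → ifz c acc (suc acc)) ≡ pred n + acc
    go zero          acc = refl
    go (suc zero)    acc = refl
    go (suc (suc n)) acc = trans (go (suc n) (suc acc)) (+-suc n acc)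

  monusF : Fun₂ _∸_
  monusF = fun₂ (iter v1 v0 (predF $₁ v0)) go
    where
    go : ∀ a b → loop b a (λ _ acc → pred acc) ≡ a ∸ b
    go a       zero    = refl
    go zero    (suc b) = trans (go zero b) (0∸n≡0 b)
    go (suc a) (suc b) = go a b

  mulF : Fun₂ _*_
  mulF = fun₂ (iter v0 (lit 0) (addF $₂ (v3 , v0))) (λ a b → trans (go a b 0) (+-identityʳ _))
    where
    go : ∀ a b acc → loop a acc (λ _ acc → b + acc) ≡ a * b + acc
    go zero    b acc = refl
    go (suc a) b acc = trans (go a b (b + acc)) (trans (sym (+-assoc (a * b) b acc)) (cong (_+ acc) (+-comm (a * b) b)))

  triangleF : Fun₁ triangle
  triangleF = fun₁ (iter v0 (lit 0) (addF $₂ (succ v1 , v0))) (λ n → trans (go n 0) (+-identityʳ _))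
    where
    go : ∀ n acc → loop n acc (λ c acc → suc c + acc) ≡ triangle n + acc
    go zero    acc = refl
    go (suc n) acc = trans (go n (suc n + acc))
      (trans (sym (+-assoc (triangle n) (suc n) acc)) (cong (_+ acc) (+-comm (triangle n) (suc n))))

  opaque
    unfolding pair
    pairF : Fun₂ pair
    pairF = fun₂ (addF $₂ (triangleF $₁ (addF $₂ (v0 , v1)) , v1)) (λ _ _ → refl)

  opaque
    unfolding diagonal
    diagonalF : Fun₁ diagonal
    diagonalF = fun₁ (iter v0 (lit 0) (ifzF $₃ (monusF $₂ (triangleF $₁ succ v0 , v2) , succ v0 , v0))) (λ _ → refl)

  opaque
    unfolding second
    secondF : Fun₁ second
    secondF = fun₁ (monusF $₂ (v0 , triangleF $₁ (diagonalF $₁ v0))) (λ _ → refl)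

  opaque
    unfolding first
    firstF : Fun₁ first
    firstF = fun₁ (monusF $₂ (diagonalF $₁ v0 , secondF $₁ v0)) (λ _ → refl)

  opaque
    unfolding cons
    consF : Fun₂ cons
    consF = fun₂ (succ (pairF $₂ (v0 , v1))) (λ _ _ → refl)

  opaque
    unfolding head
    headF : Fun₁ head
    headF = fun₁ (firstF $₁ (predF $₁ v0)) (λ _ → refl)

  opaque
    unfolding tail
    tailF : Fun₁ tail
    tailF = fun₁ (secondF $₁ (predF $₁ v0)) (λ _ → refl)

  opaque
    differ : ℕ → ℕ → ℕ
    differ a b = (a ∸ b) + (b ∸ a)

    differF : Fun₂ differ
    differF = fun₂ (addF $₂ (monusF $₂ (v0 , v1) , monusF $₂ (v1 , v0))) (λ _ _ → refl)

  opaque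
    dropC : ℕ → ℕ → ℕ
    dropC l i = loop i l (λ _ l → tail l)

    dropF : Fun₂ dropC
    dropF = fun₂ (iter v1 v0 (tailF $₁ v0)) (λ _ _ → refl)

  -- An association list, its first entry with key t winning; the default is 0.
  opaque
    get : ℕ → ℕ → ℕ
    get s t = second (head (loop s s (λ _ s → ifz (differ (first (head s)) t) s (tail s))))

    getF : Fun₂ get
    getF = fun₂ (secondF $₁ (headF $₁ iter v0 v0
        (ifzF $₃ (differF $₂ (firstF $₁ (headF $₁ v0) , v3) , v0 , tailF $₁ v0)))) (λ _ _ → refl)

  opaque
    onesC : ℕ → ℕ
    onesC n = loop n 0 (λ _ l → cons 1 l)

    onesF : Fun₁ onesC
    onesF = fun₁ (iter v0 (lit 0) (consF $₂ (lit 1 , v0))) (λ _ → refl)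

  opaque
    -- The code l bounds the length of the list it codes; surplus passes add `head 0`, which is 0.
    sumC : ℕ → ℕ
    sumC l = first (loop l (pair 0 l) (λ _ p → pair (head (second p) + first p) (tail (second p))))

    sumF : Fun₁ sumC
    sumF = fun₁ (firstF $₁ iter v0 (pairF $₂ (lit 0 , v0))
        (pairF $₂ (addF $₂ (headF $₁ (secondF $₁ v0) , firstF $₁ v0) , tailF $₁ (secondF $₁ v0)))) (λ _ → refl)

  -- Simulation of a machine given by its index: a tape is coded by
  -- ⟨ left , ⟨ scanned , right ⟩ ⟩ and a configuration by ⟨ state , tapes ⟩.
  opaque
    actC : ℕ → ℕ → ℕ
    actC a t =
      let w = first a
          m = first (second a)
          l = first t
          r = second (second t)
      in ifz m (pair (tail l) (pair (head l) (cons w r)))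
                    (ifz (pred m) (pair (cons w l) (pair (head r) (tail r))) (pair l (pair w r)))

    actF : Fun₂ actC
    actF =
      let w = firstF $₁ v0
          m = firstF $₁ (secondF $₁ v0)
          l = firstF $₁ v1
          r = secondF $₁ (secondF $₁ v1)
      in fun₂ (ifzF $₃ (m , pairF $₂ (tailF $₁ l , pairF $₂ (headF $₁ l , consF $₂ (w , r))) ,
                    ifzF $₃ (predF $₁ m , pairF $₂ (consF $₂ (w , l) , pairF $₂ (headF $₁ r , tailF $₁ r)) ,
                             pairF $₂ (l , pairF $₂ (w , r))))) (λ _ _ → refl)

  opaque
    valueC : ℕ → ℕ
    valueC t = sumC (first t) + (first (second t) + sumC (second (second t)))

    valueF : Fun₁ valueC
    valueF = fun₁ (addF $₂ (sumF $₁ (firstF $₁ v0) ,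
      addF $₂ (firstF $₁ (secondF $₁ v0) , sumF $₁ (secondF $₁ (secondF $₁ v0))))) (λ _ → refl)

  opaque
    unaryC : ℕ → ℕ
    unaryC n = pair (onesC n) 0

    unaryF : Fun₁ unaryC
    unaryF = fun₁ (pairF $₂ (onesF $₁ v0 , lit 0)) (λ _ → refl)

  opaque
    -- Only the input tape needs an entry: the default 0 of `get` is the code of a blank tape,
    -- because `pair 0 0` is 0.
    initialC : ℕ → ℕ
    initialC n = pair 0 (cons (pair 0 (unaryC n)) 0)

    initialF : Fun₁ initialC
    initialF = fun₁ (pairF $₂ (lit 0 , consF $₂ (pairF $₂ (lit 0 , unaryF $₁ v0) , lit 0))) (λ _ → refl)

  opaque
    inspectC : ℕ → ℕ → ℕ
    inspectC row s =
      let t  = first (second row)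
          tp = get s t
          a  = ifz (first (second tp)) (first (second (second row))) (second (second (second row)))
      in pair (second (second a)) (cons (pair t (actC a tp)) s)

    inspectF : Fun₂ inspectC
    inspectF =
      let t  = firstF $₁ (secondF $₁ v0)
          tp = getF $₂ (v1 , t)
          aa = secondF $₁ (secondF $₁ v0)
          a  = ifzF $₃ (firstF $₁ (secondF $₁ tp) , firstF $₁ aa , secondF $₁ aa)
      in fun₂ (pairF $₂ (secondF $₁ (secondF $₁ a) , consF $₂ (pairF $₂ (t , actF $₂ (a , tp)) , v1))) (λ _ _ → refl)

  opaque
    queryC : ℕ → ℕ → ℕ → ℕ
    queryC row a s = pair (second row) (cons (pair 1 (unaryC a)) s)

    queryF : Fun₃ queryC
    queryF = fun₃ (pairF $₂ (secondF $₁ v0 , consF $₂ (pairF $₂ (lit 1 , unaryF $₁ v1) , v2))) (λ _ _ _ → refl)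

  -- The rows of machine e from the state of configuration c on.
  opaque
    rowsC : ℕ → ℕ → ℕ
    rowsC e c = dropC (second e) (first c)

    rowsF : Fun₂ rowsC
    rowsF = fun₂ (dropF $₂ (secondF $₁ v0 , firstF $₁ v1)) (λ _ _ → refl)

  opaque
    -- When no row is left the configuration stays as it is, so simulating beyond the halting time
    -- is harmless. The answer a is consulted by query rows only.
    stepC : ℕ → ℕ → ℕ → ℕ
    stepC e a c =
      let rs = rowsC e c
      in ifz rs c (ifz (first (head rs)) (inspectC (head rs) (second c)) (queryC (head rs) a (second c)))

    stepF : Fun₃ stepC
    stepF =
      let rs = rowsF $₂ (v0 , v2)
      in fun₃ (ifzF $₃ (rs , v2 , ifzF $₃ (firstF $₁ (headF $₁ rs) ,
           inspectF $₂ (headF $₁ rs , secondF $₁ v2) , queryF $₃ (headF $₁ rs , v1 , secondF $₁ v2)))) (λ _ _ _ → refl)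

  -- j steps from the pair p of a list of oracle answers, one for each step,
  -- and a configuration.
  opaque
    runC : ℕ → ℕ → ℕ → ℕ
    runC e p j = loop j p (λ _ p → pair (tail (first p)) (stepC e (head (first p)) (second p)))

    runF : Fun₃ runC
    runF = fun₃ (iter v2 v1 (pairF $₂ (tailF $₁ (firstF $₁ v0) ,
        stepF $₃ (v2 , headF $₁ (firstF $₁ v0) , secondF $₁ v0)))) (λ _ _ _ → refl)

  opaque
    badAction : ℕ → ℕ
    badAction a = (first a ∸ 1) + (first (second a) ∸ 2)

    badActionF : Fun₁ badAction
    badActionF = fun₁ (addF $₂ (monusF $₂ (firstF $₁ v0 , lit 1) , monusF $₂ (firstF $₁ (secondF $₁ v0) , lit 2))) (λ _ → refl)

  opaque
    -- The jump demands that e be the index of a machine, so the validity of e is itself open to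
    -- objection. With k work tapes the last tape has number `suc k`; tag 1 is a query, valid with
    -- any target, and larger tags are rejected.
    badRow : ℕ → ℕ → ℕ
    badRow k row =
      let as = second (second row)
      in ifz (first row) ((first (second row) ∸ suc k) + (badAction (first as) + badAction (second as))) (pred (first row))

    badRowF : Fun₂ badRow
    badRowF =
      let as = secondF $₁ (secondF $₁ v1)
      in fun₂ (ifzF $₃ (firstF $₁ v1 ,
           addF $₂ (monusF $₂ (firstF $₁ (secondF $₁ v1) , succ v0) ,
             addF $₂ (badActionF $₁ (firstF $₁ as) , badActionF $₁ (secondF $₁ as))) ,
           predF $₁ (firstF $₁ v1))) (λ _ _ → refl)

  opaque
    badRowAt : ℕ → ℕ → ℕ
    badRowAt e j =
      let rs = dropC (second e) j
      in ifz rs 0 (badRow (first e) (head rs))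

    badRowAtF : Fun₂ badRowAt
    badRowAtF =
      let rs = dropF $₂ (secondF $₁ v0 , v1)
      in fun₂ (ifzF $₃ (rs , lit 0 , badRowF $₂ (firstF $₁ v0 , headF $₁ rs))) (λ _ _ → refl)

  -- Outcomes of challenging the claim that a machine halts.  A code
  -- ⟨ f , ⟨ g , v ⟩ ⟩ means that the claim is reduced to v being in the oracle
  -- set (g = 1) or the empty set (g = 0), to be defended by the claimant
  -- (f = 0) or by the challenger (f = 1).
  opaque
    loses wins : ℕ
    loses = pair 0 (pair 0 0)
    wins  = pair 1 (pair 0 0)

  opaque
    answerC : ℕ → ℕ → ℕ
    answerC a v = ifz a (pair 1 (pair 1 v)) (ifz (pred a) (pair 0 (pair 1 v)) loses)

    answerF : Fun₂ answerC
    answerF = fun₂ (ifzF $₃ (v0 , pairF $₂ (lit 1 , pairF $₂ (lit 1 , v1)) ,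
        ifzF $₃ (predF $₁ v0 , pairF $₂ (lit 0 , pairF $₂ (lit 1 , v1)) , lit loses))) (λ _ _ → refl)

  opaque
    challengeC : ℕ → ℕ → ℕ
    challengeC e p =
      let rs = rowsC e (second p)
      in ifz rs wins (ifz (first (head rs)) wins (answerC (head (first p)) (valueC (get (second (second p)) 1))))

    challengeF : Fun₂ challengeC
    challengeF =
      let rs = rowsF $₂ (v0 , secondF $₁ v1)
      in fun₂ (ifzF $₃ (rs , lit wins , ifzF $₃ (firstF $₁ (headF $₁ rs) , lit wins ,
           answerF $₂ (headF $₁ (firstF $₁ v1) , valueF $₁ (getF $₂ (secondF $₁ (secondF $₁ v1) , lit 1)))))) (λ _ _ → refl)

  opaque
    startC : ℕ → ℕ → ℕ
    startC e x = pair (second x) (initialC e)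

    startF : Fun₂ startC
    startF = fun₂ (pairF $₂ (secondF $₁ v1 , initialF $₁ v0)) (λ _ _ → refl)

  -- The claimant's evidence x consists of a number of steps and a list of
  -- oracle answers; the challenger objects to row j or to the answer at time j.
  opaque
    outcomeC : ℕ → ℕ → ℕ → ℕ
    outcomeC e x j = ifz (badRowAt e j)
      (ifz (rowsC e (second (runC e (startC e x) (first x)))) (challengeC e (runC e (startC e x) j)) loses) loses

    outcomeF : Fun₃ outcomeC
    outcomeF = fun₃ (ifzF $₃ (badRowAtF $₂ (v0 , v2) ,
        ifzF $₃ (rowsF $₂ (v0 , secondF $₁ (runF $₃ (v0 , startF $₂ (v0 , v1) , firstF $₁ v1))) ,
                 challengeF $₂ (v0 , runF $₃ (v0 , startF $₂ (v0 , v1) , v2)) , lit loses) ,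
        lit loses)) (λ _ _ _ → refl)

-- Correctness of the simulation, and the jump as a claim with objections

module Simulation where

  open import Data.Bool.Base using (Bool; true; false; if_then_else_)
  open import Data.Empty using (⊥-elim)
  open import Data.Fin.Base using (Fin; zero; suc; toℕ; fromℕ<)
  import Data.Fin.Properties as Fin
  open import Data.List.Base using (List; []; _∷_; map; replicate; _++_)
  open import Data.Maybe.Base using (just; nothing)
  open import Data.Nat.Base
  open import Data.Nat.Properties
  open import Data.Product.Base using (∃-syntax; _×_; _,_; proj₁; proj₂)
  open import Data.Vec.Base using (Vec; lookup; _[_]≔_)
  open import Data.Vec.Properties using (lookup∘update; lookup∘update′; lookup-replicate)
  open import Function.Bundles using (_⇔_; mk⇔; module Equivalence)
  open import Level using (0ℓ)
  open import Relation.Binary.Construct.Closure.ReflexiveTransitive using (Star; ε; _◅_)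
  open import Relation.Binary.PropositionalEquality hiding (inspect)
  open import Relation.Nullary using (¬_; yes; no; contradiction)
  open import Relation.Unary using (Pred)
  open import Defs using (triangle; ⟨_,_⟩; codeList; codeBool; Tape; tape; L; R; stay; act; marks; value; unary; Action; action; codeMove; codeAction; Row; inspect; query; codeRow; Machine; machine; table; tapes; workTapes; index; rowAt; Config; config; state; contents; Step; inspecting; querying; initial; χ; _[_]_⇓_; Jump)
  open Pairing
  open Functions

  opaque
    unfolding pair head
    pair-zero : pair 0 0 ≡ 0
    pair-zero = refl

    head-zero : head 0 ≡ 0
    head-zero = refl

    tail-zero : tail 0 ≡ 0
    tail-zero = refl

    tail≤pred : ∀ s → tail s ≤ pred s
    tail≤pred s = m∸n≤m (pred s) (triangle (diagonal (pred s)))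

    ifz-cons : ∀ a l {x y} → ifz (cons a l) x y ≡ y
    ifz-cons a l = refl

    cons≢0 : ∀ {a l} → cons a l ≢ 0
    cons≢0 ()

    tail<cons : ∀ a l → ∃[ m ] (cons a l ≡ suc m × l ≤ m)
    tail<cons a l = pair a l , refl , second≤pair a l

  halfC : List Bool → ℕ
  halfC []      = 0
  halfC (b ∷ l) = cons (codeBool b) (halfC l)

  tapeC : Tape → ℕ
  tapeC (tape l b r) = pair (halfC l) (pair (codeBool b) (halfC r))

  opaque
    unfolding differ
    differ-same : ∀ t → differ t t ≡ 0
    differ-same t = cong₂ _+_ (n∸n≡0 t) (n∸n≡0 t)

    differ-other : ∀ {s t} → s ≢ t → ∃[ n ] differ s t ≡ suc n
    differ-other {s} {t} s≢t with (s ∸ t) + (t ∸ s) in eq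
    ... | suc n = n , refl
    ... | zero  = contradiction
          (≤-antisym (m∸n≡0⇒m≤n (m+n≡0⇒m≡0 (s ∸ t) eq)) (m∸n≡0⇒m≤n (m+n≡0⇒n≡0 (s ∸ t) eq))) s≢t

  module _ (t : ℕ) where

    find : ℕ → ℕ → ℕ
    find n s = loop n s (λ _ s → ifz (differ (first (head s)) t) s (tail s))

    find-found : ∀ n s → differ (first (head s)) t ≡ 0 → find n s ≡ s
    find-found zero    s eq = refl
    find-found (suc n) s eq rewrite eq = find-found n s eq

    -- Every miss lowers the code, since `tail s` ≤ `pred s`; after s misses the search sits at 0,
    -- where it no longer moves.
    find-stable : ∀ n s → s ≤ n → find (suc n) s ≡ find n s
    find-stable n s s≤n with differ (first (head s)) t in eq
    ... | zero = refl
    find-stable zero .0 z≤n | suc _ = tail-zero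
    find-stable (suc n) s s≤n | suc _ rewrite eq = find-stable n (tail s) (≤-trans (tail≤pred s) (pred-mono-≤ s≤n))

    find-enough : ∀ n s → s ≤ n → find n s ≡ find s s
    find-enough n s s≤n with m≤n⇒∃[o]m+o≡n s≤n
    ... | o , refl = go o
      where
      go : ∀ o → find (s + o) s ≡ find s s
      go zero    = cong (λ n → find n s) (+-identityʳ s)
      go (suc o) = trans (cong (λ n → find n s) (+-suc s o)) (trans (find-stable (s + o) s (m≤m+n s o)) (go o))

  opaque
    unfolding get

    get-same : ∀ t x s → get (cons (pair t x) s) t ≡ x
    get-same t x s = trans (cong (λ s → second (head s)) (find-found t (cons (pair t x) s) (cons (pair t x) s)
        (trans (cong (λ i → differ i t) (trans (cong first (head-cons _ s)) (first-pair t x))) (differ-same t))))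
      (trans (cong second (head-cons _ s)) (second-pair t x))

    get-other : ∀ {t t′} x s → t ≢ t′ → get (cons (pair t x) s) t′ ≡ get s t′
    get-other {t} {t′} x s t≢t′ with tail<cons (pair t x) s | differ-other t≢t′
    ... | m , eq , s≤m | n , eq′ = cong (λ s → second (head s)) (trans (cong (λ k → find t′ k (cons (pair t x) s)) eq)
          (trans (cong (find t′ m) (trans (cong (λ i → ifz i _ _)
              (trans (cong (λ i → differ (first i) t′) (head-cons _ s)) (trans (cong (λ i → differ i t′) (first-pair t x)) eq′)))
              (tail-cons _ s)))
            (find-enough t′ m s s≤m)))

    get-empty : ∀ t → get 0 t ≡ 0
    get-empty t = trans (cong second head-zero) second-zero
      where
      second-zero : second 0 ≡ 0
      second-zero = trans (cong second (sym pair-zero)) (second-pair 0 0)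

  opaque
    unfolding sumC onesC valueC unaryC actC

    sum-half : ∀ l → sumC (halfC l) ≡ marks l
    sum-half l = trans (go l (halfC l) 0 ≤-refl) (+-identityʳ _)
      where
      next : ℕ → ℕ → ℕ
      next _ p = pair (head (second p) + first p) (tail (second p))
      next-pair : ∀ {n} acc s → next n (pair acc s) ≡ pair (head s + acc) (tail s)
      next-pair acc s = cong₂ pair (cong₂ _+_ (cong head (second-pair acc s)) (first-pair acc s)) (cong tail (second-pair acc s))
      go : ∀ l n acc → halfC l ≤ n → first (loop n (pair acc (halfC l)) next) ≡ marks l + acc
      go []      zero    acc _ = first-pair acc 0
      go []      (suc n) acc _ = trans (cong (λ p → first (loop n p next)) (trans (next-pair {n} acc 0) (cong₂ (λ h t → pair (h + acc) t) head-zero tail-zero)))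
                                   (go [] n acc z≤n)
      go (b ∷ l) n acc ≤n with tail<cons (codeBool b) (halfC l)
      go (b ∷ l) zero acc ≤n | m , eq , l≤m = contradiction (n≤0⇒n≡0 ≤n) cons≢0
      go (b ∷ l) (suc n) acc ≤n | m , eq , l≤m =
        trans (cong (λ p → first (loop n p next)) (trans (next-pair {n} acc (halfC (b ∷ l)))
                (cong₂ (λ h t → pair (h + acc) t) (head-cons _ _) (tail-cons _ _))))
          (trans (go l n (codeBool b + acc) (≤-trans l≤m (s≤s⁻¹ (subst (_≤ suc n) eq ≤n))))
            (trans (sym (+-assoc (marks l) (codeBool b) acc)) (cong (_+ acc) (+-comm (marks l) (codeBool b)))))

    value-tapeC : ∀ t → valueC (tapeC t) ≡ value t
    value-tapeC (tape l b r) rewrite first-pair (halfC l) (pair (codeBool b) (halfC r))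
      | second-pair (halfC l) (pair (codeBool b) (halfC r)) | first-pair (codeBool b) (halfC r)
      | second-pair (codeBool b) (halfC r) | sum-half l | sum-half r = refl

    ones-half : ∀ n → onesC n ≡ halfC (replicate n true)
    ones-half n = trans (go n []) (cong halfC (++-[] n))
      where
      ++-[] : ∀ n → replicate n true ++ [] ≡ replicate n true
      ++-[] zero    = refl
      ++-[] (suc n) = cong (true ∷_) (++-[] n)
      shift : ∀ n l → replicate n true ++ true ∷ l ≡ true ∷ replicate n true ++ l
      shift zero    l = refl
      shift (suc n) l = cong (true ∷_) (shift n l)
      go : ∀ n l → loop n (halfC l) (λ _ l → cons 1 l) ≡ halfC (replicate n true ++ l)
      go zero    l = refl
      go (suc n) l = trans (go n (true ∷ l)) (cong halfC (shift n l))

    unary-tapeC : ∀ n → unaryC n ≡ tapeC (unary n)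
    unary-tapeC n = cong₂ pair (ones-half n) (sym pair-zero)

    action-first : ∀ a → first (codeAction a) ≡ codeBool (Action.write a)
    action-first (action w m q) = trans (cong first (sym (pair-def (codeBool w) ⟨ codeMove m , q ⟩))) (first-pair _ _)

    action-second : ∀ a → second (codeAction a) ≡ pair (codeMove (Action.move a)) (Action.next a)
    action-second (action w m q) = trans (cong second (sym (pair-def (codeBool w) ⟨ codeMove m , q ⟩)))
      (trans (second-pair _ _) (sym (pair-def (codeMove m) q)))

    act-tapeC : ∀ a t → actC (codeAction a) (tapeC t) ≡ tapeC (act a t)
    act-tapeC a@(action w m q) (tape l b r) rewrite action-first a | action-second a
      | first-pair (codeMove m) q | first-pair (halfC l) (pair (codeBool b) (halfC r))
      | second-pair (halfC l) (pair (codeBool b) (halfC r)) | second-pair (codeBool b) (halfC r) = go m l r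
      where
      go : ∀ m l r → ifz (codeMove m) (pair (tail (halfC l)) (pair (head (halfC l)) (cons (codeBool w) (halfC r))))
            (ifz (pred (codeMove m)) (pair (cons (codeBool w) (halfC l)) (pair (head (halfC r)) (tail (halfC r))))
              (pair (halfC l) (pair (codeBool w) (halfC r))))
           ≡ tapeC (act (action w m q) (tape l b r))
      go L []      r rewrite head-zero | tail-zero = refl
      go L (a ∷ l) r rewrite head-cons (codeBool a) (halfC l) | tail-cons (codeBool a) (halfC l) = refl
      go R l []      rewrite head-zero | tail-zero = refl
      go R l (a ∷ r) rewrite head-cons (codeBool a) (halfC r) | tail-cons (codeBool a) (halfC r) = refl
      go stay l r = refl

  -- Ensures A o: the defence prescribed by the outcome o succeeds when A is the oracle set.
  Ensures : Pred ℕ 0ℓ → ℕ → Set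
  Ensures A o = (first o ≡ 0 → claim) × (first o ≢ 0 → ¬ claim)
    where claim = first (second o) ≢ 0 × A (second (second o))

  module _ (A : Pred ℕ 0ℓ) where

    ensures-own : ∀ g v → Ensures A (pair 0 (pair g v)) ⇔ (g ≢ 0 × A v)
    ensures-own g v rewrite first-pair 0 (pair g v) | second-pair 0 (pair g v) | first-pair g v | second-pair g v =
      mk⇔ (λ e → proj₁ e refl) (λ c → (λ _ → c) , λ 0≢0 → contradiction refl 0≢0)

    ensures-other : ∀ g v → Ensures A (pair 1 (pair g v)) ⇔ (¬ (g ≢ 0 × A v))
    ensures-other g v rewrite first-pair 1 (pair g v) | second-pair 1 (pair g v) | first-pair g v | second-pair g v =
      mk⇔ (λ e → proj₂ e (λ ())) (λ c → (λ ()) , λ _ → c)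

    opaque
      unfolding loses answerC

      ¬ensures-loses : ¬ Ensures A loses
      ¬ensures-loses e = proj₁ (Equivalence.to (ensures-own 0 0) e) refl

      ensures-wins : Ensures A wins
      ensures-wins = Equivalence.from (ensures-other 0 0) (λ c → proj₁ c refl)

      ensures-answer : ∀ a v → Ensures A (answerC a v) ⇔ χ A v a
      ensures-answer zero v = mk⇔ (λ e a → Equivalence.to (ensures-other 1 v) e ((λ ()) , a))
                                  (λ ¬a → Equivalence.from (ensures-other 1 v) (λ c → ¬a (proj₂ c)))
      ensures-answer (suc zero) v = mk⇔ (λ e → proj₂ (Equivalence.to (ensures-own 1 v) e))
                                        (λ a → Equivalence.from (ensures-own 1 v) ((λ ()) , a))
      ensures-answer (suc (suc a)) v = mk⇔ ¬ensures-loses (λ ())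

  rowsList : ∀ {k} → List (Row k) → ℕ
  rowsList rs = codeList (map codeRow rs)

  codeList-cons : ∀ x xs → codeList (x ∷ xs) ≡ cons x (codeList xs)
  codeList-cons x xs = sym (cons-def x (codeList xs))

  opaque
    unfolding dropC

    drop-zero : ∀ q → dropC 0 q ≡ 0
    drop-zero zero    = refl
    drop-zero (suc q) = trans (cong (λ l → dropC l q) tail-zero) (drop-zero q)

    drop-suc : ∀ x xs q → dropC (codeList (x ∷ xs)) (suc q) ≡ dropC (codeList xs) q
    drop-suc x xs q = cong (λ l → dropC l q) (trans (cong tail (codeList-cons x xs)) (tail-cons x (codeList xs)))

    drop-here : ∀ l → dropC l 0 ≡ l
    drop-here l = refl

  drop-none : ∀ {k} (rs : List (Row k)) q → rowAt rs q ≡ nothing → dropC (rowsList rs) q ≡ 0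
  drop-none []       q       eq = drop-zero q
  drop-none (r ∷ rs) (suc q) eq = trans (drop-suc (codeRow r) (map codeRow rs) q) (drop-none rs q eq)

  drop-some : ∀ {k} (rs : List (Row k)) q {r} → rowAt rs q ≡ just r → ∃[ l ] dropC (rowsList rs) q ≡ cons (codeRow r) l
  drop-some (r ∷ rs) zero    refl = rowsList rs , trans (drop-here _) (codeList-cons (codeRow r) (map codeRow rs))
  drop-some (r ∷ rs) (suc q) eq with drop-some rs q eq
  ... | l , eq′ = l , trans (drop-suc (codeRow r) (map codeRow rs) q) eq′

  row-inspect : ∀ {k} (t : Fin k) a₀ a₁ →
    codeRow (inspect t a₀ a₁) ≡ pair 0 (pair (toℕ t) (pair (codeAction a₀) (codeAction a₁)))
  row-inspect t a₀ a₁ = sym (trans (pair-def 0 _) (cong (λ x → ⟨ 0 , x ⟩)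
    (trans (pair-def (toℕ t) _) (cong (λ x → ⟨ toℕ t , x ⟩) (pair-def (codeAction a₀) (codeAction a₁))))))

  row-query : ∀ {k} q → codeRow {k} (query q) ≡ pair 1 q
  row-query q = sym (pair-def 1 q)

  opaque
    unfolding stepC inspectC queryC challengeC rowsC runC initialC

    step-halted : ∀ e a c → rowsC e c ≡ 0 → stepC e a c ≡ c
    step-halted e a c eq rewrite eq = refl

    step-inspect : ∀ e a c {t b₀ b₁ l} → rowsC e c ≡ cons (pair 0 (pair t (pair b₀ b₁))) l →
      let tp = get (second c) t
          b  = ifz (first (second tp)) b₀ b₁
      in stepC e a c ≡ pair (second (second b)) (cons (pair t (actC b tp)) (second c))
    step-inspect e a c {t} {b₀} {b₁} {l} eq rewrite eq | head-cons (pair 0 (pair t (pair b₀ b₁))) l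
      | first-pair 0 (pair t (pair b₀ b₁)) | second-pair 0 (pair t (pair b₀ b₁))
      | first-pair t (pair b₀ b₁) | second-pair t (pair b₀ b₁) | first-pair b₀ b₁ | second-pair b₀ b₁
      = ifz-cons (pair 0 (pair t (pair b₀ b₁))) l

    step-query : ∀ e a c {q l} → rowsC e c ≡ cons (pair 1 q) l →
      stepC e a c ≡ pair q (cons (pair 1 (unaryC a)) (second c))
    step-query e a c {q} {l} eq rewrite eq | head-cons (pair 1 q) l | first-pair 1 q | second-pair 1 q
      = ifz-cons (pair 1 q) l

    challenge-halted : ∀ e p → rowsC e (second p) ≡ 0 → challengeC e p ≡ wins
    challenge-halted e p eq rewrite eq = refl

    challenge-inspect : ∀ e p {r l} → rowsC e (second p) ≡ cons (pair 0 r) l → challengeC e p ≡ wins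
    challenge-inspect e p {r} {l} eq rewrite eq | head-cons (pair 0 r) l | first-pair 0 r = ifz-cons (pair 0 r) l

    challenge-query : ∀ e p {q l} → rowsC e (second p) ≡ cons (pair 1 q) l →
      challengeC e p ≡ answerC (head (first p)) (valueC (get (second (second p)) 1))
    challenge-query e p {q} {l} eq rewrite eq | head-cons (pair 1 q) l | first-pair 1 q = ifz-cons (pair 1 q) l

    run-zero : ∀ e p → runC e p 0 ≡ p
    run-zero e p = refl

    run-suc : ∀ e p j → runC e p (suc j) ≡ runC e (pair (tail (first p)) (stepC e (head (first p)) (second p))) j
    run-suc e p j = refl

    run-halted : ∀ e p j → rowsC e (second p) ≡ 0 → second (runC e p j) ≡ second p
    run-halted e p zero    eq = refl
    run-halted e p (suc j) eq = trans (run-halted e (pair (tail (first p)) (stepC e (head (first p)) (second p))) j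
        (trans (cong (rowsC e) same) eq)) same
      where
      same : second (pair (tail (first p)) (stepC e (head (first p)) (second p))) ≡ second p
      same = trans (second-pair _ _) (step-halted e _ (second p) eq)

  -- A relation and not a function, because the association list keeps overwritten entries and so
  -- depends on the past of the run.
  record Codes {k : ℕ} (c : ℕ) (cf : Config k) : Set where
    constructor codes
    field
      codes-state    : first c ≡ state cf
      codes-contents : ∀ i → get (second c) (toℕ i) ≡ tapeC (lookup (contents cf) i)
  open Codes

  codes-update : ∀ {k} {c q q′} {ts : Vec Tape k} i t {tp} → Codes c (config q ts) →
    tp ≡ tapeC t → Codes (pair q′ (cons (pair (toℕ i) tp) (second c))) (config q′ (ts [ i ]≔ t))
  codes-update {c = c} {q′ = q′} {ts} i t {tp} cd eq = codes (first-pair _ _)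
      λ i′ → trans (cong (λ s → get s (toℕ i′)) (second-pair q′ _)) (go i′)
    where
    s = second c
    go : ∀ i′ → get (cons (pair (toℕ i) tp) s) (toℕ i′) ≡ tapeC (lookup (ts [ i ]≔ t) i′)
    go i′ with i′ Fin.≟ i
    ... | yes refl = trans (get-same (toℕ i) tp s) (trans eq (cong tapeC (sym (lookup∘update i ts t))))
    ... | no i′≢i = trans (get-other tp s (λ e → i′≢i (sym (Fin.toℕ-injective e))))
          (trans (codes-contents cd i′) (cong tapeC (sym (lookup∘update′ i′≢i ts t))))

  module _ (M : Machine) where

    private
      e = index M

    index-second : second e ≡ rowsList (table M)
    index-second = trans (cong second (sym (pair-def (workTapes M) (rowsList (table M))))) (second-pair _ _)

    index-first : first e ≡ workTapes M
    index-first = trans (cong first (sym (pair-def (workTapes M) (rowsList (table M))))) (first-pair _ _)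

    opaque
      unfolding rowsC initialC

      rows-none : ∀ {c} {cf : Config (tapes M)} → Codes c cf → rowAt (table M) (state cf) ≡ nothing → rowsC e c ≡ 0
      rows-none cd eq = trans (cong₂ dropC index-second (codes-state cd)) (drop-none (table M) _ eq)

      rows-some : ∀ {c r} {cf : Config (tapes M)} → Codes c cf → rowAt (table M) (state cf) ≡ just r →
        ∃[ l ] rowsC e c ≡ cons (codeRow r) l
      rows-some {cf = cf} cd eq with drop-some (table M) (state cf) eq
      ... | l , eq′ = l , trans (cong₂ dropC index-second (codes-state cd)) eq′

      codes-initial : ∀ n → Codes (initialC n) (initial M n)
      codes-initial n = codes (first-pair _ _) λ i → trans (cong (λ s → get s (toℕ i)) (second-pair 0 _)) (go i)
        where
        go : ∀ i → get (cons (pair 0 (unaryC n)) 0) (toℕ i) ≡ tapeC (lookup (contents (initial M n)) i)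
        go zero    = trans (get-same 0 _ 0) (unary-tapeC n)
        go (suc i) = trans (get-other {0} {suc (toℕ i)} _ 0 (λ ())) (trans (get-empty _) (trans (sym pair-zero)
          (trans (cong (pair 0) (sym pair-zero)) (cong tapeC (sym (lookup-replicate i (unary 0)))))))

    halted : ∀ {c} {cf : Config (tapes M)} → Codes c cf → rowsC e c ≡ 0 → rowAt (table M) (state cf) ≡ nothing
    halted {cf = cf} cd eq with rowAt (table M) (state cf) in row
    ... | nothing = refl
    ... | just r with rows-some cd row
    ...   | l , eq′ = contradiction (trans (sym eq′) eq) cons≢0

    codes-inspect : ∀ {c q ts} a {t a₀ a₁} → Codes c (config q ts) → rowAt (table M) q ≡ just (inspect t a₀ a₁) →
      let b = if Tape.scanned (lookup ts t) then a₁ else a₀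
      in Codes (stepC e a c) (config (Action.next b) (ts [ t ]≔ act b (lookup ts t)))
    codes-inspect {c} {q} {ts} a {t} {a₀} {a₁} cd row with rows-some cd row
    ... | l , eq = subst (λ x → Codes x (config (Action.next b) (ts [ t ]≔ act b (lookup ts t)))) (sym step)
          (codes-update t (act b (lookup ts t)) cd (act-tapeC b (lookup ts t)))
      where
      b = if Tape.scanned (lookup ts t) then a₁ else a₀
      tp = get (second c) (toℕ t)
      bC = ifz (first (second tp)) (codeAction a₀) (codeAction a₁)
      choose : ∀ x → ifz (codeBool x) (codeAction a₀) (codeAction a₁) ≡ codeAction (if x then a₁ else a₀)
      choose false = refl
      choose true  = refl
      bC-eq : bC ≡ codeAction b
      bC-eq = trans (cong (λ x → ifz x (codeAction a₀) (codeAction a₁)) (trans (cong (λ tp → first (second tp)) (codes-contents cd t))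
                (trans (cong first (second-pair _ _)) (first-pair _ _)))) (choose (Tape.scanned (lookup ts t)))
      step : stepC e a c ≡ pair (Action.next b) (cons (pair (toℕ t) (actC (codeAction b) (tapeC (lookup ts t)))) (second c))
      step = trans (step-inspect e a c (trans eq (cong (λ r → cons r l) (row-inspect t a₀ a₁))))
        (trans (cong₂ (λ b tp → pair (second (second b)) (cons (pair (toℕ t) (actC b tp)) (second c))) bC-eq (codes-contents cd t))
          (cong (λ q → pair q (cons (pair (toℕ t) (actC (codeAction b) (tapeC (lookup ts t)))) (second c)))
            (trans (cong second (action-second b)) (second-pair _ _))))

    codes-query : ∀ {c q ts} a {q′} → Codes c (config q ts) → rowAt (table M) q ≡ just (query q′) →
      Codes (stepC e a c) (config q′ (ts [ suc zero ]≔ unary a))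
    codes-query {c} {q} {ts} a {q′} cd row with rows-some cd row
    ... | l , eq = subst (λ x → Codes x (config q′ (ts [ suc zero ]≔ unary a)))
          (sym (step-query e a c (trans eq (cong (λ r → cons r l) (row-query {tapes M} q′)))))
          (codes-update (suc zero) (unary a) cd (unary-tapeC a))

    module _ {A : Pred ℕ 0ℓ} where

      challenge-answer : ∀ {p q ts q′} → Codes (second p) (config q ts) → rowAt (table M) q ≡ just (query q′) →
        Ensures A (challengeC e p) ⇔ χ A (value (lookup ts (suc zero))) (head (first p))
      challenge-answer {p} {q} {ts} {q′} cd row with rows-some cd row
      ... | l , eq = subst₂ (λ o v → Ensures A o ⇔ χ A v (head (first p)))
            (sym (challenge-query e p (trans eq (cong (λ r → cons r l) (row-query {tapes M} q′)))))
            (trans (cong valueC (codes-contents cd (suc zero))) (value-tapeC (lookup ts (suc zero))))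
            (ensures-answer A _ _)

      -- Induction on the claimed number of steps. The objection at time 0 certifies the answer used
      -- by the present step, and the objections at later times are those against the rest of the
      -- run.
      soundness : ∀ T p cf → Codes (second p) cf → (∀ j → Ensures A (challengeC e (runC e p j))) →
        rowsC e (second (runC e p T)) ≡ 0 →
        ∃[ cf′ ] (Star (Step M (χ A)) cf cf′ × rowAt (table M) (state cf′) ≡ nothing)
      soundness zero p cf cd ens halt = cf , ε , halted cd (trans (cong (λ p → rowsC e (second p)) (sym (run-zero e p))) halt)
      soundness (suc T) p cf@(config q ts) cd ens halt with rowAt (table M) q in row
      ... | nothing = cf , ε , row
      ... | just (inspect t a₀ a₁) with soundness T p′ _
              (subst (λ x → Codes x _) (sym (second-pair _ _)) (codes-inspect (head (first p)) cd row))
              (λ j → subst (λ p → Ensures A (challengeC e p)) (run-suc e p j) (ens (suc j)))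
              (trans (cong (λ p → rowsC e (second p)) (sym (run-suc e p T))) halt)
        where p′ = pair (tail (first p)) (stepC e (head (first p)) (second p))
      ...   | cf′ , steps , halt′ = cf′ , inspecting row ◅ steps , halt′
      soundness (suc T) p cf@(config q ts) cd ens halt | just (query q′) with soundness T p′ (config q′ (ts [ suc zero ]≔ unary (head (first p))))
              (subst (λ x → Codes x (config q′ (ts [ suc zero ]≔ unary (head (first p))))) (sym (second-pair _ _)) (codes-query (head (first p)) cd row))
              (λ j → subst (λ p → Ensures A (challengeC e p)) (run-suc e p j) (ens (suc j)))
              (trans (cong (λ p → rowsC e (second p)) (sym (run-suc e p T))) halt)
        where p′ = pair (tail (first p)) (stepC e (head (first p)) (second p))
      ...   | cf′ , steps , halt′ = cf′ , querying {a = head (first p)} row (Equivalence.to (challenge-answer {p} cd row)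
                (subst (λ p → Ensures A (challengeC e p)) (run-zero e p) (ens 0))) ◅ steps , halt′

      Evidence : ℕ → Set
      Evidence c = ∃[ T ] ∃[ l ] (rowsC e (second (runC e (pair l c) T)) ≡ 0
                                 × ∀ j → Ensures A (challengeC e (runC e (pair l c) j)))

      -- The premise on the present answer is asked for every list l because the list of later
      -- answers is only produced by the remaining run.
      prepend : ∀ {c} a → (∀ l → Ensures A (challengeC e (pair (cons a l) c))) → Evidence (stepC e a c) → Evidence c
      prepend {c} a now (T , l , halt , ens) = suc T , cons a l ,
          trans (cong (λ p → rowsC e (second p)) (shift T)) halt , later
        where
        shift : ∀ j → runC e (pair (cons a l) c) (suc j) ≡ runC e (pair l (stepC e a c)) j
        shift j = trans (run-suc e _ j) (cong (λ p → runC e p j) (cong₂ pair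
          (trans (cong tail (first-pair _ _)) (tail-cons a l))
          (cong₂ (stepC e) (trans (cong head (first-pair _ _)) (head-cons a l)) (second-pair _ _))))
        later : ∀ j → Ensures A (challengeC e (runC e (pair (cons a l) c) j))
        later zero    = subst (λ p → Ensures A (challengeC e p)) (sym (run-zero e _)) (now l)
        later (suc j) = subst (λ p → Ensures A (challengeC e p)) (sym (shift j)) (ens j)

      completeness : ∀ {cf cf′ c} → Codes c cf → Star (Step M (χ A)) cf cf′ → rowAt (table M) (state cf′) ≡ nothing → Evidence c
      completeness {c = c} cd ε halt = 0 , 0 , stops 0 , λ j →
          subst (Ensures A) (sym (challenge-halted e _ (stops j))) (ensures-wins A)
        where
        stops : ∀ j → rowsC e (second (runC e (pair 0 c) j)) ≡ 0
        stops j = trans (cong (rowsC e) (trans (run-halted e (pair 0 c) j (trans (cong (rowsC e) (second-pair 0 c)) (rows-none cd halt)))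
                    (second-pair 0 c))) (rows-none cd halt)
      completeness {c = c} cd (inspecting {t = t} {a₀} {a₁} row ◅ steps) halt with rows-some cd row
      -- The list has one answer for each step, so an inspecting step uses up an entry that is never
      -- read.
      ... | l′ , eq = prepend 0
            (λ l → subst (Ensures A) (sym (challenge-inspect e _
                (trans (cong (rowsC e) (second-pair _ c)) (trans eq (cong (λ r → cons r l′) (row-inspect t a₀ a₁))))))
              (ensures-wins A))
            (completeness (codes-inspect 0 cd row) steps halt)
      completeness {c = c} cd (querying {ts = ts} {q′} {a} row answer ◅ steps) halt = prepend a
          (λ l → Equivalence.from (challenge-answer {pair (cons a l) c} (subst (λ x → Codes x _) (sym (second-pair _ c)) cd) row)
            (subst (χ A (value (lookup ts (suc zero)))) (sym (trans (cong head (first-pair _ _)) (head-cons a l))) answer))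
          (completeness (codes-query a cd row) steps halt)

  opaque
    unfolding badRow badAction badRowAt

    good-action : ∀ a → badAction (codeAction a) ≡ 0
    good-action a = cong₂ _+_ (trans (cong (_∸ 1) (action-first a)) (bool (Action.write a)))
        (trans (cong (λ x → first x ∸ 2) (action-second a)) (trans (cong (_∸ 2) (first-pair _ _)) (moves (Action.move a))))
      where
      bool : ∀ b → codeBool b ∸ 1 ≡ 0
      bool false = refl
      bool true  = refl
      moves : ∀ m → codeMove m ∸ 2 ≡ 0
      moves L    = refl
      moves R    = refl
      moves stay = refl

    good-row : ∀ {k} (r : Row (2 + k)) → badRow k (codeRow r) ≡ 0
    good-row {k} (query q) rewrite row-query {2 + k} q | first-pair 1 q = refl
    good-row {k} (inspect t a₀ a₁) rewrite row-inspect t a₀ a₁ | first-pair 0 (pair (toℕ t) (pair (codeAction a₀) (codeAction a₁)))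
      | second-pair 0 (pair (toℕ t) (pair (codeAction a₀) (codeAction a₁))) | first-pair (toℕ t) (pair (codeAction a₀) (codeAction a₁))
      | second-pair (toℕ t) (pair (codeAction a₀) (codeAction a₁)) | first-pair (codeAction a₀) (codeAction a₁)
      | second-pair (codeAction a₀) (codeAction a₁) | good-action a₀ | good-action a₁
      = trans (+-identityʳ _) (m≤n⇒m∸n≡0 (s≤s⁻¹ (Fin.toℕ<n t)))

    decode-action : ∀ x → badAction x ≡ 0 → ∃[ a ] codeAction a ≡ x
    decode-action x eq with bool (first x) (m+n≡0⇒m≡0 (first x ∸ 1) eq)
                          | moves (first (second x)) (m+n≡0⇒n≡0 (first x ∸ 1) eq)
      where
      bool : ∀ n → n ∸ 1 ≡ 0 → ∃[ b ] codeBool b ≡ n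
      bool 0 _ = false , refl
      bool 1 _ = true , refl
      moves : ∀ n → n ∸ 2 ≡ 0 → ∃[ m ] codeMove m ≡ n
      moves 0 _ = L , refl
      moves 1 _ = R , refl
      moves 2 _ = stay , refl
    ... | w , eqw | m , eqm = action w m (second (second x)) ,
          trans (cong₂ (λ w m → ⟨ w , ⟨ m , second (second x) ⟩ ⟩) eqw eqm)
            (trans (cong (λ y → ⟨ first x , y ⟩) (trans (sym (pair-def _ (second (second x)))) (pair-eta (second x))))
              (trans (sym (pair-def (first x) (second x))) (pair-eta x)))

    decode-row : ∀ k x → badRow k x ≡ 0 → ∃[ r ] codeRow {2 + k} r ≡ x
    decode-row k x eq with first x in tag
    ... | 1 = query (second x) , trans (row-query {2 + k} (second x)) (trans (cong (λ y → pair y (second x)) (sym tag)) (pair-eta x))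
    ... | 0 with decode-action (first (second (second x))) (m+n≡0⇒m≡0 (badAction (first (second (second x)))) (m+n≡0⇒n≡0 (first (second x) ∸ suc k) eq))
               | decode-action (second (second (second x))) (m+n≡0⇒n≡0 (badAction (first (second (second x)))) (m+n≡0⇒n≡0 (first (second x) ∸ suc k) eq))
    ...   | a₀ , eq₀ | a₁ , eq₁ = inspect (fromℕ< t<) a₀ a₁ , trans (row-inspect (fromℕ< t<) a₀ a₁)
            (trans (cong₂ (λ y z → pair y z) (sym tag)
              (trans (cong₂ pair (Fin.toℕ-fromℕ< t<) (trans (cong₂ pair eq₀ eq₁) (pair-eta (second (second x))))) (pair-eta (second x))))
              (pair-eta x))
            where
            t< : first (second x) < 2 + k
            t< = s≤s (m∸n≡0⇒m≤n (m+n≡0⇒m≡0 (first (second x) ∸ suc k) eq))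

    good-rows : ∀ M j → badRowAt (index M) j ≡ 0
    good-rows M j with rowAt (table M) j in row
    ... | nothing rewrite index-second M | drop-none (table M) j row = refl
    ... | just r with drop-some (table M) j row
    ...   | l , eq rewrite index-second M | index-first M | eq | head-cons (codeRow r) l =
            trans (ifz-cons (codeRow r) l) (good-row r)

    decode-rows : ∀ k xs → (∀ j → ifz (dropC (codeList xs) j) 0 (badRow k (head (dropC (codeList xs) j))) ≡ 0) →
      ∃[ rs ] map (codeRow {2 + k}) rs ≡ xs
    decode-rows k []       good = [] , refl
    decode-rows k (x ∷ xs) good with decode-row k x
        (trans (sym (trans (cong (λ l → ifz l 0 (badRow k (head l))) (trans (drop-here _) (codeList-cons x xs)))
          (trans (ifz-cons x (codeList xs)) (cong (badRow k) (head-cons x (codeList xs)))))) (good 0))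
      | decode-rows k xs (λ j → trans (cong (λ l → ifz l 0 (badRow k (head l))) (sym (drop-suc x xs j))) (good (suc j)))
    ... | r , refl | rs , refl = r ∷ rs , refl

    decode-machine : ∀ e → (∀ j → badRowAt e j ≡ 0) → ∃[ M ] index M ≡ e
    decode-machine e good with codeList-surjective (second e)
    ... | xs , eq with decode-rows (first e) xs
            (subst (λ l → ∀ j → ifz (dropC l j) 0 (badRow (first e) (head (dropC l j))) ≡ 0) eq good)
    ...   | rs , refl = machine (first e) rs , trans (sym (pair-def (first e) _)) (trans (cong (pair (first e)) (sym eq)) (pair-eta e))

  module _ (A : Pred ℕ 0ℓ) where

    opaque
      unfolding outcomeC startC

      outcome-challenge : ∀ e T l j → badRowAt e j ≡ 0 → rowsC e (second (runC e (pair l (initialC e)) T)) ≡ 0 →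
        outcomeC e (pair T l) j ≡ challengeC e (runC e (pair l (initialC e)) j)
      outcome-challenge e T l j good stops rewrite good | first-pair T l | second-pair T l | stops = refl

      halting⇒evidence : ∀ M {m} → M [ χ A ] index M ⇓ m → ∃[ x ] ∀ j → Ensures A (outcomeC (index M) x j)
      halting⇒evidence M (cf , steps , halt , _) with completeness M (codes-initial M (index M)) steps halt
      ... | T , l , stops , ens = pair T l , λ j →
            subst (Ensures A) (sym (outcome-challenge (index M) T l j (good-rows M j) stops)) (ens j)

      evidence⇒halting : ∀ e x → (∀ j → Ensures A (outcomeC e x j)) → ∃[ M ] (index M ≡ e × ∃[ m ] (M [ χ A ] e ⇓ m))
      evidence⇒halting e x ens with decode-machine e good
        where
        good : ∀ j → badRowAt e j ≡ 0
        good j with badRowAt e j | ens j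
        ... | zero  | _   = refl
        ... | suc _ | bad = ⊥-elim (¬ensures-loses A bad)
      ... | M , refl with soundness M (first x) (pair (second x) (initialC e)) (initial M e)
                            (subst (λ c → Codes c (initial M e)) (sym (second-pair _ _)) (codes-initial M e))
                            (λ j → proj₂ (split j)) (proj₁ (split 0))
        where
        split : ∀ j → rowsC e (second (runC e (pair (second x) (initialC e)) (first x))) ≡ 0
                      × Ensures A (challengeC e (runC e (pair (second x) (initialC e)) j))
        split j with badRowAt e j | rowsC e (second (runC e (pair (second x) (initialC e)) (first x))) | ens j
        ... | zero  | zero  | good = refl , good
        ... | zero  | suc _ | bad  = ⊥-elim (¬ensures-loses A bad)
        ... | suc _ | _     | bad  = ⊥-elim (¬ensures-loses A bad)
      ...   | cf , steps , halt = M , refl , _ , cf , steps , halt , refl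

    -- The normal form of a set enumerable in A. The universal objection is what replaces the
    -- unboundedly many oracle answers of a run by the single one that it points at, leaving one
    -- question about A of either sign.
    jump⇔evidence : ∀ e → Jump A e ⇔ (¬ ¬ (∃[ x ] ∀ j → Ensures A (outcomeC e x j)))
    jump⇔evidence e = mk⇔
      (λ jump ¬ev → jump λ { (M , refl , _ , run) → ¬ev (halting⇒evidence M run) })
      (λ ev ¬halt → ev λ { (x , ens) → ¬halt (evidence⇒halting e x ens) })

-- The game for the finite jumps and its histories

module Game where

  open import Data.Empty using (⊥; ⊥-elim)
  open import Data.List.Base using (List; []; _∷_; length)
  open import Data.Nat.Base
  open import Data.Nat.Properties
  open import Data.Product.Base using (∃-syntax; _×_; _,_; proj₁; proj₂)
  open import Function.Base using (_∘_; id)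
  open import Function.Bundles using (_⇔_; mk⇔; module Equivalence)
  import Function.Properties.Equivalence as ⇔
  open import Level using (0ℓ)
  open import Relation.Binary.PropositionalEquality
  open import Relation.Nullary using (¬_; contradiction)
  open import Relation.Unary using (Pred)
  open import Defs using (𝟎^⟨_⟩)
  open Pairing
  open Program
  open Machines
  open Functions
  open Simulation

  open Equivalence using (to; from)

  -- ⟨ p , ⟨ k , n ⟩ ⟩ is the claim that n lies in the k-th jump, made by the
  -- existential player if p = 0 and by the universal player if p = 1.
  opaque
    resolve : ℕ → ℕ → ℕ → ℕ
    resolve p k o = pair (ifz (first o) p (1 ∸ p)) (pair (ifz (first (second o)) 0 k) (second (second o)))

    resolveF : Fun₃ resolve
    resolveF = fun₃ (pairF $₂ (ifzF $₃ (firstF $₁ v2 , v0 , monusF $₂ (lit 1 , v0)) ,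
        pairF $₂ (ifzF $₃ (firstF $₁ (secondF $₁ v2) , lit 0 , v1) , secondF $₁ (secondF $₁ v2)))) (λ _ _ _ → refl)

  -- One round, on a list of three successors of moves.
  opaque
    roundC : ℕ → ℕ → ℕ
    roundC l st =
      let p = first st
          k = first (second st)
          x = pred (head l)
          y = pred (head (tail l))
          z = pred (head (tail (tail l)))
      in ifz k st (resolve p (pred k) (outcomeC (second (second st)) (ifz p x y) (ifz p y z)))

    roundF : Fun₂ roundC
    roundF =
      let p = firstF $₁ v1
          k = firstF $₁ (secondF $₁ v1)
          x = predF $₁ (headF $₁ v0)
          y = predF $₁ (headF $₁ (tailF $₁ v0))
          z = predF $₁ (headF $₁ (tailF $₁ (tailF $₁ v0)))
      in fun₂ (ifzF $₃ (k , v1 , resolveF $₃ (p , predF $₁ k ,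
           outcomeF $₃ (secondF $₁ (secondF $₁ v1) , ifzF $₃ (p , x , y) , ifzF $₃ (p , y , z))))) (λ _ _ → refl)

    -- At level 0 the claim is membership in the empty set, so the claimant loses: the existential
    -- player wins exactly if p = 1.
    acceptC : ℕ → ℕ
    acceptC st = ifz (first (second st)) (first st) 0

    acceptF : Fun₁ acceptC
    acceptF = fun₁ (ifzF $₃ (firstF $₁ (secondF $₁ v0) , firstF $₁ v0 , lit 0)) (λ _ → refl)

  triple : ℕ → ℕ → ℕ → ℕ → ℕ
  triple x y z l = cons (suc x) (cons (suc y) (cons (suc z) l))

  claim : ℕ → ℕ → ℕ → ℕ
  claim p k n = pair p (pair k n)

  opaque
    unfolding roundC

    round-done : ∀ p n l → roundC l (claim p 0 n) ≡ claim p 0 n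
    round-done p n l rewrite second-pair p (pair 0 n) | first-pair 0 n = refl

    round-claim : ∀ p k n x y z l →
      roundC (triple x y z l) (claim p (suc k) n) ≡ resolve p k (outcomeC n (ifz p x y) (ifz p y z))
    round-claim p k n x y z l
      rewrite first-pair p (pair (suc k) n) | second-pair p (pair (suc k) n) | first-pair (suc k) n | second-pair (suc k) n
      | head-cons (suc x) (cons (suc y) (cons (suc z) l)) | tail-cons (suc x) (cons (suc y) (cons (suc z) l))
      | head-cons (suc y) (cons (suc z) l) | tail-cons (suc y) (cons (suc z) l) | head-cons (suc z) l = refl

    accept-claim : ∀ p n → acceptC (claim p 0 n) ≡ p
    accept-claim p n rewrite second-pair p (pair 0 n) | first-pair 0 n | first-pair p (pair 0 n) = refl

  ⇔-sym : ∀ {A B : Set} → A ⇔ B → B ⇔ A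
  ⇔-sym = ⇔.sym

  infixr 4 _▸_
  _▸_ : ∀ {A B C : Set} → A ⇔ B → B ⇔ C → A ⇔ C
  _▸_ = ⇔.trans

  ≡⇒⇔ : ∀ {A B : Set} → A ≡ B → A ⇔ B
  ≡⇒⇔ refl = ⇔.refl

  Stable : Pred ℕ 0ℓ → Set
  Stable P = ∀ n → ¬ ¬ P n → P n

  Wins : ℕ → ℕ → Set
  Wins zero    st = acceptC st ≢ 0
  Wins (suc j) st = ¬ (∀ x → ¬ (∀ y → ¬ (∀ z → ¬ Wins j (roundC (triple x y z 0) st))))

  wins-stable : ∀ j → Stable (Wins j)
  wins-stable zero    st nn eq = nn λ f → f eq
  wins-stable (suc j) st nn f  = nn λ g → g f

  jump-stable : ∀ k → Stable 𝟎^⟨ k ⟩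
  jump-stable zero    n nn = nn id
  jump-stable (suc k) n nn f = nn λ g → g f

  ensures-stable : ∀ {A} → Stable A → Stable (Ensures A)
  ensures-stable st o nn =
    (λ eq → (λ g → nn λ e → proj₁ (proj₁ e eq) g) , st _ λ ¬a → nn λ e → ¬a (proj₂ (proj₁ e eq))) ,
    λ ne c → nn λ e → proj₂ e ne c

  ¬-cong : ∀ {A B : Set} → A ⇔ B → (¬ A) ⇔ (¬ B)
  ¬-cong e = mk⇔ (_∘ from e) (_∘ to e)

  ∀-cong : ∀ {A B : ℕ → Set} → (∀ x → A x ⇔ B x) → (∀ x → A x) ⇔ (∀ x → B x)
  ∀-cong e = mk⇔ (λ f x → to (e x) (f x)) (λ f x → from (e x) (f x))

  Signed : ℕ → Set → Set
  Signed zero    A = A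
  Signed (suc _) A = ¬ A

  signed-cong : ∀ p {A B} → A ⇔ B → Signed p A ⇔ Signed p B
  signed-cong zero    e = e
  signed-cong (suc p) e = ¬-cong e

  ¬¬-⇔ : ∀ {A : Set} → (¬ ¬ A → A) → (¬ ¬ A) ⇔ A
  ¬¬-⇔ st = mk⇔ st (λ a ¬a → ¬a a)

  -- Stability is used only when both signs are negative, where two negations cancel.
  signed-flip : ∀ f p {A} → p ≤ 1 → (¬ ¬ A → A) → Signed (ifz f p (1 ∸ p)) A ⇔ Signed p (Signed f A)
  signed-flip zero    p             p≤1 st = mk⇔ id id
  signed-flip (suc f) zero          p≤1 st = mk⇔ id id
  signed-flip (suc f) (suc zero)    p≤1 st = ⇔-sym (¬¬-⇔ st)
  signed-flip (suc f) (suc (suc p)) (s≤s ()) st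

  ensures-signed : ∀ A o → Ensures A o ⇔ Signed (first o) (first (second o) ≢ 0 × A (second (second o)))
  ensures-signed A o with first o
  ... | zero  = mk⇔ (λ e → proj₁ e refl) (λ c → (λ _ → c) , λ 0≢0 → contradiction refl 0≢0)
  ... | suc _ = mk⇔ (λ e → proj₂ e (λ ())) (λ ¬c → (λ ()) , λ _ → ¬c)

  -- A dispute settled on the spot is recast as a claim about level 0, the empty set, so that the
  -- game has one kind of position only.
  lowered : ∀ g k v → 𝟎^⟨ ifz g 0 k ⟩ v ⇔ (g ≢ 0 × 𝟎^⟨ k ⟩ v)
  lowered zero    k v = mk⇔ ⊥-elim (λ c → proj₁ c refl)
  lowered (suc g) k v = mk⇔ (λ a → (λ ()) , a) proj₂

  opaque
    unfolding resolve

    wins-resolve : ∀ j → (∀ p k n → p ≤ 1 → k ≤ j → Wins j (claim p k n) ⇔ Signed p (𝟎^⟨ k ⟩ n)) →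
      ∀ p k o → p ≤ 1 → k ≤ j → Wins j (resolve p k o) ⇔ Signed p (Ensures 𝟎^⟨ k ⟩ o)
    wins-resolve j wins⇔truth p k o p≤1 k≤j =
      wins⇔truth (ifz f p (1 ∸ p)) (ifz g 0 k) v (flip≤ f) (low≤ g) ▸
      signed-flip f p p≤1 (jump-stable (ifz g 0 k) v) ▸
      signed-cong p (signed-cong f (lowered g k v) ▸ ⇔-sym (ensures-signed 𝟎^⟨ k ⟩ o))
      where
      f g v : ℕ
      f = first o
      g = first (second o)
      v = second (second o)
      flip≤ : ∀ f → ifz f p (1 ∸ p) ≤ 1
      flip≤ zero    = p≤1
      flip≤ (suc f) = m∸n≤m 1 p
      low≤ : ∀ g → ifz g 0 k ≤ j
      low≤ zero    = z≤n
      low≤ (suc g) = k≤j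

  constant-∃ : ∀ {A : Set} → (¬ ¬ A → A) → (¬ (ℕ → ¬ A)) ⇔ A
  constant-∃ st = mk⇔ (λ f → st λ ¬a → f λ _ → ¬a) (λ a f → f 0 a)

  constant-∀ : ∀ {A : Set} → (ℕ → A) ⇔ A
  constant-∀ = mk⇔ (λ f → f 0) (λ a _ → a)

  -- In a round the existential claimant uses x as evidence against the objection y, and z is idle;
  -- the universal claimant uses y as evidence against the objection z, and x is idle. Idle moves
  -- drop out by `constant-∃`. Each contested round lowers the level by at least one, so j ≥ k
  -- rounds suffice; at level 0 the surplus rounds change nothing.
  wins⇔truth : ∀ j p k n → p ≤ 1 → k ≤ j → Wins j (claim p k n) ⇔ Signed p (𝟎^⟨ k ⟩ n)
  wins⇔truth zero    p          zero    n p≤1 k≤j = ¬-cong (≡⇒⇔ (cong (_≡ 0) (accept-claim p n))) ▸ nonzero p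
    where
    nonzero : ∀ p → (p ≢ 0) ⇔ Signed p ⊥
    nonzero zero    = mk⇔ (λ f → f refl) ⊥-elim
    nonzero (suc p) = mk⇔ (λ _ → id) (λ _ ())
  wins⇔truth (suc j) p          zero    n p≤1 k≤j =
    ¬-cong (∀-cong λ x → ¬-cong ((∀-cong λ y → ¬-cong (∀-cong λ z →
        ¬-cong (≡⇒⇔ (cong (Wins j) (round-done p n (triple x y z 0))))) ▸
      constant-∃ (wins-stable j (claim p 0 n))) ▸ constant-∀)) ▸
    constant-∃ (wins-stable j (claim p 0 n)) ▸
    wins⇔truth j p 0 n p≤1 z≤n
  wins⇔truth (suc j) zero       (suc k) n p≤1 (s≤s k≤j) =
    ¬-cong (∀-cong λ x → ¬-cong (∀-cong λ y → ¬-cong (∀-cong λ z →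
        ¬-cong (≡⇒⇔ (cong (Wins j) (round-claim 0 k n x y z 0)) ▸
          wins-resolve j (wins⇔truth j) 0 k (outcomeC n x y) z≤n k≤j)) ▸
      constant-∃ (ensures-stable (jump-stable k) (outcomeC n x y)))) ▸
    mk⇔ (λ f g → f λ x h → g (x , h)) (λ f g → f λ (x , h) → g x h) ▸
    ⇔-sym (jump⇔evidence 𝟎^⟨ k ⟩ n)
  wins⇔truth (suc j) (suc zero) (suc k) n p≤1 (s≤s k≤j) =
    ¬-cong (∀-cong λ x → ¬-cong (∀-cong λ y → ¬-cong (∀-cong λ z →
        ¬-cong (≡⇒⇔ (cong (Wins j) (round-claim 1 k n x y z 0)) ▸
          wins-resolve j (wins⇔truth j) 1 k (outcomeC n y z) p≤1 k≤j) ▸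
        ¬¬-⇔ (ensures-stable (jump-stable k) (outcomeC n y z))))) ▸
    constant-∃ (λ nn y f → nn λ g → g y f) ▸
    mk⇔ (λ f g → g λ (y , h) → f y h) (λ f y h → f λ g → g (y , h)) ▸
    ¬-cong (⇔-sym (jump⇔evidence 𝟎^⟨ k ⟩ n))
  wins⇔truth (suc j) (suc (suc p)) (suc k) n (s≤s ()) k≤j

  -- A history is the number pair (… (pair (pair 1 h) b₁) …) bᵢ with all bᵢ
  -- positive; the root 1 is pair 1 0.
  unwinding : ℕ → ℕ → ℕ
  unwinding _ p = ifz (second (second p)) p (pair (cons (second (second p)) (first p)) (first (second p)))

  opaque
    unwindC : ℕ → ℕ
    unwindC K = first (loop K (pair 0 K) unwinding)

    unwindF : Fun₁ unwindC
    unwindF = fun₁ (firstF $₁ iter v0 (pairF $₂ (lit 0 , v0))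
      (ifzF $₃ (secondF $₁ (secondF $₁ v0) , v0 ,
        pairF $₂ (consF $₂ (secondF $₁ (secondF $₁ v0) , firstF $₁ v0) , firstF $₁ (secondF $₁ v0))))) (λ _ → refl)

    playC : ℕ → ℕ → ℕ → ℕ
    playC m l st = second (loop m (pair l st) (λ _ p → pair (tail (tail (tail (first p)))) (roundC (first p) (second p))))

    playF : Fun₃ playC
    playF = fun₃ (secondF $₁ iter v0 (pairF $₂ (v1 , v2))
      (pairF $₂ (tailF $₁ (tailF $₁ (tailF $₁ (firstF $₁ v0))) , roundF $₂ (firstF $₁ v0 , secondF $₁ v0)))) (λ _ _ _ → refl)

    -- The first entry of a history is 1 when the existential player has already
    -- won and m + 2 when membership of m in the ω-jump is at stake.
    judgeC : ℕ → ℕ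
    judgeC l =
      let m = pred (pred (head l))
      in ifz (pred (head l)) 1 (acceptC (playC m (tail l) (pair 0 (pair (second m) (first m)))))

    judgeF : Fun₁ judgeC
    judgeF =
      let m = predF $₁ (predF $₁ (headF $₁ v0))
      in fun₁ (ifzF $₃ (predF $₁ (headF $₁ v0) , lit 1 ,
           acceptF $₁ (playF $₃ (m , tailF $₁ v0 , pairF $₂ (lit 0 , pairF $₂ (secondF $₁ m , firstF $₁ m)))))) (λ _ → refl)

    verdictC : ℕ → ℕ
    verdictC K = judgeC (unwindC K)

    verdictF : Fun₁ verdictC
    verdictF = fun₁ (judgeF $₁ (unwindF $₁ v0)) (λ _ → refl)

  -- Admitting every count from K on, and an arbitrary list l collected so far, is what the
  -- induction along a history requires.
  Unwinds : ℕ → ℕ → ℕ → Set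
  Unwinds K l l′ = ∀ n → K ≤ n → first (loop n (pair l K) unwinding) ≡ l′

  opaque
    unfolding pair unwindC
    one-pair : 1 ≡ pair 1 0
    one-pair = refl

    -- The reason for storing successors of moves: only a positive second component makes unwinding
    -- decrease the history strictly, and only then does K bound the number of moves.
    first<pair : ∀ a b → a < pair a (suc b)
    first<pair a b = ≤-trans (subst (suc a ≤_) (sym (+-suc a b)) (s≤s (m≤m+n a b)))
      (≤-trans (n≤triangle (a + suc b)) (m≤m+n _ (suc b)))

    unwind-from : ∀ {K l} → Unwinds K 0 l → unwindC K ≡ l
    unwind-from {K} u = u K ≤-refl

  unwinds-root : ∀ l → Unwinds 1 l l
  unwinds-root l n _ = go n
    where
    go : ∀ n → first (loop n (pair l 1) unwinding) ≡ l
    go zero    = first-pair l 1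
    go (suc n) rewrite second-pair l 1 | trans (cong second one-pair) (second-pair 1 0) = go n

  unwinds-step : ∀ {a b l l′} → Unwinds a (cons (suc b) l) l′ → Unwinds (pair a (suc b)) l l′
  unwinds-step {a} {b} {l} u zero    p≤n = contradiction (≤-trans (first<pair a b) p≤n) λ ()
  unwinds-step {a} {b} {l} u (suc n) p≤n
    rewrite second-pair l (pair a (suc b)) | second-pair a (suc b) | first-pair l (pair a (suc b)) | first-pair a (suc b)
    = u n (s≤s⁻¹ (≤-trans (first<pair a b) p≤n))

  -- After a universal forfeit play goes on from a history of the existential player's choice.
  -- Descendants of `pair 1 1` serve for this: their first entry is 1, which decides the verdict
  -- whatever is played afterwards.
  data Won : ℕ → Set where
    root : Won (pair 1 1)
    extend : ∀ {K} x → Won K → Won (pair K (suc x))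

  won-unwinds : ∀ {K} → Won K → ∀ l → ∃[ l′ ] Unwinds K l (cons 1 l′)
  won-unwinds root        l = l , unwinds-step (unwinds-root (cons 1 l))
  won-unwinds (extend x w) l with won-unwinds w (cons (suc x) l)
  ... | l′ , u = l′ , unwinds-step u

  Triple : Set
  Triple = ℕ × ℕ × ℕ

  -- Latest round first.
  history : ℕ → List Triple → ℕ
  history h []                 = pair 1 (suc h)
  history h ((x , y , z) ∷ ts) = pair (pair (pair (history h ts) (suc x)) (suc y)) (suc z)

  moves : List Triple → ℕ → ℕ
  moves []                 l = l
  moves ((x , y , z) ∷ ts) l = moves ts (triple x y z l)

  position : ℕ → List Triple → ℕ
  position st []                 = st
  position st ((x , y , z) ∷ ts) = roundC (triple x y z 0) (position st ts)

  history-unwinds : ∀ h ts l → Unwinds (history h ts) l (cons (suc h) (moves ts l))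
  history-unwinds h []                 l = unwinds-step (unwinds-root (cons (suc h) l))
  history-unwinds h ((x , y , z) ∷ ts) l =
    unwinds-step (unwinds-step (unwinds-step (history-unwinds h ts (triple x y z l))))

  loop-last : ∀ n acc (s : ℕ → ℕ) → loop (suc n) acc (λ _ → s) ≡ s (loop n acc (λ _ → s))
  loop-last zero    acc s = refl
  loop-last (suc n) acc s = loop-last n (s acc) s

  opaque
    unfolding roundC playC judgeC verdictC

    round-triple : ∀ x y z l st → roundC (triple x y z l) st ≡ roundC (triple x y z 0) st
    round-triple x y z l st
      rewrite head-cons (suc x) (cons (suc y) (cons (suc z) l)) | tail-cons (suc x) (cons (suc y) (cons (suc z) l))
      | head-cons (suc y) (cons (suc z) l) | tail-cons (suc y) (cons (suc z) l) | head-cons (suc z) l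
      | head-cons (suc x) (cons (suc y) (cons (suc z) 0)) | tail-cons (suc x) (cons (suc y) (cons (suc z) 0))
      | head-cons (suc y) (cons (suc z) 0) | tail-cons (suc y) (cons (suc z) 0) | head-cons (suc z) 0 = refl

    play-moves : ∀ ts l st → loop (length ts) (pair (moves ts l) st)
        (λ _ p → pair (tail (tail (tail (first p)))) (roundC (first p) (second p))) ≡ pair l (position st ts)
    play-moves []                 l st = refl
    play-moves ((x , y , z) ∷ ts) l st = trans (loop-last (length ts) _ _) (trans (cong turn (play-moves ts (triple x y z l) st))
        (cong₂ pair (trans (cong (λ l → tail (tail (tail l))) (first-pair _ _)) tails)
          (trans (cong₂ roundC (first-pair _ _) (second-pair _ _)) (round-triple x y z l (position st ts)))))
      where
      turn : ℕ → ℕ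
      turn p = pair (tail (tail (tail (first p)))) (roundC (first p) (second p))
      tails : tail (tail (tail (triple x y z l))) ≡ l
      tails = trans (cong (λ l → tail (tail l)) (tail-cons _ _)) (trans (cong tail (tail-cons _ _)) (tail-cons _ _))

    verdict-won : ∀ {K} → Won K → verdictC K ≡ 1
    verdict-won w with won-unwinds w 0
    ... | l , u rewrite unwind-from u | head-cons 1 l = refl

    verdict-history : ∀ n k ts → length ts ≡ pair n k →
      verdictC (history (suc (pair n k)) ts) ≡ acceptC (position (claim 0 k n) ts)
    verdict-history n k ts len rewrite unwind-from (history-unwinds (suc (pair n k)) ts 0)
      | head-cons (suc (suc (pair n k))) (moves ts 0) | tail-cons (suc (suc (pair n k))) (moves ts 0)
      | first-pair n k | second-pair n k | sym len
      = cong acceptC (trans (cong second (play-moves ts 0 (claim 0 k n))) (second-pair _ _))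

  Some Every : Pred ℕ 0ℓ → Pred ℕ 0ℓ
  Some  P K = ¬ (∀ x → ¬ P (pair K (suc x)))
  Every P K = ∀ x → P (pair K (suc x))

  Winning : ℕ → Pred ℕ 0ℓ
  Winning zero    K = verdictC K ≢ 0
  Winning (suc j) = Some (Every (Some (Winning j)))

  winning-won : ∀ j {K} → Won K → Winning j K
  winning-won zero    w eq = contradiction (trans (sym (verdict-won w)) eq) λ ()
  winning-won (suc j) w f = f 0 λ y g → g 0 (winning-won j (extend 0 (extend y (extend 0 w))))

  -- The verdict replays exactly `pair n k` rounds, a number it reads off the first entry of the
  -- history; hence the condition that the rounds played and those to come add up to it.
  winning⇔wins : ∀ n k j ts → j + length ts ≡ pair n k →
    Winning j (history (suc (pair n k)) ts) ⇔ Wins j (position (claim 0 k n) ts)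
  winning⇔wins n k zero    ts eq = ¬-cong (≡⇒⇔ (cong (_≡ 0) (verdict-history n k ts eq)))
  winning⇔wins n k (suc j) ts eq = ¬-cong (∀-cong λ x → ¬-cong (∀-cong λ y → ¬-cong (∀-cong λ z →
    ¬-cong (winning⇔wins n k j ((x , y , z) ∷ ts) (trans (+-suc j (length ts)) eq)))))

  winning⇔jump : ∀ n k → Winning (pair n k) (pair 1 (2 + pair n k)) ⇔ 𝟎^⟨ k ⟩ n
  winning⇔jump n k = winning⇔wins n k (pair n k) [] (+-identityʳ _) ▸
    wins⇔truth (pair n k) 0 k n z≤n (subst (k ≤_) (sym (pair-def n k)) (second≤pair n k))

-- Real numbers as Cauchy sequences

module Reals where

  open import Data.Integer.Base as ℤ using (ℤ)
  open import Data.Nat.Base as ℕ using (ℕ; zero; suc; _⊔_)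
  import Data.Nat.Properties as ℕₚ
  open import Data.Product.Base using (∃-syntax; _×_; _,_; proj₁; proj₂)
  open import Data.Rational.Unnormalised.Base as ℚ using (ℚᵘ; mkℚᵘ; 0ℚᵘ; 1ℚᵘ; ½; *≤*; *≡*)
  import Data.Rational.Unnormalised.Properties as ℚₚ
  open import Data.Rational.Unnormalised.Solver using (module +-*-Solver)
  open import Data.Sum.Base using (inj₁; inj₂)
  open import Relation.Binary.PropositionalEquality using (_≡_; refl; sym; cong; subst)
  open import Relation.Nullary using (¬_; yes; no)
  open import Defs using (ℝ; seq; cauchy; ½^_; _≤_; _<_; _≈_; _+_; _*_; fromℚ; module CauchyLemmas)
  open CauchyLemmas using (half+half; ½^-nonNeg; shrink; bounded; scaled)
  open +-*-Solver using (solve; _:+_; _:*_; _:-_; :-_; _:=_)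
  open ℚₚ.≤-Reasoning

  abs≤ : ∀ {p q} → p ℚ.≤ q → ℚ.- p ℚ.≤ q → ℚ.∣ p ∣ ℚ.≤ q
  abs≤ {p} {q} l l′ with ℚₚ.∣p∣≡p∨∣p∣≡-p p
  ... | inj₁ eq = subst (ℚ._≤ q) (sym eq) l
  ... | inj₂ eq = subst (ℚ._≤ q) (sym eq) l′

  p≤∣p∣ : ∀ p → p ℚ.≤ ℚ.∣ p ∣
  p≤∣p∣ p with ℚₚ.≤-total 0ℚᵘ p
  ... | inj₁ 0≤p = ℚₚ.≤-reflexive (ℚₚ.≃-sym (ℚₚ.≃-reflexive (ℚₚ.0≤p⇒∣p∣≡p 0≤p)))
  ... | inj₂ p≤0 = ℚₚ.≤-trans p≤0 (ℚₚ.0≤∣p∣ p)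

  swap-∣-∣ : ∀ p q → ℚ.∣ p ℚ.- q ∣ ℚ.≃ ℚ.∣ q ℚ.- p ∣
  swap-∣-∣ p q = ℚₚ.≃-trans (ℚₚ.≃-sym (ℚₚ.∣-p∣≃∣p∣ (p ℚ.- q)))
    (ℚₚ.∣-∣-cong (solve 2 (λ p q → :- (p :- q) := q :- p) ℚₚ.≃-refl p q))

  -≤ : ∀ {p q r} → p ℚ.≤ q ℚ.+ r → p ℚ.- q ℚ.≤ r
  -≤ {p} {q} {r} l = begin
    p ℚ.- q          ≤⟨ ℚₚ.+-monoˡ-≤ (ℚ.- q) l ⟩
    q ℚ.+ r ℚ.- q    ≃⟨ solve 2 (λ q r → q :+ r :- q := r) ℚₚ.≃-refl q r ⟩
    r                ∎

  ≤+ : ∀ {p q r} → p ℚ.- q ℚ.≤ r → p ℚ.≤ q ℚ.+ r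
  ≤+ {p} {q} {r} l = begin
    p                ≃⟨ solve 2 (λ p q → p := q :+ (p :- q)) ℚₚ.≃-refl p q ⟩
    q ℚ.+ (p ℚ.- q)  ≤⟨ ℚₚ.+-monoʳ-≤ q l ⟩
    q ℚ.+ r          ∎

  ∣-∣≤ : ∀ {p q r} → p ℚ.≤ q ℚ.+ r → q ℚ.≤ p ℚ.+ r → ℚ.∣ p ℚ.- q ∣ ℚ.≤ r
  ∣-∣≤ {p} {q} l l′ = abs≤ (-≤ l)
    (ℚₚ.≤-trans (ℚₚ.≤-reflexive (solve 2 (λ p q → :- (p :- q) := q :- p) ℚₚ.≃-refl p q)) (-≤ l′))

  ≤+∣-∣ : ∀ p q → p ℚ.≤ q ℚ.+ ℚ.∣ p ℚ.- q ∣
  ≤+∣-∣ p q = ≤+ (p≤∣p∣ (p ℚ.- q))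

  0≤½^ : ∀ k → 0ℚᵘ ℚ.≤ ½^ k
  0≤½^ k = ℚₚ.nonNegative⁻¹ (½^ k) {{½^-nonNeg k}}

  ½^-suc≤ : ∀ k → ½^ suc k ℚ.≤ ½^ k
  ½^-suc≤ k = begin
    ½ ℚ.* ½^ k                      ≃⟨ ℚₚ.+-identityʳ (½ ℚ.* ½^ k) ⟨
    ½ ℚ.* ½^ k ℚ.+ 0ℚᵘ              ≤⟨ ℚₚ.+-monoʳ-≤ (½ ℚ.* ½^ k) (0≤½^ (suc k)) ⟩
    ½ ℚ.* ½^ k ℚ.+ ½ ℚ.* ½^ k       ≃⟨ half+half (½^ k) ⟩
    ½^ k                            ∎

  ½^-mono : ∀ {m n} → m ℕ.≤ n → ½^ n ℚ.≤ ½^ m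
  ½^-mono {m} m≤n with ℕₚ.m≤n⇒∃[o]m+o≡n m≤n
  ... | o , refl = go o
    where
    go : ∀ o → ½^ (m ℕ.+ o) ℚ.≤ ½^ m
    go zero    = ℚₚ.≤-reflexive (ℚₚ.≃-reflexive (cong ½^_ (ℕₚ.+-identityʳ m)))
    go (suc o) = ℚₚ.≤-trans (ℚₚ.≤-reflexive (ℚₚ.≃-reflexive (cong ½^_ (ℕₚ.+-suc m o)))) (ℚₚ.≤-trans (½^-suc≤ (m ℕ.+ o)) (go o))

  0<½^ : ∀ k → 0ℚᵘ ℚ.< ½^ k
  0<½^ zero    = ℚ.*<* (ℤ.+<+ (ℕ.s≤s ℕ.z≤n))
  0<½^ (suc k) = ℚₚ.positive⁻¹ (½ ℚ.* ½^ k) {{ℚₚ.pos*pos⇒pos ½ (½^ k) {{ℚ.positive (0<½^ k)}}}}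

  ½^-suc< : ∀ k → ½^ suc k ℚ.< ½^ k
  ½^-suc< k = begin-strict
    ½ ℚ.* ½^ k                      ≃⟨ ℚₚ.+-identityʳ (½ ℚ.* ½^ k) ⟨
    ½ ℚ.* ½^ k ℚ.+ 0ℚᵘ              <⟨ ℚₚ.+-monoʳ-< (½ ℚ.* ½^ k) (0<½^ (suc k)) ⟩
    ½ ℚ.* ½^ k ℚ.+ ½ ℚ.* ½^ k       ≃⟨ half+half (½^ k) ⟩
    ½^ k                            ∎

  Eventually : (ℕ → Set) → Set
  Eventually P = ∃[ N ] ∀ n → N ℕ.≤ n → P n

  eventually-map : ∀ {P Q : ℕ → Set} → (∀ n → P n → Q n) → Eventually P → Eventually Q
  eventually-map f (N , p) = N , λ n l → f n (p n l)

  infixr 4 _and_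
  _and_ : ∀ {P Q : ℕ → Set} → Eventually P → Eventually Q → Eventually (λ n → P n × Q n)
  (N , p) and (N′ , q) = N ⊔ N′ , λ n l → p n (ℕₚ.m⊔n≤o⇒m≤o N N′ l) , q n (ℕₚ.m⊔n≤o⇒n≤o N N′ l)

  eventually-sure : ∀ {P : Set} → Eventually (λ _ → P) → P
  eventually-sure (N , p) = p N ℕₚ.≤-refl

  Close : ℝ → ℝ → Set
  Close x y = ∀ k → Eventually (λ n → ℚ.∣ seq x n ℚ.- seq y n ∣ ℚ.≤ ½^ k)

  close⇒≈ : ∀ {x y} → Close x y → x ≈ y
  close⇒≈ {x} {y} c =
    (λ k → eventually-map (λ n l → ℚₚ.≤-trans (≤+∣-∣ (seq x n) (seq y n)) (ℚₚ.+-monoʳ-≤ (seq y n) l)) (c k)) ,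
    (λ k → eventually-map (λ n l → ℚₚ.≤-trans (≤+∣-∣ (seq y n) (seq x n))
             (ℚₚ.+-monoʳ-≤ (seq x n) (ℚₚ.≤-trans (ℚₚ.≤-reflexive (swap-∣-∣ (seq y n) (seq x n))) l))) (c k))

  ≈⇒close : ∀ {x y} → x ≈ y → Close x y
  ≈⇒close (l , l′) k = eventually-map (λ n (p , q) → ∣-∣≤ p q) (l k and l′ k)

  ≃⇒≈ : ∀ {x y} → (∀ n → seq x n ℚ.≃ seq y n) → x ≈ y
  ≃⇒≈ {x} {y} eq = (λ k → 0 , λ n _ → grow (ℚₚ.≤-reflexive (eq n)) k) , (λ k → 0 , λ n _ → grow (ℚₚ.≤-reflexive (ℚₚ.≃-sym (eq n))) k)
    where
    grow : ∀ {p q} → p ℚ.≤ q → ∀ k → p ℚ.≤ q ℚ.+ ½^ k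
    grow {p} {q} l k = begin
      p              ≤⟨ l ⟩
      q              ≃⟨ ℚₚ.+-identityʳ q ⟨
      q ℚ.+ 0ℚᵘ      ≤⟨ ℚₚ.+-monoʳ-≤ q (0≤½^ k) ⟩
      q ℚ.+ ½^ k     ∎

  ≤-pointwise : ∀ {x y} → Eventually (λ n → seq x n ℚ.≤ seq y n) → x ≤ y
  ≤-pointwise {x} {y} e k = eventually-map (λ n l → begin
      seq x n              ≤⟨ l ⟩
      seq y n              ≃⟨ ℚₚ.+-identityʳ (seq y n) ⟨
      seq y n ℚ.+ 0ℚᵘ      ≤⟨ ℚₚ.+-monoʳ-≤ (seq y n) (0≤½^ k) ⟩
      seq y n ℚ.+ ½^ k     ∎) e

  ≤-trans : ∀ {x y z} → x ≤ y → y ≤ z → x ≤ z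
  ≤-trans {x} {y} {z} l l′ k = eventually-map (λ n (p , q) → begin
      seq x n                                ≤⟨ p ⟩
      seq y n ℚ.+ ½^ suc k                   ≤⟨ ℚₚ.+-monoˡ-≤ (½^ suc k) q ⟩
      seq z n ℚ.+ ½^ suc k ℚ.+ ½^ suc k      ≃⟨ ℚₚ.+-assoc (seq z n) (½^ suc k) (½^ suc k) ⟩
      seq z n ℚ.+ (½^ suc k ℚ.+ ½^ suc k)    ≃⟨ ℚₚ.+-congʳ (seq z n) (half+half (½^ k)) ⟩
      seq z n ℚ.+ ½^ k                       ∎) (l (suc k) and l′ (suc k))

  ≈-refl : ∀ {x} → x ≈ x
  ≈-refl {x} = ≃⇒≈ {x} {x} (λ n → ℚₚ.≃-refl)

  ≈-sym : ∀ {x y} → x ≈ y → y ≈ x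
  ≈-sym (l , l′) = l′ , l

  ≈-trans : ∀ {x y z} → x ≈ y → y ≈ z → x ≈ z
  ≈-trans {x} {y} {z} (l , l′) (m , m′) = ≤-trans {x} {y} {z} l m , ≤-trans {z} {y} {x} m′ l′

  ≤-resp : ∀ {x x′ y y′} → x ≈ x′ → y ≈ y′ → x ≤ y → x′ ≤ y′
  ≤-resp {x} {x′} {y} {y′} e e′ l = ≤-trans {x′} {x} {y′} (proj₂ e) (≤-trans {x} {y} {y′} l (proj₁ e′))

  <-resp : ∀ {x x′ y y′} → x ≈ x′ → y ≈ y′ → x < y → x′ < y′
  <-resp {x} {x′} {y} {y′} (_ , e) (e′ , _) (k , h) =
    -- Half of the old gap is kept; a quarter each pays for replacing x and y.
    suc k , eventually-map (λ n ((p , q) , r) → begin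
      seq x′ n ℚ.+ ½^ suc k                        ≃⟨ solve 2 (λ a b → a :+ b := a :+ b :+ b :- b) ℚₚ.≃-refl (seq x′ n) (½^ suc k) ⟩
      seq x′ n ℚ.+ ½^ suc k ℚ.+ ½^ suc k ℚ.- ½^ suc k  ≤⟨ ℚₚ.+-monoˡ-≤ (ℚ.- ½^ suc k) (step n p q r) ⟩
      seq y′ n ℚ.+ ½^ suc k ℚ.- ½^ suc k           ≃⟨ solve 2 (λ a b → a :+ b :- b := a) ℚₚ.≃-refl (seq y′ n) (½^ suc k) ⟩
      seq y′ n                                     ∎) ((e (suc (suc k)) and e′ (suc (suc k))) and h)
    where
    h2 = ½^ suc (suc k)
    step : ∀ n → seq x′ n ℚ.≤ seq x n ℚ.+ h2 → seq y n ℚ.≤ seq y′ n ℚ.+ h2 → seq x n ℚ.+ ½^ k ℚ.≤ seq y n →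
      seq x′ n ℚ.+ ½^ suc k ℚ.+ ½^ suc k ℚ.≤ seq y′ n ℚ.+ ½^ suc k
    step n p q r = begin
      seq x′ n ℚ.+ ½^ suc k ℚ.+ ½^ suc k         ≃⟨ ℚₚ.+-assoc (seq x′ n) (½^ suc k) (½^ suc k) ⟩
      seq x′ n ℚ.+ (½^ suc k ℚ.+ ½^ suc k)       ≃⟨ ℚₚ.+-congʳ (seq x′ n) (half+half (½^ k)) ⟩
      seq x′ n ℚ.+ ½^ k                          ≤⟨ ℚₚ.+-monoˡ-≤ (½^ k) p ⟩
      seq x n ℚ.+ h2 ℚ.+ ½^ k                    ≃⟨ solve 3 (λ a b c → a :+ b :+ c := a :+ c :+ b) ℚₚ.≃-refl (seq x n) h2 (½^ k) ⟩
      seq x n ℚ.+ ½^ k ℚ.+ h2                    ≤⟨ ℚₚ.+-monoˡ-≤ h2 r ⟩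
      seq y n ℚ.+ h2                             ≤⟨ ℚₚ.+-monoˡ-≤ h2 q ⟩
      seq y′ n ℚ.+ h2 ℚ.+ h2                     ≃⟨ ℚₚ.+-assoc (seq y′ n) h2 h2 ⟩
      seq y′ n ℚ.+ (h2 ℚ.+ h2)                   ≃⟨ ℚₚ.+-congʳ (seq y′ n) (half+half (½^ suc k)) ⟩
      seq y′ n ℚ.+ ½^ suc k                      ∎

  +-cong : ∀ {x x′ y y′} → x ≈ x′ → y ≈ y′ → x + y ≈ x′ + y′
  +-cong {x} {x′} {y} {y′} e e′ = close⇒≈ {x + y} {x′ + y′} λ k → eventually-map (λ n (p , q) → begin
      ℚ.∣ seq x n ℚ.+ seq y n ℚ.- (seq x′ n ℚ.+ seq y′ n) ∣
        ≃⟨ ℚₚ.∣-∣-cong (solve 4 (λ a b c d → a :+ b :- (c :+ d) := (a :- c) :+ (b :- d)) ℚₚ.≃-refl (seq x n) (seq y n) (seq x′ n) (seq y′ n)) ⟩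
      ℚ.∣ (seq x n ℚ.- seq x′ n) ℚ.+ (seq y n ℚ.- seq y′ n) ∣
        ≤⟨ ℚₚ.∣p+q∣≤∣p∣+∣q∣ (seq x n ℚ.- seq x′ n) (seq y n ℚ.- seq y′ n) ⟩
      ℚ.∣ seq x n ℚ.- seq x′ n ∣ ℚ.+ ℚ.∣ seq y n ℚ.- seq y′ n ∣
        ≤⟨ ℚₚ.+-mono-≤ p q ⟩
      ½^ suc k ℚ.+ ½^ suc k
        ≃⟨ half+half (½^ k) ⟩
      ½^ k ∎) (≈⇒close {x} {x′} e (suc k) and ≈⇒close {y} {y′} e′ (suc k))

  *-cong : ∀ {x x′ y y′} → x ≈ x′ → y ≈ y′ → x * y ≈ x′ * y′
  *-cong {x} {x′} {y} {y′} e e′ = close⇒≈ {x * y} {x′ * y′} go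
    where
    go : Close (x * y) (x′ * y′)
    go k with bounded (seq x) (cauchy x) | bounded (seq y′) (cauchy y′)
    ... | B , b | B′ , b′ with shrink B (suc k) | shrink B′ (suc k)
    ...   | j , s | j′ , s′ = eventually-map (λ n ((p , q) , (r , t)) → begin
      ℚ.∣ seq x n ℚ.* seq y n ℚ.- seq x′ n ℚ.* seq y′ n ∣
        ≃⟨ ℚₚ.∣-∣-cong (solve 4 (λ a b c d → a :* b :- c :* d := a :* (b :- d) :+ d :* (a :- c)) ℚₚ.≃-refl (seq x n) (seq y n) (seq x′ n) (seq y′ n)) ⟩
      ℚ.∣ seq x n ℚ.* (seq y n ℚ.- seq y′ n) ℚ.+ seq y′ n ℚ.* (seq x n ℚ.- seq x′ n) ∣
        ≤⟨ ℚₚ.∣p+q∣≤∣p∣+∣q∣ (seq x n ℚ.* (seq y n ℚ.- seq y′ n)) (seq y′ n ℚ.* (seq x n ℚ.- seq x′ n)) ⟩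
      ℚ.∣ seq x n ℚ.* (seq y n ℚ.- seq y′ n) ∣ ℚ.+ ℚ.∣ seq y′ n ℚ.* (seq x n ℚ.- seq x′ n) ∣
        ≤⟨ ℚₚ.+-mono-≤ (scaled {seq x n} r q) (scaled {seq y′ n} t p) ⟩
      B ℚ.* ½^ j ℚ.+ B′ ℚ.* ½^ j′
        ≤⟨ ℚₚ.+-mono-≤ s s′ ⟩
      ½^ suc k ℚ.+ ½^ suc k
        ≃⟨ half+half (½^ k) ⟩
      ½^ k ∎) ((≈⇒close {x} {x′} e j′ and ≈⇒close {y} {y′} e′ j) and (b and b′))

  fromℚ-≤ : ∀ {p q} → p ℚ.≤ q → fromℚ p ≤ fromℚ q
  fromℚ-≤ {p} {q} l = ≤-pointwise {fromℚ p} {fromℚ q} (0 , λ _ _ → l)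

  ½^-below : ∀ {p} → 0ℚᵘ ℚ.< p → ∃[ k ] ½^ k ℚ.< p
  ½^-below {p} 0<p with shrink (ℚ.1/_ p {{nz}}) 1
    where nz = ℚₚ.pos⇒nonZero p {{ℚ.positive 0<p}}
  ... | j , l = j , (begin-strict
      ½^ j                          ≃⟨ ℚₚ.*-identityˡ (½^ j) ⟨
      1ℚᵘ ℚ.* ½^ j                  ≃⟨ ℚₚ.*-congʳ {½^ j} (ℚₚ.*-inverseʳ p {{nz}}) ⟨
      p ℚ.* ℚ.1/_ p {{nz}} ℚ.* ½^ j ≃⟨ ℚₚ.*-assoc p (ℚ.1/_ p {{nz}}) (½^ j) ⟩
      p ℚ.* (ℚ.1/_ p {{nz}} ℚ.* ½^ j) ≤⟨ ℚₚ.*-monoʳ-≤-nonNeg p {{ℚ.nonNegative (ℚₚ.<⇒≤ 0<p)}} l ⟩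
      p ℚ.* ½^ 1                    <⟨ ℚₚ.*-monoʳ-<-pos p {{ℚ.positive 0<p}} (½^-suc< 0) ⟩
      p ℚ.* 1ℚᵘ                     ≃⟨ ℚₚ.*-identityʳ p ⟩
      p                             ∎)
    where nz = ℚₚ.pos⇒nonZero p {{ℚ.positive 0<p}}

  archimedean : ∀ {p q} → (∀ k → p ℚ.≤ q ℚ.+ ½^ k) → p ℚ.≤ q
  archimedean {p} {q} l = ℚₚ.≮⇒≥ λ q<p → absurd q<p (½^-below (positive q<p))
    where
    positive : q ℚ.< p → 0ℚᵘ ℚ.< p ℚ.- q
    positive q<p = begin-strict
      0ℚᵘ      ≃⟨ ℚₚ.+-inverseʳ q ⟨
      q ℚ.- q  <⟨ ℚₚ.+-monoˡ-< (ℚ.- q) q<p ⟩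
      p ℚ.- q  ∎
    absurd : q ℚ.< p → ¬ (∃[ k ] ½^ k ℚ.< p ℚ.- q)
    absurd q<p (k , s) = ℚₚ.<-irrefl (ℚₚ.≃-refl {½^ k}) (ℚₚ.<-≤-trans s (-≤ (l k)))

  fromℚ-≤⁻¹ : ∀ {p q} → fromℚ p ≤ fromℚ q → p ℚ.≤ q
  fromℚ-≤⁻¹ l = archimedean λ k → eventually-sure (l k)

  fromℚ-< : ∀ {p q} → p ℚ.< q → fromℚ p < fromℚ q
  fromℚ-< {p} {q} p<q with ½^-below {q ℚ.- p} (begin-strict
      0ℚᵘ      ≃⟨ ℚₚ.+-inverseʳ p ⟨
      p ℚ.- p  <⟨ ℚₚ.+-monoˡ-< (ℚ.- p) p<q ⟩
      q ℚ.- p  ∎)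
  ... | k , s = k , 0 , λ _ _ → begin
      p ℚ.+ ½^ k        ≤⟨ ℚₚ.+-monoʳ-≤ p (ℚₚ.<⇒≤ s) ⟩
      p ℚ.+ (q ℚ.- p)   ≃⟨ solve 2 (λ p q → p :+ (q :- p) := q) ℚₚ.≃-refl p q ⟩
      q                 ∎

  <-irrefl : ∀ {x} → ¬ (x < x)
  <-irrefl {x} (k , e) = ℚₚ.<-irrefl (ℚₚ.≃-refl {seq x n}) (begin-strict
      seq x n             ≃⟨ ℚₚ.+-identityʳ (seq x n) ⟨
      seq x n ℚ.+ 0ℚᵘ     <⟨ ℚₚ.+-monoʳ-< (seq x n) (0<½^ k) ⟩
      seq x n ℚ.+ ½^ k    ≤⟨ proj₂ e n ℕₚ.≤-refl ⟩
      seq x n             ∎)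
    where n = proj₁ e

  -- One decidable comparison of rationals at a late index N settles each precision: beyond N the
  -- sequence moves by at most ½^(k+2), so either it stays within ½^k of q, or it stays at least
  -- ½^(k+2) away, which the assumption forbids.
  apart : ∀ {x q} → ¬ (x ≈ fromℚ q) → ¬ ¬ (∃[ k ] Eventually (λ n → ½^ k ℚ.≤ ℚ.∣ seq x n ℚ.- q ∣))
  apart {x} {q} x≉q ¬apart = x≉q (close⇒≈ {x} {fromℚ q} go)
    where
    go : Close x (fromℚ q)
    go k with cauchy x (suc (suc k))
    ... | N , h with ℚ.∣ seq x N ℚ.- q ∣ ℚₚ.≤? ½^ suc k
    ...   | yes l = N , λ n N≤n → begin
      ℚ.∣ seq x n ℚ.- q ∣
        ≃⟨ ℚₚ.∣-∣-cong (solve 3 (λ a b c → a :- c := (a :- b) :+ (b :- c)) ℚₚ.≃-refl (seq x n) (seq x N) q) ⟩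
      ℚ.∣ (seq x n ℚ.- seq x N) ℚ.+ (seq x N ℚ.- q) ∣
        ≤⟨ ℚₚ.∣p+q∣≤∣p∣+∣q∣ (seq x n ℚ.- seq x N) (seq x N ℚ.- q) ⟩
      ℚ.∣ seq x n ℚ.- seq x N ∣ ℚ.+ ℚ.∣ seq x N ℚ.- q ∣
        ≤⟨ ℚₚ.+-mono-≤ (ℚₚ.≤-trans (h n N N≤n ℕₚ.≤-refl) (½^-suc≤ (suc k))) l ⟩
      ½^ suc k ℚ.+ ½^ suc k
        ≃⟨ half+half (½^ k) ⟩
      ½^ k ∎
    ...   | no ¬l = ¬ap (suc (suc k) , N , λ n N≤n → begin
      ½^ suc (suc k)
        ≃⟨ solve 1 (λ a → a := a :+ a :- a) ℚₚ.≃-refl (½^ suc (suc k)) ⟩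
      ½^ suc (suc k) ℚ.+ ½^ suc (suc k) ℚ.- ½^ suc (suc k)
        ≤⟨ -≤ (begin
             ½^ suc (suc k) ℚ.+ ½^ suc (suc k)
               ≃⟨ half+half (½^ suc k) ⟩
             ½^ suc k
               ≤⟨ ℚₚ.≰⇒≥ ¬l ⟩
             ℚ.∣ seq x N ℚ.- q ∣
               ≃⟨ ℚₚ.∣-∣-cong (solve 3 (λ a b c → b :- c := (b :- a) :+ (a :- c)) ℚₚ.≃-refl (seq x n) (seq x N) q) ⟩
             ℚ.∣ (seq x N ℚ.- seq x n) ℚ.+ (seq x n ℚ.- q) ∣
               ≤⟨ ℚₚ.∣p+q∣≤∣p∣+∣q∣ (seq x N ℚ.- seq x n) (seq x n ℚ.- q) ⟩
             ℚ.∣ seq x N ℚ.- seq x n ∣ ℚ.+ ℚ.∣ seq x n ℚ.- q ∣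
               ≤⟨ ℚₚ.+-monoˡ-≤ ℚ.∣ seq x n ℚ.- q ∣ (h N n ℕₚ.≤-refl N≤n) ⟩
             ½^ suc (suc k) ℚ.+ ℚ.∣ seq x n ℚ.- q ∣ ∎) ⟩
      ℚ.∣ seq x n ℚ.- q ∣ ∎)
      where
      ¬ap : ∃[ k ] Eventually (λ n → ½^ k ℚ.≤ ℚ.∣ seq x n ℚ.- q ∣) → Eventually (λ n → ℚ.∣ seq x n ℚ.- q ∣ ℚ.≤ ½^ k)
      ¬ap a with () ← ¬apart a

  -- unit K is the reciprocal of K + 1.
  unit : ℕ → ℚᵘ
  unit K = mkℚᵘ (ℤ.+ 1) K

  0<unit : ∀ K → 0ℚᵘ ℚ.< unit K
  0<unit K = ℚ.*<* (ℤ.+<+ (ℕ.s≤s ℕ.z≤n))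

  unit-mono : ∀ {K M} → K ℕ.≤ M → unit M ℚ.≤ unit K
  unit-mono K≤M = *≤* (ℤ.+≤+ (ℕ.s≤s (ℕₚ.+-monoˡ-≤ 0 K≤M)))

  unit≤1 : ∀ K → unit K ℚ.≤ 1ℚᵘ
  unit≤1 K = unit-mono {0} {K} ℕ.z≤n

  unit-small : ∀ k → ∃[ B ] ∀ K → B ℕ.≤ K → unit K ℚ.≤ ½^ k
  unit-small zero    = 0 , λ K _ → unit≤1 K
  unit-small (suc k) with unit-small k
  -- The index shift makes this a halving: the denominator is 2 B + 2, twice that of `unit B`.
  ... | B , small = suc (B ℕ.+ B) , λ K l → begin
      unit K             ≤⟨ unit-mono l ⟩
      unit (suc (B ℕ.+ B)) ≃⟨ *≡* (cong (λ n → ℤ.+ suc (n ℕ.+ 0)) (eq B)) ⟩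
      ½ ℚ.* unit B       ≤⟨ ℚₚ.*-monoʳ-≤-nonNeg ½ (small B ℕₚ.≤-refl) ⟩
      ½ ℚ.* ½^ k         ∎
      where
      eq : ∀ B → B ℕ.+ suc (B ℕ.+ 0) ≡ suc (B ℕ.+ B)
      eq B rewrite ℕₚ.+-identityʳ B = ℕₚ.+-suc B B

  *-monoʳ-≤ : ∀ {x y} c → 0ℚᵘ ℚ.≤ c → x ≤ y → x * fromℚ c ≤ y * fromℚ c
  *-monoʳ-≤ {x} {y} c 0≤c l k with shrink c k
  ... | j , s = eventually-map (λ n p → begin
      seq x n ℚ.* c                    ≤⟨ ℚₚ.*-monoˡ-≤-nonNeg c {{ℚ.nonNegative 0≤c}} p ⟩
      (seq y n ℚ.+ ½^ j) ℚ.* c         ≃⟨ solve 3 (λ a b c → (a :+ b) :* c := a :* c :+ c :* b) ℚₚ.≃-refl (seq y n) (½^ j) c ⟩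
      seq y n ℚ.* c ℚ.+ c ℚ.* ½^ j     ≤⟨ ℚₚ.+-monoʳ-≤ (seq y n ℚ.* c) s ⟩
      seq y n ℚ.* c ℚ.+ ½^ k           ∎) (l j)

-- Envelopes of tents under the parabola ½ y²

module Tent where

  open import Data.Integer.Base as ℤ using (ℤ)
  open import Data.Nat.Base as ℕ using (ℕ; zero; suc; _⊔_)
  import Data.Nat.Properties as ℕₚ
  open import Data.Product.Base using (∃-syntax; _×_; _,_)
  open import Data.Rational.Unnormalised.Base as ℚ using (ℚᵘ; 0ℚᵘ; 1ℚᵘ; ½; *≤*)
  import Data.Rational.Unnormalised.Properties as ℚₚ
  open import Data.Rational.Unnormalised.Solver using (module +-*-Solver)
  open import Data.Sum.Base using (inj₁; inj₂)
  open import Relation.Binary.PropositionalEquality using (_≢_; refl)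
  open import Relation.Nullary using (¬_; yes; no; contradiction)
  open import Defs using (ℝ; real; seq; cauchy; ½^_; _≤_; _<_; _≈_; _+_; _*_; fromℚ; codeℚ; graph; _[_]_⇓_; Machine; FunctionSymbol; module CauchyLemmas)
  open CauchyLemmas using (half+half; ½^-+; scaled)
  open Reals
  open +-*-Solver using (solve; _:+_; _:*_; _:-_; :-_; _:=_)
  open ℚₚ.≤-Reasoning

  tent : ℕ → ℚᵘ → ℚᵘ
  tent K q = ½ ℚ.* (unit K ℚ.* unit K) ℚ.- ℚ.∣ q ℚ.- unit K ∣

  tent-lipschitz : ∀ K p q → tent K p ℚ.≤ tent K q ℚ.+ ℚ.∣ p ℚ.- q ∣
  tent-lipschitz K p q = begin
    h ℚ.- ℚ.∣ p ℚ.- u ∣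
      ≃⟨ solve 3 (λ h a b → h :- a := h :- (a :+ b) :+ b) ℚₚ.≃-refl h ℚ.∣ p ℚ.- u ∣ ℚ.∣ p ℚ.- q ∣ ⟩
    h ℚ.- (ℚ.∣ p ℚ.- u ∣ ℚ.+ ℚ.∣ p ℚ.- q ∣) ℚ.+ ℚ.∣ p ℚ.- q ∣
      ≤⟨ ℚₚ.+-monoˡ-≤ ℚ.∣ p ℚ.- q ∣ (ℚₚ.+-monoʳ-≤ h (ℚₚ.neg-mono-≤ (begin
           ℚ.∣ q ℚ.- u ∣                          ≃⟨ ℚₚ.∣-∣-cong (solve 3 (λ p q u → q :- u := (p :- u) :+ (q :- p)) ℚₚ.≃-refl p q u) ⟩
           ℚ.∣ (p ℚ.- u) ℚ.+ (q ℚ.- p) ∣          ≤⟨ ℚₚ.∣p+q∣≤∣p∣+∣q∣ (p ℚ.- u) (q ℚ.- p) ⟩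
           ℚ.∣ p ℚ.- u ∣ ℚ.+ ℚ.∣ q ℚ.- p ∣        ≃⟨ ℚₚ.+-congʳ ℚ.∣ p ℚ.- u ∣ (swap-∣-∣ q p) ⟩
           ℚ.∣ p ℚ.- u ∣ ℚ.+ ℚ.∣ p ℚ.- q ∣        ∎))) ⟩
    h ℚ.- ℚ.∣ q ℚ.- u ∣ ℚ.+ ℚ.∣ p ℚ.- q ∣ ∎
    where
    u = unit K
    h = ½ ℚ.* (u ℚ.* u)

  tent-peak : ∀ K → tent K (unit K) ℚ.≃ ½ ℚ.* (unit K ℚ.* unit K)
  tent-peak K = begin-equality
    h ℚ.- ℚ.∣ unit K ℚ.- unit K ∣   ≃⟨ ℚₚ.+-congʳ h (ℚₚ.-‿cong (ℚₚ.∣-∣-cong (ℚₚ.+-inverseʳ (unit K)))) ⟩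
    h ℚ.- 0ℚᵘ                       ≃⟨ ℚₚ.+-identityʳ h ⟩
    h                               ∎
    where h = ½ ℚ.* (unit K ℚ.* unit K)

  -- The key estimate: ½u² - |q - u| ≤ ½q² - ½(q - u)² because u (u - q) ≤ |q - u|.
  tent-below : ∀ K q → tent K q ℚ.≤ ½ ℚ.* (q ℚ.* q) ℚ.- ½ ℚ.* ((q ℚ.- unit K) ℚ.* (q ℚ.- unit K))
  tent-below K q = begin
    ½ ℚ.* (u ℚ.* u) ℚ.- ℚ.∣ q ℚ.- u ∣
      ≤⟨ ℚₚ.+-monoʳ-≤ (½ ℚ.* (u ℚ.* u)) (ℚₚ.neg-mono-≤ (begin
           u ℚ.* (u ℚ.- q)               ≤⟨ p≤∣p∣ (u ℚ.* (u ℚ.- q)) ⟩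
           ℚ.∣ u ℚ.* (u ℚ.- q) ∣         ≤⟨ scaled {u} {1ℚᵘ} (ℚₚ.≤-trans (ℚₚ.≤-reflexive (ℚₚ.≃-reflexive (ℚₚ.0≤p⇒∣p∣≡p (ℚₚ.<⇒≤ (0<unit K))))) (unit≤1 K)) (ℚₚ.≤-reflexive (swap-∣-∣ u q)) ⟩
           1ℚᵘ ℚ.* ℚ.∣ q ℚ.- u ∣         ≃⟨ ℚₚ.*-identityˡ ℚ.∣ q ℚ.- u ∣ ⟩
           ℚ.∣ q ℚ.- u ∣                 ∎)) ⟩
    ½ ℚ.* (u ℚ.* u) ℚ.- u ℚ.* (u ℚ.- q)
      ≃⟨ ℚₚ.≃-trans (solve 3 (λ h u q → h :* (u :* u) :- u :* (u :- q) := h :* (u :* u) :- (u :* u) :+ u :* q) ℚₚ.≃-refl ½ u q)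
           (ℚₚ.≃-trans (ℚₚ.+-congˡ (u ℚ.* q) (ℚₚ.+-congʳ (½ ℚ.* (u ℚ.* u)) (ℚₚ.-‿cong (ℚₚ.≃-sym (half+half (u ℚ.* u))))))
             (ℚₚ.≃-trans (ℚₚ.+-congʳ (½ ℚ.* (u ℚ.* u) ℚ.- (½ ℚ.* (u ℚ.* u) ℚ.+ ½ ℚ.* (u ℚ.* u))) (ℚₚ.≃-sym (half+half (u ℚ.* q))))
               (solve 3 (λ h u q → h :* (u :* u) :- (h :* (u :* u) :+ h :* (u :* u)) :+ (h :* (u :* q) :+ h :* (u :* q))
                          := h :* (q :* q) :- h :* ((q :- u) :* (q :- u))) ℚₚ.≃-refl ½ u q))) ⟩
    ½ ℚ.* (q ℚ.* q) ℚ.- ½ ℚ.* ((q ℚ.- u) ℚ.* (q ℚ.- u)) ∎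
    where u = unit K

  -- To the left of 0 the distance from the apex u is at least u, and u ≥ ½ u². So the envelope
  -- vanishes there and the program may answer 0 for negative arguments.
  tent-nonpos : ∀ K q → q ℚ.≤ 0ℚᵘ → tent K q ℚ.≤ 0ℚᵘ
  tent-nonpos K q q≤0 = -≤ {½ ℚ.* (u ℚ.* u)} {ℚ.∣ q ℚ.- u ∣} (begin
    ½ ℚ.* (u ℚ.* u)          ≤⟨ ℚₚ.*-monoʳ-≤-nonNeg ½ (ℚₚ.*-monoʳ-≤-nonNeg u {u} {1ℚᵘ} (unit≤1 K)) ⟩
    ½ ℚ.* (u ℚ.* 1ℚᵘ)        ≃⟨ ℚₚ.*-congˡ {½} (ℚₚ.*-identityʳ u) ⟩
    ½ ℚ.* u                  ≤⟨ ℚₚ.*-monoˡ-≤-nonNeg u {½} {1ℚᵘ} (*≤* (ℤ.+≤+ (ℕ.s≤s ℕ.z≤n))) ⟩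
    1ℚᵘ ℚ.* u                ≃⟨ ℚₚ.*-identityˡ u ⟩
    u                        ≃⟨ ℚₚ.+-identityʳ u ⟨
    u ℚ.- 0ℚᵘ                ≤⟨ ℚₚ.+-monoʳ-≤ u (ℚₚ.neg-mono-≤ q≤0) ⟩
    u ℚ.- q                  ≤⟨ p≤∣p∣ (u ℚ.- q) ⟩
    ℚ.∣ u ℚ.- q ∣            ≃⟨ swap-∣-∣ u q ⟩
    ℚ.∣ q ℚ.- u ∣            ≃⟨ ℚₚ.+-identityʳ _ ⟨
    ℚ.∣ q ℚ.- u ∣ ℚ.+ 0ℚᵘ    ∎)
    where
    u = unit K

  -- F is the supremum of 0 and of the tents at the points 1 / K with r K ≢ 0.
  record IsEnvelope (r : ℕ → ℕ) (F : ℚᵘ → ℚᵘ) : Set where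
    field
      nonneg : ∀ q → 0ℚᵘ ℚ.≤ F q
      upper  : ∀ K q → r (suc K) ≢ 0 → tent K q ℚ.≤ F q
      least  : ∀ q {B} → 0ℚᵘ ℚ.≤ B → (∀ K → r (suc K) ≢ 0 → tent K q ℚ.≤ B) → F q ℚ.≤ B

  module Envelope {r : ℕ → ℕ} {F : ℚᵘ → ℚᵘ} (env : IsEnvelope r F) where
    open IsEnvelope env

    -- A supremum of 1-Lipschitz functions: the right-hand side bounds 0 and every tent at p, so
    -- `least` applies.
    lipschitz : ∀ p q → F p ℚ.≤ F q ℚ.+ ℚ.∣ p ℚ.- q ∣
    lipschitz p q = least p
      (ℚₚ.≤-trans (nonneg q) (ℚₚ.≤-trans (ℚₚ.≤-reflexive (ℚₚ.≃-sym (ℚₚ.+-identityʳ (F q)))) (ℚₚ.+-monoʳ-≤ (F q) (ℚₚ.0≤∣p∣ (p ℚ.- q)))))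
      λ K rK → ℚₚ.≤-trans (tent-lipschitz K p q) (ℚₚ.+-monoˡ-≤ ℚ.∣ p ℚ.- q ∣ (upper K q rK))

    lipschitz-∣-∣ : ∀ p q → ℚ.∣ F p ℚ.- F q ∣ ℚ.≤ ℚ.∣ p ℚ.- q ∣
    lipschitz-∣-∣ p q = ∣-∣≤ (lipschitz p q)
      (ℚₚ.≤-trans (lipschitz q p) (ℚₚ.+-monoʳ-≤ (F p) (ℚₚ.≤-reflexive (swap-∣-∣ q p))))

    envelope : ℝ → ℝ
    envelope x = real (λ n → F (seq x n)) λ k →
      let N , h = cauchy x k in N , λ m n N≤m N≤n → ℚₚ.≤-trans (lipschitz-∣-∣ (seq x m) (seq x n)) (h m n N≤m N≤n)

    envelope-cong : ∀ {x y} → x ≈ y → envelope x ≈ envelope y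
    envelope-cong {x} {y} e = close⇒≈ {envelope x} {envelope y} λ k →
      eventually-map (λ n → ℚₚ.≤-trans (lipschitz-∣-∣ (seq x n) (seq y n))) (≈⇒close {x} {y} e k)

    -- A 1-Lipschitz function turns the i-th entry of a name into the i-th entry of a name, even for
    -- the strict inequality, so no modulus of continuity enters the program.
    symbol : (M : Machine) → (∀ p i → M [ graph (λ n → codeℚ (p n)) ] i ⇓ codeℚ (F (p i))) → FunctionSymbol
    symbol M runs = record
      { program       = M
      ; function      = envelope
      ; function-cong = λ {x} {y} → envelope-cong {x} {y}
      ; computes      = λ x p name → (λ i → F (p i)) ,
          (λ i → let k , N , h = name i in k , N , λ n N≤n →
            ℚₚ.≤-trans (ℚₚ.+-monoˡ-≤ (½^ k) (lipschitz-∣-∣ (p i) (seq x n))) (h n N≤n)) ,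
          runs p
      }

    peaks : ∀ {y K} → r (suc K) ≢ 0 → y ≈ fromℚ (unit K) → fromℚ ½ * (y * y) ≤ envelope y
    peaks {y} {K} rK e = ≤-resp {fromℚ ½ * (fromℚ u * fromℚ u)} {fromℚ ½ * (y * y)} {envelope (fromℚ u)} {envelope y}
        (*-cong {fromℚ ½} {fromℚ ½} {fromℚ u * fromℚ u} {y * y} (≈-refl {fromℚ ½}) (*-cong {fromℚ u} {y} {fromℚ u} {y} e′ e′))
        (envelope-cong {fromℚ u} {y} e′)
        (≤-pointwise {fromℚ ½ * (fromℚ u * fromℚ u)} {envelope (fromℚ u)}
          (0 , λ _ _ → ℚₚ.≤-trans (ℚₚ.≤-reflexive (ℚₚ.≃-sym (tent-peak K))) (upper K u rK)))
      where
      u = unit K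
      e′ = ≈-sym {y} {fromℚ u} e

    module _ {y : ℝ} (0≤y : fromℚ 0ℚᵘ ≤ y) (y≉0 : ¬ (y ≈ fromℚ 0ℚᵘ))
             (no-peak : ∀ K → r (suc K) ≢ 0 → ¬ (y ≈ fromℚ (unit K))) where

      away-from-0 : ¬ ¬ (∃[ k ] Eventually (λ n → ½^ k ℚ.≤ seq y n))
      away-from-0 ¬away = apart {y} {0ℚᵘ} y≉0 λ (k , far) → ¬away (k , eventually-map (λ n (f , l) → go n k f l) (far and 0≤y (suc k)))
        where
        go : ∀ n k → ½^ k ℚ.≤ ℚ.∣ seq y n ℚ.- 0ℚᵘ ∣ → 0ℚᵘ ℚ.≤ seq y n ℚ.+ ½^ suc k → ½^ k ℚ.≤ seq y n
        go n k f l with ℚₚ.≤-total 0ℚᵘ (seq y n)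
        ... | inj₁ 0≤ = ℚₚ.≤-trans f (ℚₚ.≤-reflexive (ℚₚ.≃-trans (ℚₚ.∣-∣-cong (ℚₚ.+-identityʳ (seq y n)))
                          (ℚₚ.≃-reflexive (ℚₚ.0≤p⇒∣p∣≡p 0≤))))
        ... | inj₂ ≤0 = contradiction (ℚₚ.<-≤-trans (½^-suc< k) (begin
                ½^ k                      ≤⟨ f ⟩
                ℚ.∣ seq y n ℚ.- 0ℚᵘ ∣     ≤⟨ ∣-∣≤ {seq y n} {0ℚᵘ} (ℚₚ.≤-trans ≤0 (ℚₚ.≤-trans (0≤½^ (suc k)) (ℚₚ.≤-reflexive (ℚₚ.≃-sym (ℚₚ.+-identityˡ (½^ suc k)))))) l ⟩
                ½^ suc k                  ∎)) (ℚₚ.<-irrefl ℚₚ.≃-refl)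

      Apart : ℕ → ℕ → ℕ → Set
      Apart k K n = r (suc K) ≢ 0 → ½^ k ℚ.≤ ℚ.∣ seq y n ℚ.- unit K ∣

      -- Each single distance is positive only up to double negation, but finitely many can be
      -- combined into a common lower bound by induction on B.
      away-from-first : ∀ B → ¬ ¬ (∃[ k ] Eventually (λ n → ∀ K → K ℕ.< B → Apart k K n))
      away-from-first zero    ¬away = ¬away (0 , 0 , λ n _ K ())
      away-from-first (suc B) ¬away = away-from-first B λ (k , far) → away-from-one B λ (k′ , far′) →
          ¬away (k ⊔ k′ , eventually-map (λ n (f , f′) → both n k k′ f f′) (far and far′))
        where
        away-from-one : ∀ K → ¬ ¬ (∃[ k ] Eventually (Apart k K))
        away-from-one K ¬one with r (suc K) ℕₚ.≟ 0
        ... | yes r0 = ¬one (0 , 0 , λ n _ r≢0 → contradiction r0 r≢0)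
        ... | no r≢0 = apart {y} {unit K} (no-peak K r≢0) λ (k , far) → ¬one (k , eventually-map (λ n f _ → f) far)
        both : ∀ n k k′ → (∀ K → K ℕ.< B → Apart k K n) → Apart k′ B n → ∀ K → K ℕ.< suc B → Apart (k ⊔ k′) K n
        both n k k′ f f′ K K<B rK with ℕₚ.m≤n⇒m<n∨m≡n (ℕ.s≤s⁻¹ K<B)
        ... | inj₁ K<  = ℚₚ.≤-trans (½^-mono (ℕₚ.m≤m⊔n k k′)) (f K K< rK)
        ... | inj₂ refl = ℚₚ.≤-trans (½^-mono (ℕₚ.m≤n⊔m k k′)) (f′ rK)

      -- Uniformity over infinitely many peaks: once y ≥ ½^j, all peaks below ½^(j+1) are at least
      -- ½^(j+1) away, and only the finitely many others need separate bounds.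
      away : ¬ ¬ (∃[ k ] Eventually (λ n → ½^ k ℚ.≤ seq y n × ∀ K → Apart k K n))
      away ¬away = away-from-0 λ (j , pos) →
        let B , small = unit-small (suc j) in
        away-from-first B λ (k , far) →
        ¬away (suc j ⊔ k , eventually-map (λ n (p , f) →
          ℚₚ.≤-trans (½^-mono (ℕₚ.m≤m⊔n (suc j) k)) (ℚₚ.≤-trans (½^-suc≤ j) p) ,
          λ K rK → split j k B small n p f K rK) (pos and far))
        where
        split : ∀ j k B → (∀ K → B ℕ.≤ K → unit K ℚ.≤ ½^ suc j) → ∀ n → ½^ j ℚ.≤ seq y n →
          (∀ K → K ℕ.< B → Apart k K n) → ∀ K → Apart (suc j ⊔ k) K n
        split j k B small n p f K rK with K ℕₚ.<? B
        ... | yes K<B = ℚₚ.≤-trans (½^-mono (ℕₚ.m≤n⊔m (suc j) k)) (f K K<B rK)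
        ... | no K≮B  = ℚₚ.≤-trans (½^-mono (ℕₚ.m≤m⊔n (suc j) k)) (begin
                ½^ suc j
                  ≃⟨ solve 1 (λ a → a := a :+ a :- a) ℚₚ.≃-refl (½^ suc j) ⟩
                ½^ suc j ℚ.+ ½^ suc j ℚ.- ½^ suc j
                  ≤⟨ ℚₚ.+-mono-≤ (ℚₚ.≤-trans (ℚₚ.≤-reflexive (half+half (½^ j))) p) (ℚₚ.neg-mono-≤ (small K (ℕₚ.≮⇒≥ K≮B))) ⟩
                seq y n ℚ.- unit K
                  ≤⟨ p≤∣p∣ (seq y n ℚ.- unit K) ⟩
                ℚ.∣ seq y n ℚ.- unit K ∣ ∎)

      square-mono : ∀ {a b} → 0ℚᵘ ℚ.≤ a → a ℚ.≤ ℚ.∣ b ∣ → a ℚ.* a ℚ.≤ b ℚ.* b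
      square-mono {a} {b} 0≤a a≤b = begin
        a ℚ.* a               ≤⟨ ℚₚ.*-mono-≤-nonNeg {{ℚ.nonNegative 0≤a}} {{ℚ.nonNegative 0≤a}} a≤b a≤b ⟩
        ℚ.∣ b ∣ ℚ.* ℚ.∣ b ∣   ≃⟨ ℚₚ.∣p*q∣≃∣p∣*∣q∣ b b ⟨
        ℚ.∣ b ℚ.* b ∣         ≃⟨ ℚₚ.≃-reflexive (ℚₚ.0≤p⇒∣p∣≡p 0≤b²) ⟩
        b ℚ.* b               ∎
        where
        0≤b² : 0ℚᵘ ℚ.≤ b ℚ.* b
        0≤b² with ℚₚ.≤-total 0ℚᵘ b
        ... | inj₁ 0≤b = ℚₚ.nonNegative⁻¹ (b ℚ.* b) {{ℚₚ.nonNeg*nonNeg⇒nonNeg b {{ℚ.nonNegative 0≤b}} b {{ℚ.nonNegative 0≤b}}}}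
        ... | inj₂ b≤0 = ℚₚ.≤-trans
              (ℚₚ.nonNegative⁻¹ (ℚ.- b ℚ.* ℚ.- b) {{ℚₚ.nonNeg*nonNeg⇒nonNeg (ℚ.- b) {{0≤-b}} (ℚ.- b) {{0≤-b}}}})
              (ℚₚ.≤-reflexive (solve 1 (λ b → :- b :* :- b := b :* b) ℚₚ.≃-refl b))
          where 0≤-b = ℚ.nonNegative (ℚₚ.neg-mono-≤ b≤0)

      -- A distance ½^k from 0 and from all peaks, put into `tent-below`, keeps the envelope below
      -- the parabola by half the square of ½^k, that is ½^(2k+1). The assumed inequality, read at
      -- precision ½^(2k+2), leaves less room than that.
      envelope-misses : ¬ (fromℚ ½ * (y * y) ≤ envelope y)
      envelope-misses l = away λ (k , far) →
        let e = eventually-map (λ n ((p , f) , q) → clash n k p f q) (far and l (suc (suc (k ℕ.+ k))))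
        in eventually-sure e
        where
        clash : ∀ n k → ½^ k ℚ.≤ seq y n → (∀ K → Apart k K n) →
          ½ ℚ.* (seq y n ℚ.* seq y n) ℚ.≤ F (seq y n) ℚ.+ ½^ suc (suc (k ℕ.+ k)) → _
        clash n k p f q = ℚₚ.<-irrefl ℚₚ.≃-refl (ℚₚ.<-≤-trans (½^-suc< (suc (k ℕ.+ k))) (begin
            ½^ suc (k ℕ.+ k)
              ≃⟨ ℚₚ.*-congˡ {½} (½^-+ k k) ⟩
            g
              ≃⟨ solve 2 (λ h g → g := h :- (h :- g)) ℚₚ.≃-refl (½ ℚ.* (b ℚ.* b)) g ⟩
            ½ ℚ.* (b ℚ.* b) ℚ.- (½ ℚ.* (b ℚ.* b) ℚ.- g)
              ≤⟨ -≤ (begin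
                   ½ ℚ.* (b ℚ.* b)                                              ≤⟨ q ⟩
                   F b ℚ.+ ½^ suc (suc (k ℕ.+ k))                                ≤⟨ ℚₚ.+-monoˡ-≤ (½^ suc (suc (k ℕ.+ k))) low ⟩
                   ½ ℚ.* (b ℚ.* b) ℚ.- g ℚ.+ ½^ suc (suc (k ℕ.+ k))              ∎) ⟩
            ½^ suc (suc (k ℕ.+ k)) ∎))
          where
          b = seq y n
          g = ½ ℚ.* (½^ k ℚ.* ½^ k)
          below : ∀ {c} → ½^ k ℚ.≤ ℚ.∣ c ∣ → ½ ℚ.* (b ℚ.* b) ℚ.- ½ ℚ.* (c ℚ.* c) ℚ.≤ ½ ℚ.* (b ℚ.* b) ℚ.- g
          below {c} l = ℚₚ.+-monoʳ-≤ (½ ℚ.* (b ℚ.* b)) (ℚₚ.neg-mono-≤ (ℚₚ.*-monoʳ-≤-nonNeg ½ (square-mono {b = c} (0≤½^ k) l)))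
          low : F b ℚ.≤ ½ ℚ.* (b ℚ.* b) ℚ.- g
          low = least b
            -- The constant 0 in the supremum is treated like a tent at 0: here b itself plays the
            -- part of the distance from the apex.
            (ℚₚ.≤-trans (ℚₚ.≤-reflexive (ℚₚ.≃-sym (ℚₚ.+-inverseʳ (½ ℚ.* (b ℚ.* b))))) (below {b} (ℚₚ.≤-trans p (p≤∣p∣ b))))
            λ K rK → ℚₚ.≤-trans (tent-below K b) (below {b ℚ.- unit K} (f K rK))

-- A program for the envelope

module TentProgram where

  open import Data.Integer.Base as ℤ using (ℤ)
  import Data.Integer.Properties as ℤₚ
  open import Data.Nat.Base hiding (parity)
  open import Data.Nat.Properties
  open import Data.Nat.Tactic.RingSolver using (solve-∀)
  open import Data.Product.Base using (_,_)
  open import Data.Rational.Unnormalised.Base as ℚ using (ℚᵘ; mkℚᵘ; 0ℚᵘ; ½; *≤*; *≡*)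
  import Data.Rational.Unnormalised.Properties as ℚₚ
  open import Data.Sum.Base using (inj₁; inj₂)
  open import Relation.Binary.PropositionalEquality
  open import Relation.Nullary using (yes; no; contradiction)
  import Defs
  open import Defs using (codeℚ; FunctionSymbol)
  open Pairing
  open Program
  open Machines
  open Functions
  open Simulation using (pair-zero)
  open Reals using (unit; -≤)
  open Tent

  -- Reads the sign of an integer off its code, which is even exactly for the nonnegative ones.
  parity : ℕ → ℕ
  parity n = loop n 0 (λ _ b → 1 ∸ b)

  parityF : Fun₁ parity
  parityF = fun₁ (iter v0 (lit 0) (monusF $₂ (lit 1 , v0))) (λ _ → refl)

  parity-even : ∀ n → parity (2 * n) ≡ 0
  parity-odd  : ∀ n → parity (suc (2 * n)) ≡ 1
  parity-even zero    = refl
  parity-even (suc n) rewrite +-suc n (n + 0) = parity-even n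
  parity-odd zero    = refl
  parity-odd (suc n) rewrite +-suc n (n + 0) = parity-odd n

  -- ⟨ n , d ⟩ stands for the fraction n / (d + 1).
  frac : ℕ → ℕ → ℚᵘ
  frac n d = mkℚᵘ (ℤ.+ n) d

  fracC : ℕ → ℚᵘ
  fracC p = frac (first p) (second p)

  opaque
    maxC : ℕ → ℕ → ℕ
    maxC p p′ = ifz (first p * suc (second p′) ∸ first p′ * suc (second p)) p′ p

    maxF : Fun₂ maxC
    maxF = fun₂ (ifzF $₃ (monusF $₂ (mulF $₂ (firstF $₁ v0 , succ (secondF $₁ v1)) , mulF $₂ (firstF $₁ v1 , succ (secondF $₁ v0))) ,
      v1 , v0)) (λ _ _ → refl)

  frac-≤ : ∀ {n d n′ d′} → n * suc d′ ≤ n′ * suc d → frac n d ℚ.≤ frac n′ d′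
  frac-≤ {n} {d} {n′} {d′} l = *≤* (subst₂ ℤ._≤_ (ℤₚ.pos-* n (suc d′)) (ℤₚ.pos-* n′ (suc d)) (ℤ.+≤+ l))

  opaque
    unfolding maxC

    maxC-left : ∀ p p′ → fracC p ℚ.≤ fracC (maxC p p′)
    maxC-left p p′ with first p * suc (second p′) ∸ first p′ * suc (second p) in eq
    ... | zero  = frac-≤ (m∸n≡0⇒m≤n eq)
    ... | suc _ = ℚₚ.≤-refl

    maxC-right : ∀ p p′ → fracC p′ ℚ.≤ fracC (maxC p p′)
    maxC-right p p′ with first p * suc (second p′) ∸ first p′ * suc (second p) in eq
    ... | zero  = ℚₚ.≤-refl
    ... | suc _ = frac-≤ (<⇒≤ (suc⇒< eq))
      where
      suc⇒< : ∀ {m n o} → m ∸ n ≡ suc o → n < m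
      suc⇒< {m} {n} e = m∸n≢0⇒n<m (λ z → contradiction (trans (sym e) z) λ ())

    maxC-least : ∀ {B} p p′ → fracC p ℚ.≤ B → fracC p′ ℚ.≤ B → fracC (maxC p p′) ℚ.≤ B
    maxC-least p p′ l l′ with first p * suc (second p′) ∸ first p′ * suc (second p)
    ... | zero  = l′
    ... | suc _ = l

  -- The positive part of tent c (z / 2b).
  tentC : ℕ → ℕ → ℕ → ℕ
  tentC z b c = pair (b ∸ suc c * differ (z * suc c) (2 * b)) (pred (2 * (b * (suc c * suc c))))

  tentF : Fun₃ tentC
  tentF = fun₃ (pairF $₂ (monusF $₂ (v1 , mulF $₂ (succ v2 , differF $₂ (mulF $₂ (v0 , succ v2) , mulF $₂ (lit 2 , v1)))) ,
    predF $₁ (mulF $₂ (lit 2 , mulF $₂ (v1 , mulF $₂ (succ v2 , succ v2)))))) (λ _ _ _ → refl)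

  module _ {r : ℕ → ℕ} (rF : Fun₁ r) where

    envelopeStep : ℕ → ℕ → ℕ → ℕ → ℕ
    envelopeStep z b c acc = ifz (r (suc c)) acc (maxC acc (tentC z b c))

    -- The tents at 1 / K with K > 2b vanish at z / 2b.
    envelopeC : ℕ → ℕ → ℕ
    envelopeC z b = loop (2 * b) 0 (envelopeStep z b)

    envelopeF : Fun₂ envelopeC
    envelopeF = fun₂ (iter (mulF $₂ (lit 2 , v1)) (lit 0)
      (ifzF $₃ (rF $₁ succ v1 , v0 , maxF $₂ (v0 , tentF $₃ (v2 , v3 , v1))))) (λ _ _ → refl)

    step-above : ∀ z b c acc → fracC acc ℚ.≤ fracC (envelopeStep z b c acc)
    step-above z b c acc with r (suc c)
    ... | zero  = ℚₚ.≤-refl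
    ... | suc _ = maxC-left acc _

    step-tent : ∀ z b c acc → r (suc c) ≢ 0 → fracC (tentC z b c) ℚ.≤ fracC (envelopeStep z b c acc)
    step-tent z b c acc rc with r (suc c)
    ... | zero  = contradiction refl rc
    ... | suc _ = maxC-right acc _

    loop-above : ∀ z b n acc → fracC acc ℚ.≤ fracC (loop n acc (envelopeStep z b))
    loop-above z b zero    acc = ℚₚ.≤-refl
    loop-above z b (suc n) acc = ℚₚ.≤-trans (step-above z b n acc) (loop-above z b n _)

    loop-tent : ∀ z b n acc c → c < n → r (suc c) ≢ 0 → fracC (tentC z b c) ℚ.≤ fracC (loop n acc (envelopeStep z b))
    loop-tent z b (suc n) acc c c<n rc with m≤n⇒m<n∨m≡n (s≤s⁻¹ c<n)
    ... | inj₁ c<n′ = loop-tent z b n _ c c<n′ rc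
    ... | inj₂ refl = ℚₚ.≤-trans (step-tent z b c acc rc) (loop-above z b n _)

    loop-least : ∀ z b {B} n acc → fracC acc ℚ.≤ B → (∀ c → r (suc c) ≢ 0 → fracC (tentC z b c) ℚ.≤ B) →
      fracC (loop n acc (envelopeStep z b)) ℚ.≤ B
    loop-least z b     zero    acc l tents = l
    loop-least z b {B} (suc n) acc l tents = loop-least z b n _ next tents
      where
      next : fracC (envelopeStep z b n acc) ℚ.≤ B
      next with r (suc n) | tents n
      ... | zero  | _ = l
      ... | suc _ | t = maxC-least acc _ l (t λ ())

    envelopeℚ : ℚᵘ → ℚᵘ
    envelopeℚ (mkℚᵘ (ℤ.+ a) d)      = fracC (envelopeC (2 * a) (suc d))
    envelopeℚ (mkℚᵘ (ℤ.-[1+ n ]) d) = 0ℚᵘ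

    -- For a numerator a ≥ 0 the first component of q is its code 2 a, and it is passed on without
    -- halving; this is where the z / 2b in the tents comes from. In the negative case the result 0
    -- is the code of the fraction 0 / 1.
    codeEnvelope : ℕ → ℕ
    codeEnvelope q =
      let s = envelopeC (first q) (suc (second q))
      in ifz (parity (first q)) (pair (2 * first s) (second s)) 0

    codeEnvelopeF : Fun₁ codeEnvelope
    codeEnvelopeF =
      let s = envelopeF $₂ (firstF $₁ v0 , succ (secondF $₁ v0))
      in fun₁ (ifzF $₃ (parityF $₁ (firstF $₁ v0) , pairF $₂ (mulF $₂ (lit 2 , firstF $₁ s) , secondF $₁ s) , lit 0)) (λ _ → refl)

    codeEnvelope-correct : ∀ q → codeEnvelope (codeℚ q) ≡ codeℚ (envelopeℚ q)
    codeEnvelope-correct (mkℚᵘ (ℤ.+ a) d) rewrite sym (pair-def (2 * a) d) | first-pair (2 * a) d | second-pair (2 * a) d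
      | parity-even a = pair-def _ _
    codeEnvelope-correct (mkℚᵘ (ℤ.-[1+ n ]) d) rewrite sym (pair-def (suc (2 * n)) d) | first-pair (suc (2 * n)) d
      | parity-odd n = refl

  same-denominator-+ : ∀ m n d → frac m d ℚ.+ frac n d ℚ.≃ frac (m + n) d
  same-denominator-+ m n d = *≡* (trans (cong (ℤ._* (ℤ.+ suc d)) (sym (ℤₚ.*-distribʳ-+ (ℤ.+ suc d) (ℤ.+ m) (ℤ.+ n))))
    (trans (ℤₚ.*-assoc (ℤ.+ (m + n)) (ℤ.+ suc d) (ℤ.+ suc d)) (cong ((ℤ.+ (m + n)) ℤ.*_) (sym (ℤₚ.pos-* (suc d) (suc d))))))

  same-denominator-≤ : ∀ {m n} d → m ≤ n → frac m d ℚ.≤ frac n d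
  same-denominator-≤ d l = frac-≤ (*-monoˡ-≤ (suc d) l)

  frac-≃ : ∀ {n d n′ d′} → n * suc d′ ≡ n′ * suc d → frac n d ℚ.≃ frac n′ d′
  frac-≃ {n} {d} {n′} {d′} eq = *≡* (trans (sym (ℤₚ.pos-* n (suc d′))) (trans (cong ℤ.+_ eq) (ℤₚ.pos-* n′ (suc d))))

  frac-zero : ∀ d → frac 0 d ℚ.≃ 0ℚᵘ
  frac-zero d = *≡* refl

  opaque
    unfolding differ

    differ-⊖ : ∀ m n → ℤ.∣ m ℤ.⊖ n ∣ ≡ differ m n
    differ-⊖ m n with ≤-total m n
    ... | inj₁ m≤n rewrite m≤n⇒m∸n≡0 m≤n = ℤₚ.∣⊖∣-≤ m≤n
    ... | inj₂ n≤m rewrite m≤n⇒m∸n≡0 n≤m | ℤₚ.⊖-≥ n≤m = sym (+-identityʳ (m ∸ n))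

    differ-double : ∀ m n → differ (2 * m) (2 * n) ≡ 2 * differ m n
    differ-double m n = trans (cong₂ _+_ (sym (*-distribˡ-∸ 2 m n)) (sym (*-distribˡ-∸ 2 n m))) (sym (*-distribˡ-+ 2 (m ∸ n) (n ∸ m)))

    ∸≤differ : ∀ m n → m ∸ n ≤ differ m n
    ∸≤differ m n = m≤m+n (m ∸ n) (n ∸ m)

    ∸≤differ′ : ∀ m n → n ∸ m ≤ differ m n
    ∸≤differ′ m n = m≤n+m (n ∸ m) (m ∸ n)

  module _ (a d c : ℕ) where

    private
      b = suc d
      K = suc c
      q = mkℚᵘ (ℤ.+ a) d
      -- With common denominator 2 b K², X is the numerator of the height ½ / K² and Y that of the
      -- distance between a / b and 1 / K.
      X = b
      Y = K * differ (2 * a * K) (2 * b)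
      D = pred (2 * (b * (K * K)))

    height : frac X D ℚ.≃ ½ ℚ.* (unit c ℚ.* unit c)
    height = frac-≃ {d = D} {1} {pred (2 * (K * K))} (lemma b (K * K))
      where
      lemma : ∀ b k → b * (2 * k) ≡ 1 * (2 * (b * k))
      lemma = solve-∀

    distance : frac Y D ℚ.≃ ℚ.∣ q ℚ.- unit c ∣
    distance = ℚₚ.≃-trans (frac-≃ {d = D} {differ (a * K) b} {pred (b * K)} eq)
        (ℚₚ.≃-reflexive (cong (λ n → frac n (pred (b * K))) (sym abs)))
      where
      eq : Y * (b * K) ≡ differ (a * K) b * (2 * (b * (K * K)))
      eq = trans (cong (λ m → K * m * (b * K)) (trans (cong (λ m → differ m (2 * b)) (*-assoc 2 a K)) (differ-double (a * K) b)))
             (lemma K (differ (a * K) b) b)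
        where
        lemma : ∀ K x b → K * (2 * x) * (b * K) ≡ x * (2 * (b * (K * K)))
        lemma = solve-∀
      abs : ℤ.∣ ℤ.+ a ℤ.* ℤ.+ K ℤ.+ ℤ.-[1+ 0 ] ℤ.* ℤ.+ b ∣ ≡ differ (a * K) b
      abs = trans (cong ℤ.∣_∣ (trans (cong₂ ℤ._+_ (sym (ℤₚ.pos-* a K)) (ℤₚ.-1*i≡-i (ℤ.+ b))) (ℤₚ.m-n≡m⊖n (a * K) b))) (differ-⊖ (a * K) b)

    tent-frac : tent c q ℚ.≃ frac X D ℚ.- frac Y D
    tent-frac = ℚₚ.≃-sym (ℚₚ.+-cong height (ℚₚ.-‿cong distance))

    fracC-tent : fracC (tentC (2 * a) b c) ≡ frac (X ∸ Y) D
    fracC-tent = cong₂ frac (first-pair (X ∸ Y) D) (second-pair (X ∸ Y) D)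

    tent≤tentC : tent c q ℚ.≤ fracC (tentC (2 * a) b c)
    tent≤tentC = begin
      tent c q                  ≃⟨ tent-frac ⟩
      frac X D ℚ.- frac Y D     ≤⟨ -≤ {frac X D} {frac Y D} (ℚₚ.≤-trans (same-denominator-≤ D (m≤n+m∸n X Y))
                                        (ℚₚ.≤-reflexive (ℚₚ.≃-sym (same-denominator-+ Y (X ∸ Y) D)))) ⟩
      frac (X ∸ Y) D            ≡⟨ fracC-tent ⟨
      fracC (tentC (2 * a) b c) ∎
      where open ℚₚ.≤-Reasoning

    tentC-least : ∀ {B} → 0ℚᵘ ℚ.≤ B → tent c q ℚ.≤ B → fracC (tentC (2 * a) b c) ℚ.≤ B
    tentC-least {B} 0≤B t≤B with ≤-total Y X
    ... | inj₂ X≤Y = begin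
      fracC (tentC (2 * a) b c) ≡⟨ fracC-tent ⟩
      frac (X ∸ Y) D            ≡⟨ cong (λ n → frac n D) (m≤n⇒m∸n≡0 X≤Y) ⟩
      frac 0 D                  ≃⟨ frac-zero D ⟩
      0ℚᵘ                       ≤⟨ 0≤B ⟩
      B                         ∎
      where open ℚₚ.≤-Reasoning
    ... | inj₁ Y≤X = begin
      fracC (tentC (2 * a) b c)                     ≡⟨ fracC-tent ⟩
      frac (X ∸ Y) D                                ≃⟨ cancel (frac (X ∸ Y) D) (frac Y D) ⟩
      frac Y D ℚ.+ frac (X ∸ Y) D ℚ.- frac Y D      ≃⟨ ℚₚ.+-congˡ (ℚ.- frac Y D) (same-denominator-+ Y (X ∸ Y) D) ⟩
      frac (Y + (X ∸ Y)) D ℚ.- frac Y D             ≡⟨ cong (λ n → frac n D ℚ.- frac Y D) (m+[n∸m]≡n Y≤X) ⟩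
      frac X D ℚ.- frac Y D                         ≃⟨ tent-frac ⟨
      tent c q                                      ≤⟨ t≤B ⟩
      B                                             ∎
      where
      open ℚₚ.≤-Reasoning
      cancel : ∀ p q → p ℚ.≃ q ℚ.+ p ℚ.- q
      cancel p q = ℚₚ.≃-trans (ℚₚ.≃-sym (ℚₚ.+-identityˡ p)) (ℚₚ.≃-trans (ℚₚ.+-congˡ p (ℚₚ.≃-sym (ℚₚ.+-inverseʳ q)))
        (ℚₚ.≃-trans (ℚₚ.+-assoc q (ℚ.- q) p) (ℚₚ.≃-trans (ℚₚ.+-congʳ q (ℚₚ.+-comm (ℚ.- q) p)) (ℚₚ.≃-sym (ℚₚ.+-assoc q p (ℚ.- q))))))

    -- For K > 2b no fraction with denominator b equals 1 / K, so the integer numerator of the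
    -- difference is at least 1. Then Y ≥ K ≥ b, and the distance is at least the height.
    tentC-far : 2 * b ≤ c → fracC (tentC (2 * a) b c) ℚ.≤ 0ℚᵘ
    tentC-far 2b≤c = ℚₚ.≤-reflexive (ℚₚ.≃-trans (ℚₚ.≃-reflexive (trans fracC-tent (cong (λ n → frac n D) (m≤n⇒m∸n≡0 X≤Y)))) (frac-zero D))
      where
      gap : ∀ a → 1 ≤ differ (2 * a * K) (2 * b)
      gap zero    = ≤-trans (s≤s z≤n) (∸≤differ′ 0 (2 * b))
      gap (suc a) = ≤-trans (m<n⇒0<n∸m (≤-trans (s≤s 2b≤c) (≤-trans (m≤n*m K (2 * suc a)) ≤-refl))) (∸≤differ (2 * suc a * K) (2 * b))
      X≤Y : X ≤ Y
      X≤Y = ≤-trans (≤-trans (m≤n*m b 2) (≤-trans 2b≤c (n≤1+n c))) (≤-trans (≤-reflexive (sym (*-identityʳ K))) (*-monoʳ-≤ K (gap a)))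

  module _ {r : ℕ → ℕ} (rF : Fun₁ r) where

    fracC-zero : fracC 0 ℚ.≃ 0ℚᵘ
    fracC-zero = ℚₚ.≃-trans (ℚₚ.≃-reflexive (cong (λ n → frac n (second 0)) (trans (cong first (sym pair-zero)) (first-pair 0 0)))) (frac-zero (second 0))

    isEnvelope : IsEnvelope r (envelopeℚ rF)
    isEnvelope = record
      { nonneg = λ { (mkℚᵘ (ℤ.+ a) d)      → nonneg a d
                   ; (mkℚᵘ (ℤ.-[1+ n ]) d) → ℚₚ.≤-refl }
      ; upper  = λ { K (mkℚᵘ (ℤ.+ a) d) rK      → upper K a d rK
                   ; K (mkℚᵘ (ℤ.-[1+ n ]) d) rK → tent-nonpos K (mkℚᵘ (ℤ.-[1+ n ]) d) (*≤* ℤ.-≤+) }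
      ; least  = λ { (mkℚᵘ (ℤ.+ a) d) 0≤B tents →
                       loop-least rF (2 * a) (suc d) (2 * suc d) 0 (ℚₚ.≤-trans (ℚₚ.≤-reflexive fracC-zero) 0≤B)
                         (λ c rc → tentC-least a d c 0≤B (tents c rc))
                   ; (mkℚᵘ (ℤ.-[1+ n ]) d) 0≤B tents → 0≤B }
      }
      where
      nonneg : ∀ a d → 0ℚᵘ ℚ.≤ fracC (envelopeC rF (2 * a) (suc d))
      nonneg a d = ℚₚ.≤-trans (ℚₚ.≤-reflexive (ℚₚ.≃-sym fracC-zero)) (loop-above rF (2 * a) (suc d) (2 * suc d) 0)
      upper : ∀ K a d → r (suc K) ≢ 0 → tent K (mkℚᵘ (ℤ.+ a) d) ℚ.≤ fracC (envelopeC rF (2 * a) (suc d))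
      upper K a d rK with K <? 2 * suc d
      ... | yes K< = ℚₚ.≤-trans (tent≤tentC a d K) (loop-tent rF (2 * a) (suc d) (2 * suc d) 0 K K< rK)
      ... | no K≮  = ℚₚ.≤-trans (tent≤tentC a d K) (ℚₚ.≤-trans (tentC-far a d K (≮⇒≥ K≮)) (nonneg a d))

    envelopeSymbol : FunctionSymbol
    envelopeSymbol = Envelope.symbol isEnvelope (machineOf (queryCmd (codeEnvelopeF rF))) λ p i →
      subst (Defs._[_]_⇓_ _ _ i) (codeEnvelope-correct rF (p i)) (queries (codeEnvelopeF rF) (λ n → codeℚ (p n)) i)

-- Moves as bounded quantifiers, and pairing of reciprocals

module Formula where

  open import Data.Fin.Base using (zero; suc)
  open import Data.Integer.Base as ℤ using (ℤ)
  import Data.Integer.Properties as ℤₚ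
  open import Data.List.Base using ([]; _∷_)
  open import Data.Nat.Base as ℕ using (ℕ; zero; suc; pred)
  open import Data.Nat.Tactic.RingSolver using (solve-∀)
  open import Data.Rational.Unnormalised.Base as ℚ using (ℚᵘ; mkℚᵘ; 0ℚᵘ; 1ℚᵘ; ½; *≤*; *≡*)
  import Data.Rational.Unnormalised.Properties as ℚₚ
  open import Data.Rational.Unnormalised.Solver using (module +-*-Solver)
  open import Relation.Binary.PropositionalEquality using (_≡_; refl; sym; trans; cong)
  open import Defs
  open Reals
  open TentProgram using (frac; same-denominator-+)

  open +-*-Solver using (solve; _:+_; _:*_; _:=_; con)

  -- From ⟨ K , b ⟩ = (K + b) (K + b + 1) / 2 + b: for s = 1 / K and y = 1 / b,
  -- the solution of r α = β is r = 1 / ⟨ K , b ⟩.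
  opaque
    α β : ∀ {n} → Term n → Term n → Term n
    α s y = ((s ⊕ y) ⊗ ((s ⊕ y) ⊕ (s ⊗ y))) ⊕ (const (mkℚᵘ (ℤ.+ 2) 0) ⊗ ((s ⊗ s) ⊗ y))
    β s y = const (mkℚᵘ (ℤ.+ 2) 0) ⊗ ((s ⊗ s) ⊗ (y ⊗ y))

    halfSquare : ∀ {n} → Term n → Term n
    halfSquare y = const ½ ⊗ (y ⊗ y)

  opaque
    αℚ βℚ : ℚᵘ → ℚᵘ → ℚᵘ
    αℚ s y = (s ℚ.+ y) ℚ.* ((s ℚ.+ y) ℚ.+ (s ℚ.* y)) ℚ.+ mkℚᵘ (ℤ.+ 2) 0 ℚ.* ((s ℚ.* s) ℚ.* y)
    βℚ s y = mkℚᵘ (ℤ.+ 2) 0 ℚ.* ((s ℚ.* s) ℚ.* (y ℚ.* y))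

    αℚ-def : ∀ s y → αℚ s y ≡ (s ℚ.+ y) ℚ.* ((s ℚ.+ y) ℚ.+ (s ℚ.* y)) ℚ.+ mkℚᵘ (ℤ.+ 2) 0 ℚ.* ((s ℚ.* s) ℚ.* y)
    αℚ-def s y = refl

    βℚ-def : ∀ s y → βℚ s y ≡ mkℚᵘ (ℤ.+ 2) 0 ℚ.* ((s ℚ.* s) ℚ.* (y ℚ.* y))
    βℚ-def s y = refl

  pattern x₀ = var zero
  pattern x₁ = var (suc zero)
  pattern x₂ = var (suc (suc zero))
  pattern x₃ = var (suc (suc (suc zero)))
  pattern x₄ = var (suc (suc (suc (suc zero))))
  pattern x₅ = var (suc (suc (suc (suc (suc zero)))))
  pattern x₆ = var (suc (suc (suc (suc (suc (suc zero))))))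

  -- An interval quantifier over a variable that is not used says that the
  -- interval is nonempty.  In a context with variable 2 equal to 1 / K, a move
  -- quantifies a real y, restricts it to 0 and the reciprocals 1 / b, and
  -- quantifies the solution r of r α = β, to become the new variable 2.  A
  -- factor y lets the existential player choose any r against the universal move 0.
  exMove allMove : ∀ {n} → FunctionSymbol → BoundedFormula (8 ℕ.+ n) → BoundedFormula (3 ℕ.+ n)
  exMove V φ =
    ∃[ const 0ℚᵘ , const 1ℚᵘ ] ∃[ halfSquare x₀ , app V x₀ ]
    ∃[ const 0ℚᵘ , x₄ ] ∃[ x₀ ⊗ α x₅ x₂ , β x₅ x₂ ] ∃[ β x₆ x₃ , x₁ ⊗ α x₆ x₃ ] φ
  allMove V φ =
    ∀[ const 0ℚᵘ , const 1ℚᵘ ] ∀[ halfSquare x₀ , app V x₀ ]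
    ∃[ const 0ℚᵘ , const 1ℚᵘ ] ∃[ x₂ ⊗ (x₀ ⊗ α x₅ x₂) , x₂ ⊗ β x₅ x₂ ] ∃[ x₃ ⊗ β x₆ x₃ , x₃ ⊗ (x₁ ⊗ α x₆ x₃) ] φ

  opaque
    positive : ∀ {n} → Term n → Clause n
    positive s = pos (s >′ const 0ℚᵘ) ∷ []

    detected : ∀ {n} → FunctionSymbol → Term n → Clause n
    detected G s = pos (app G s ≥′ halfSquare s) ∷ []

  final : ∀ {n} → FunctionSymbol → BoundedFormula (3 ℕ.+ n)
  final G = matrix (positive x₂ ∷ detected G x₂ ∷ [])

  double-triangle : ∀ n → triangle n ℕ.+ triangle n ≡ n ℕ.* suc n
  double-triangle zero    = refl
  double-triangle (suc n) = trans (lemma n (triangle n)) (trans (cong (λ t → 2 ℕ.* suc n ℕ.+ t) (double-triangle n)) (lemma′ n))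
    where
    lemma : ∀ n t → suc n ℕ.+ t ℕ.+ (suc n ℕ.+ t) ≡ 2 ℕ.* suc n ℕ.+ (t ℕ.+ t)
    lemma = solve-∀
    lemma′ : ∀ n → 2 ℕ.* suc n ℕ.+ n ℕ.* suc n ≡ suc n ℕ.* suc (suc n)
    lemma′ = solve-∀

  double-pair : ∀ a b → (b ℕ.+ a) ℕ.* (b ℕ.+ a ℕ.+ 1) ℕ.+ 2 ℕ.* b ≡ ⟨ a , b ⟩ ℕ.+ ⟨ a , b ⟩
  double-pair a b = trans (trans (lemma a b) (cong (ℕ._+ (b ℕ.+ b)) (sym (double-triangle (a ℕ.+ b))))) (lemma′ (triangle (a ℕ.+ b)) b)
    where
    lemma : ∀ a b → (b ℕ.+ a) ℕ.* (b ℕ.+ a ℕ.+ 1) ℕ.+ 2 ℕ.* b ≡ (a ℕ.+ b) ℕ.* suc (a ℕ.+ b) ℕ.+ (b ℕ.+ b)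
    lemma = solve-∀
    lemma′ : ∀ t b → t ℕ.+ t ℕ.+ (b ℕ.+ b) ≡ t ℕ.+ b ℕ.+ (t ℕ.+ b)
    lemma′ = solve-∀

  nat : ℕ → ℚᵘ
  nat n = frac n 0

  nat-* : ∀ m n → nat m ℚ.* nat n ℚ.≃ nat (m ℕ.* n)
  nat-* m n = *≡* (cong (ℤ._* ℤ.+ 1) (sym (ℤₚ.pos-* m n)))

  unit-nat : ∀ K → unit K ℚ.* nat (suc K) ℚ.≃ 1ℚᵘ
  unit-nat K = *≡* (trans (ℤₚ.*-identityʳ _) (cong (λ n → ℤ.+ suc n) (lemma K)))
    where
    lemma : ∀ K → K ℕ.+ 0 ≡ K ℕ.* 1 ℕ.+ 0
    lemma = solve-∀

  -- child K x + 1 is the code of K + 1 and x + 1.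
  child : ℕ → ℕ → ℕ
  child K x = pred ⟨ suc K , suc x ⟩

  -- Intervals express the equation r A = B as two inequalities. The sign of the inverse of A is
  -- recorded so that each of them can be divided by A on its own.
  record Solves (A B C : ℚᵘ) : Set where
    constructor solves
    field
      {inverse} : ℚᵘ
      nonneg    : 0ℚᵘ ℚ.≤ inverse
      inverts   : A ℚ.* inverse ℚ.≃ 1ℚᵘ
      solution  : B ℚ.* inverse ℚ.≃ C

    satisfies : C ℚ.* A ℚ.≃ B
    satisfies = begin-equality
      C ℚ.* A                 ≃⟨ ℚₚ.*-congʳ {A} solution ⟨
      B ℚ.* inverse ℚ.* A     ≃⟨ solve 3 (λ B D A → B :* D :* A := B :* (A :* D)) ℚₚ.≃-refl B inverse A ⟩
      B ℚ.* (A ℚ.* inverse)   ≃⟨ ℚₚ.*-congˡ {B} inverts ⟩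
      B ℚ.* 1ℚᵘ               ≃⟨ ℚₚ.*-identityʳ B ⟩
      B                       ∎
      where open ℚₚ.≤-Reasoning

  0≤frac : ∀ n d → 0ℚᵘ ℚ.≤ frac n d
  0≤frac n d = ℚₚ.nonNegative⁻¹ (frac n d)

  0≤* : ∀ {p q} → 0ℚᵘ ℚ.≤ p → 0ℚᵘ ℚ.≤ q → 0ℚᵘ ℚ.≤ p ℚ.* q
  0≤* {p} {q} 0≤p 0≤q = ℚₚ.nonNegative⁻¹ (p ℚ.* q) {{ℚₚ.nonNeg*nonNeg⇒nonNeg p {{ℚ.nonNegative 0≤p}} q {{ℚ.nonNegative 0≤q}}}}

  opaque
    unfolding αℚ

    -- Let a = K + 1 and b = x + 1. Multiplication by (a b)² turns α into (a + b) (a + b + 1) + 2 b,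
    -- which is twice ⟨ a , b ⟩, and β into 2. So (a b)² / (2 ⟨ a , b ⟩) inverts α.
    solves-child : ∀ K x → Solves (αℚ (unit K) (unit x)) (βℚ (unit K) (unit x)) (unit (child K x))
    solves-child K x = solves {inverse = E ℚ.* w}
      (0≤* {E} (0≤* {a ℚ.* b} 0≤ab 0≤ab) (0≤* {½} (*≤* (ℤ.+≤+ ℕ.z≤n)) (ℚₚ.<⇒≤ (0<unit (child K x)))))
      (begin-equality
        αℚ s y ℚ.* (E ℚ.* w)
          ≃⟨ solve 6 (λ s y a b t w →
               ((s :+ y) :* (s :+ y :+ s :* y) :+ t :* (s :* s :* y)) :* ((a :* b) :* (a :* b) :* w) :=
               (((s :* a) :* b :+ (y :* b) :* a) :* ((s :* a) :* b :+ (y :* b) :* a :+ (s :* a) :* (y :* b))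
                 :+ t :* ((s :* a) :* (s :* a) :* (y :* b) :* b)) :* w) ℚₚ.≃-refl s y a b two w ⟩
        g (s ℚ.* a) (y ℚ.* b) ℚ.* w
          ≃⟨ ℚₚ.*-congʳ {w} (g-cong (unit-nat K) (unit-nat x)) ⟩
        g 1ℚᵘ 1ℚᵘ ℚ.* w
          ≃⟨ ℚₚ.*-congʳ {w} (ℚₚ.+-cong (ℚₚ.*-cong one (ℚₚ.+-cong one ones)) (ℚₚ.*-congˡ {two} (ℚₚ.≃-trans (ℚₚ.*-congʳ {b} ones³) (ℚₚ.*-identityˡ b)))) ⟩
        ((b ℚ.+ a) ℚ.* (b ℚ.+ a ℚ.+ 1ℚᵘ) ℚ.+ two ℚ.* b) ℚ.* w
          ≃⟨ ℚₚ.*-congʳ {w} casts ⟩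
        (c ℚ.+ c) ℚ.* w
          ≃⟨ solve 3 (λ c h u → (c :+ c) :* (h :* u) := h :* (u :* c) :+ h :* (u :* c)) ℚₚ.≃-refl c ½ u ⟩
        ½ ℚ.* (u ℚ.* c) ℚ.+ ½ ℚ.* (u ℚ.* c)
          ≃⟨ CauchyLemmas.half+half (u ℚ.* c) ⟩
        u ℚ.* c
          ≃⟨ unit-nat (child K x) ⟩
        1ℚᵘ ∎)
      (begin-equality
        βℚ s y ℚ.* (E ℚ.* w)
          ≃⟨ solve 6 (λ s y a b t w → t :* (s :* s :* (y :* y)) :* ((a :* b) :* (a :* b) :* w) :=
               (s :* a) :* (s :* a) :* ((y :* b) :* (y :* b)) :* (t :* w)) ℚₚ.≃-refl s y a b two w ⟩
        (s ℚ.* a) ℚ.* (s ℚ.* a) ℚ.* ((y ℚ.* b) ℚ.* (y ℚ.* b)) ℚ.* (two ℚ.* w)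
          ≃⟨ ℚₚ.*-congʳ {two ℚ.* w} (ℚₚ.≃-trans (ℚₚ.*-cong (ℚₚ.*-cong (unit-nat K) (unit-nat K)) (ℚₚ.*-cong (unit-nat x) (unit-nat x))) ones⁴) ⟩
        1ℚᵘ ℚ.* (two ℚ.* w)
          ≃⟨ ℚₚ.*-identityˡ (two ℚ.* w) ⟩
        two ℚ.* (½ ℚ.* u)
          ≃⟨ ℚₚ.*-assoc two ½ u ⟨
        two ℚ.* ½ ℚ.* u
          ≃⟨ ℚₚ.*-congʳ {u} {two ℚ.* ½} {1ℚᵘ} (*≡* refl) ⟩
        1ℚᵘ ℚ.* u
          ≃⟨ ℚₚ.*-identityˡ u ⟩
        u ∎)
      where
      open ℚₚ.≤-Reasoning
      s y a b c u two E w : ℚᵘ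
      s = unit K
      y = unit x
      a = nat (suc K)
      b = nat (suc x)
      c = nat ⟨ suc K , suc x ⟩
      u = unit (child K x)
      two = mkℚᵘ (ℤ.+ 2) 0
      E = (a ℚ.* b) ℚ.* (a ℚ.* b)
      w = ½ ℚ.* u
      0≤ab : 0ℚᵘ ℚ.≤ a ℚ.* b
      0≤ab = 0≤* {a} (0≤frac (suc K) 0) (0≤frac (suc x) 0)
      g : ℚᵘ → ℚᵘ → ℚᵘ
      g p q = (p ℚ.* b ℚ.+ q ℚ.* a) ℚ.* (p ℚ.* b ℚ.+ q ℚ.* a ℚ.+ p ℚ.* q) ℚ.+ two ℚ.* (p ℚ.* p ℚ.* q ℚ.* b)
      g-cong : ∀ {p p′ q q′} → p ℚ.≃ p′ → q ℚ.≃ q′ → g p q ℚ.≃ g p′ q′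
      g-cong e e′ = let l = ℚₚ.+-cong (ℚₚ.*-congʳ {b} e) (ℚₚ.*-congʳ {a} e′) in
        ℚₚ.+-cong (ℚₚ.*-cong l (ℚₚ.+-cong l (ℚₚ.*-cong e e′))) (ℚₚ.*-congˡ {two} (ℚₚ.*-congʳ {b} (ℚₚ.*-cong (ℚₚ.*-cong e e) e′)))
      ones : 1ℚᵘ ℚ.* 1ℚᵘ ℚ.≃ 1ℚᵘ
      ones = *≡* refl
      ones³ : 1ℚᵘ ℚ.* 1ℚᵘ ℚ.* 1ℚᵘ ℚ.≃ 1ℚᵘ
      ones³ = *≡* refl
      ones⁴ : 1ℚᵘ ℚ.* 1ℚᵘ ℚ.* (1ℚᵘ ℚ.* 1ℚᵘ) ℚ.≃ 1ℚᵘ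
      ones⁴ = *≡* refl
      one : 1ℚᵘ ℚ.* b ℚ.+ 1ℚᵘ ℚ.* a ℚ.≃ b ℚ.+ a
      one = ℚₚ.+-cong (ℚₚ.*-identityˡ b) (ℚₚ.*-identityˡ a)
      casts : (b ℚ.+ a) ℚ.* (b ℚ.+ a ℚ.+ 1ℚᵘ) ℚ.+ two ℚ.* b ℚ.≃ c ℚ.+ c
      casts = begin-equality
        (b ℚ.+ a) ℚ.* (b ℚ.+ a ℚ.+ 1ℚᵘ) ℚ.+ two ℚ.* b
          ≃⟨ ℚₚ.+-cong (ℚₚ.*-cong sum (ℚₚ.≃-trans (ℚₚ.+-congˡ 1ℚᵘ sum) (same-denominator-+ (suc x ℕ.+ suc K) 1 0))) (nat-* 2 (suc x)) ⟩
        nat (suc x ℕ.+ suc K) ℚ.* nat (suc x ℕ.+ suc K ℕ.+ 1) ℚ.+ nat (2 ℕ.* suc x)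
          ≃⟨ ℚₚ.+-congˡ (nat (2 ℕ.* suc x)) (nat-* (suc x ℕ.+ suc K) (suc x ℕ.+ suc K ℕ.+ 1)) ⟩
        nat ((suc x ℕ.+ suc K) ℕ.* (suc x ℕ.+ suc K ℕ.+ 1)) ℚ.+ nat (2 ℕ.* suc x)
          ≃⟨ same-denominator-+ ((suc x ℕ.+ suc K) ℕ.* (suc x ℕ.+ suc K ℕ.+ 1)) (2 ℕ.* suc x) 0 ⟩
        nat ((suc x ℕ.+ suc K) ℕ.* (suc x ℕ.+ suc K ℕ.+ 1) ℕ.+ 2 ℕ.* suc x)
          ≡⟨ cong nat (double-pair (suc K) (suc x)) ⟩
        nat (⟨ suc K , suc x ⟩ ℕ.+ ⟨ suc K , suc x ⟩)
          ≃⟨ same-denominator-+ ⟨ suc K , suc x ⟩ ⟨ suc K , suc x ⟩ 0 ⟨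
        c ℚ.+ c ∎
        where
        sum : b ℚ.+ a ℚ.≃ nat (suc x ℕ.+ suc K)
        sum = same-denominator-+ (suc x) (suc K) 0

    -- At y = 0 only s² is left of α and nothing of β, so an existential move 0 forces the new
    -- history to be 0.
    solves-forfeit : ∀ K → Solves (αℚ (unit K) 0ℚᵘ) (βℚ (unit K) 0ℚᵘ) 0ℚᵘ
    solves-forfeit K = solves {inverse = a ℚ.* a} (0≤* {a} {a} (0≤frac (suc K) 0) (0≤frac (suc K) 0))
      (begin-equality
        αℚ s 0ℚᵘ ℚ.* (a ℚ.* a)
          ≃⟨ solve 3 (λ s a t → ((s :+ con 0ℚᵘ) :* (s :+ con 0ℚᵘ :+ s :* con 0ℚᵘ) :+ t :* (s :* s :* con 0ℚᵘ)) :* (a :* a) := (s :* a) :* (s :* a))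
               ℚₚ.≃-refl s a (mkℚᵘ (ℤ.+ 2) 0) ⟩
        (s ℚ.* a) ℚ.* (s ℚ.* a)
          ≃⟨ ℚₚ.*-cong (unit-nat K) (unit-nat K) ⟩
        1ℚᵘ ℚ.* 1ℚᵘ
          ≃⟨ *≡* refl ⟩
        1ℚᵘ ∎)
      (solve 3 (λ s a t → t :* (s :* s :* (con 0ℚᵘ :* con 0ℚᵘ)) :* (a :* a) := con 0ℚᵘ) ℚₚ.≃-refl s a (mkℚᵘ (ℤ.+ 2) 0))
      where
      open ℚₚ.≤-Reasoning
      s a : ℚᵘ
      s = unit K
      a = nat (suc K)

    -- A lost history stays lost through a universal round: against s = 0 the universal player may
    -- move 1, where α is 1 and β is 0.
    solves-lost : Solves (αℚ 0ℚᵘ (unit 0)) (βℚ 0ℚᵘ (unit 0)) 0ℚᵘ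
    solves-lost = solves {inverse = 1ℚᵘ} (*≤* (ℤ.+≤+ ℕ.z≤n)) (*≡* refl) (*≡* refl)

-- The meaning of the moves in the reals

module Truth where

  open import Data.Empty using (⊥)
  open import Data.Integer.Base as ℤ using (ℤ)
  open import Data.Nat.Base as ℕ using (ℕ; suc)
  open import Data.Product.Base using (_×_; _,_; proj₁; proj₂)
  open import Data.Rational.Unnormalised.Base as ℚ using (ℚᵘ; mkℚᵘ; 0ℚᵘ; 1ℚᵘ; ½)
  import Data.Rational.Unnormalised.Properties as ℚₚ
  open import Data.Vec.Base using (Vec; _∷_)
  open import Function.Bundles using (_⇔_; mk⇔; module Equivalence)
  open import Level using (0ℓ)
  open import Relation.Binary.PropositionalEquality using (_≡_; _≢_; sym; subst)
  open import Relation.Nullary using (¬_)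
  open import Relation.Unary using (Pred)
  open import Defs
  open Pairing using (pair; pair-def; first≤pair)
  open Reals hiding (≈-refl; ≈-sym; ≈-trans; ≤-trans)
  open Tent using (IsEnvelope; module Envelope)
  open Game using (Some; Every; Stable)
  open Formula
  open Equivalence using (to; from)

  -- The relations on ℝ unfold to quantifiers; wrapping them lets implicit arguments be inferred.
  infix 4 _≋_ _≼_
  record _≋_ (x y : ℝ) : Set where
    constructor ≋-intro
    field ≋-elim : x ≈ y
  open _≋_ public

  record _≼_ (x y : ℝ) : Set where
    constructor ≼-intro
    field ≼-elim : x ≤ y
  open _≼_ public

  ≋-refl : ∀ {x} → x ≋ x
  ≋-refl {x} = ≋-intro (Reals.≈-refl {x})

  ≋-sym : ∀ {x y} → x ≋ y → y ≋ x
  ≋-sym {x} {y} (≋-intro e) = ≋-intro (Reals.≈-sym {x} {y} e)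

  ≋-trans : ∀ {x y z} → x ≋ y → y ≋ z → x ≋ z
  ≋-trans {x} {y} {z} (≋-intro e) (≋-intro e′) = ≋-intro (Reals.≈-trans {x} {y} {z} e e′)

  ≋-+ : ∀ {x x′ y y′} → x ≋ x′ → y ≋ y′ → x + y ≋ x′ + y′
  ≋-+ {x} {x′} {y} {y′} (≋-intro e) (≋-intro e′) = ≋-intro (+-cong {x} {x′} {y} {y′} e e′)

  ≋-* : ∀ {x x′ y y′} → x ≋ x′ → y ≋ y′ → x * y ≋ x′ * y′
  ≋-* {x} {x′} {y} {y′} (≋-intro e) (≋-intro e′) = ≋-intro (*-cong {x} {x′} {y} {y′} e e′)

  ≋-pointwise : ∀ {x y} → (∀ n → seq x n ℚ.≃ seq y n) → x ≋ y
  ≋-pointwise {x} {y} e = ≋-intro (≃⇒≈ {x} {y} e)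

  ≋-fromℚ : ∀ {p q} → p ℚ.≃ q → fromℚ p ≋ fromℚ q
  ≋-fromℚ e = ≋-pointwise (λ _ → e)

  ≋⇒≼ : ∀ {x y} → x ≋ y → x ≼ y
  ≋⇒≼ (≋-intro e) = ≼-intro (proj₁ e)

  ≼-antisym : ∀ {x y} → x ≼ y → y ≼ x → x ≋ y
  ≼-antisym (≼-intro l) (≼-intro l′) = ≋-intro (l , l′)

  ≼-refl : ∀ {x} → x ≼ x
  ≼-refl = ≋⇒≼ ≋-refl

  ≼-trans : ∀ {x y z} → x ≼ y → y ≼ z → x ≼ z
  ≼-trans {x} {y} {z} (≼-intro l) (≼-intro l′) = ≼-intro (Reals.≤-trans {x} {y} {z} l l′)

  ≼-fromℚ : ∀ {p q} → p ℚ.≤ q → fromℚ p ≼ fromℚ q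
  ≼-fromℚ l = ≼-intro (fromℚ-≤ l)

  ≼-*ʳ : ∀ {x y} c → 0ℚᵘ ℚ.≤ c → x ≼ y → x * fromℚ c ≼ y * fromℚ c
  ≼-*ʳ {x} {y} c 0≤c (≼-intro l) = ≼-intro (*-monoʳ-≤ {x} {y} c 0≤c l)

  scale-cancel : ∀ {x A D} → A ℚ.* D ℚ.≃ 1ℚᵘ → x * fromℚ A * fromℚ D ≋ x
  scale-cancel {x} {A} {D} e = ≋-pointwise {x * fromℚ A * fromℚ D} {x} λ n →
    ℚₚ.≃-trans (ℚₚ.*-assoc (seq x n) A D) (ℚₚ.≃-trans (ℚₚ.*-congˡ {seq x n} e) (ℚₚ.*-identityʳ (seq x n)))

  +-value : ∀ {x y p q} → x ≋ fromℚ p → y ≋ fromℚ q → x + y ≋ fromℚ (p ℚ.+ q)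
  +-value {x} {y} {p} {q} e e′ = ≋-trans {y = fromℚ p + fromℚ q} (≋-+ {x} {fromℚ p} {y} {fromℚ q} e e′)
    (≋-pointwise {fromℚ p + fromℚ q} {fromℚ (p ℚ.+ q)} λ _ → ℚₚ.≃-refl {p ℚ.+ q})

  *-value : ∀ {x y p q} → x ≋ fromℚ p → y ≋ fromℚ q → x * y ≋ fromℚ (p ℚ.* q)
  *-value {x} {y} {p} {q} e e′ = ≋-trans {y = fromℚ p * fromℚ q} (≋-* {x} {fromℚ p} {y} {fromℚ q} e e′)
    (≋-pointwise {fromℚ p * fromℚ q} {fromℚ (p ℚ.* q)} λ _ → ℚₚ.≃-refl {p ℚ.* q})

  scale-≼ : ∀ {y u v q b} → y ≋ fromℚ q → 0ℚᵘ ℚ.≤ b → q ℚ.* b ℚ.≃ 1ℚᵘ → y * u ≼ y * v → u ≼ v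
  scale-≼ {y} {u} {v} {q} {b} e 0≤b inv l =
    ≼-trans (≋⇒≼ (≋-sym (cancel u))) (≼-trans (≼-*ʳ {y * u} {y * v} b 0≤b l) (≋⇒≼ (cancel v)))
    where
    cancel : ∀ u → y * u * fromℚ b ≋ u
    cancel u = ≋-trans {y = fromℚ q * u * fromℚ b}
      (≋-* {y * u} {fromℚ q * u} {fromℚ b} {fromℚ b} (≋-* {y} {fromℚ q} {u} {u} e ≋-refl) ≋-refl)
      (≋-pointwise {fromℚ q * u * fromℚ b} {u} λ n →
        ℚₚ.≃-trans (ℚₚ.*-congʳ {b} (ℚₚ.*-comm q (seq u n))) (ℚₚ.≃-trans (ℚₚ.*-assoc (seq u n) q b)
          (ℚₚ.≃-trans (ℚₚ.*-congˡ {seq u n} inv) (ℚₚ.*-identityʳ (seq u n)))))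

  zero-* : ∀ {y} u → y ≋ fromℚ 0ℚᵘ → y * u ≋ fromℚ 0ℚᵘ
  zero-* {y} u e = ≋-trans {y = fromℚ 0ℚᵘ * u} (≋-* {y} {fromℚ 0ℚᵘ} {u} {u} e ≋-refl)
    (≋-pointwise {fromℚ 0ℚᵘ * u} {fromℚ 0ℚᵘ} λ n → ℚₚ.*-zeroˡ (seq u n))

  -- f detects the set of the numbers 1 / K with r K ≢ 0.
  Detects : (ℝ → ℝ) → (ℕ → ℕ) → Set
  Detects f r =
    (∀ {y K} → r (suc K) ≢ 0 → y ≋ fromℚ (unit K) → fromℚ ½ * (y * y) ≼ f y) ×
    (∀ {y} → fromℚ 0ℚᵘ ≼ y → fromℚ ½ * (y * y) ≼ f y → ¬ (y ≋ fromℚ 0ℚᵘ) →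
      ¬ (∀ K → r (suc K) ≢ 0 → ¬ (y ≋ fromℚ (unit K))))

  envelope-detects : ∀ {r F} (env : IsEnvelope r F) → Detects (Envelope.envelope env) r
  envelope-detects env =
    (λ { {y} rK (≋-intro e) → ≼-intro (Envelope.peaks env {y} rK e) }) ,
    (λ { {y} (≼-intro 0≤y) (≼-intro l) y≉0 no → Envelope.envelope-misses env {y} 0≤y (λ e → y≉0 (≋-intro e))
           (λ K rK e → no K rK (≋-intro e)) l })

  record Has {n : ℕ} (ρ : Vec ℝ n) (t : Term n) (p : ℚᵘ) : Set where
    constructor has
    field has-elim : ⟦ t ⟧ ρ ≋ fromℚ p
  open Has public

  record Le {n : ℕ} (ρ : Vec ℝ n) (t u : Term n) : Set where
    constructor le
    field le-elim : ⟦ t ⟧ ρ ≼ ⟦ u ⟧ ρ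
  open Le public

  record Within {n : ℕ} (ρ : Vec ℝ n) (a b : Term n) (z : ℝ) : Set where
    constructor within
    field
      lower : ⟦ a ⟧ ρ ≼ z
      upper : z ≼ ⟦ b ⟧ ρ

    interval : Le ρ a b
    interval = le (≼-trans lower upper)
  open Within public

  record Sat {n : ℕ} (ρ : Vec ℝ n) (φ : BoundedFormula n) : Set where
    constructor sat
    field sat-elim : ρ ⊨ φ
  open Sat public

  module _ {n : ℕ} {ρ : Vec ℝ n} where

    ∃-elim : ∀ {a b φ} → Sat ρ (∃[ a , b ] φ) → (∀ z → Within ρ a b z → ¬ Sat (z ∷ ρ) φ) → ⊥
    ∃-elim (sat s) f = s λ z (l , u , h) → f z (within (≼-intro l) (≼-intro u)) (sat h)

    ∃-intro : ∀ {a b φ} → (¬ (∀ z → Within ρ a b z → ¬ Sat (z ∷ ρ) φ)) → Sat ρ (∃[ a , b ] φ)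
    ∃-intro s = sat λ f → s λ z (within (≼-intro l) (≼-intro u)) (sat h) → f z (l , u , h)

    ∀-elim : ∀ {a b φ} → Sat ρ (∀[ a , b ] φ) → ∀ z → Within ρ a b z → Sat (z ∷ ρ) φ
    ∀-elim (sat s) z (within (≼-intro l) (≼-intro u)) = sat (s z (l , u))

    ∀-intro : ∀ {a b φ} → (∀ z → Within ρ a b z → Sat (z ∷ ρ) φ) → Sat ρ (∀[ a , b ] φ)
    ∀-intro s = sat λ z (l , u) → sat-elim (s z (within (≼-intro l) (≼-intro u)))

    -- Witness for a quantifier that merely states that its interval is nonempty.
    at-lower : ∀ {a b} → Le ρ a b → Within ρ a b (⟦ a ⟧ ρ)
    at-lower (le l) = within ≼-refl l

    has-const : ∀ p → Has ρ (const p) p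
    has-const p = has ≋-refl

    has-⊕ : ∀ {s t p q} → Has ρ s p → Has ρ t q → Has ρ (s ⊕ t) (p ℚ.+ q)
    has-⊕ {s} {t} {p} {q} (has e) (has e′) = has (+-value {⟦ s ⟧ ρ} {⟦ t ⟧ ρ} {p} {q} e e′)

    has-⊗ : ∀ {s t p q} → Has ρ s p → Has ρ t q → Has ρ (s ⊗ t) (p ℚ.* q)
    has-⊗ {s} {t} {p} {q} (has e) (has e′) = has (*-value {⟦ s ⟧ ρ} {⟦ t ⟧ ρ} {p} {q} e e′)

    ⊗-elim : ∀ t u {x y} → ⟦ t ⟧ ρ ≋ x → ⟦ u ⟧ ρ ≋ y → ⟦ t ⊗ u ⟧ ρ ≋ x * y
    ⊗-elim t u {x} {y} = ≋-* {⟦ t ⟧ ρ} {x} {⟦ u ⟧ ρ} {y}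

    ⊗-cong : ∀ {t u v} → ⟦ t ⟧ ρ ≋ ⟦ u ⟧ ρ → ⟦ v ⊗ t ⟧ ρ ≋ ⟦ v ⊗ u ⟧ ρ
    ⊗-cong {t} {u} {v} e = ≋-* {⟦ v ⟧ ρ} {⟦ v ⟧ ρ} {⟦ t ⟧ ρ} {⟦ u ⟧ ρ} ≋-refl e

    Le-unscale : ∀ {y t u q b} → Has ρ y q → 0ℚᵘ ℚ.≤ b → q ℚ.* b ℚ.≃ 1ℚᵘ → Le ρ (y ⊗ t) (y ⊗ u) → Le ρ t u
    Le-unscale {y} {t} {u} {q} {b} (has e) 0≤b inv (le l) = le (scale-≼ {⟦ y ⟧ ρ} {⟦ t ⟧ ρ} {⟦ u ⟧ ρ} {q} {b} e 0≤b inv l)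

    Le-zero : ∀ {y t u} → Has ρ y 0ℚᵘ → Le ρ (y ⊗ t) (y ⊗ u)
    Le-zero {y} {t} {u} (has e) = le (≋⇒≼ (≋-trans {y = fromℚ 0ℚᵘ} (zero-* {⟦ y ⟧ ρ} (⟦ t ⟧ ρ) e) (≋-sym (zero-* {⟦ y ⟧ ρ} (⟦ u ⟧ ρ) e))))

    module _ {s y : Term n} {p q : ℚᵘ} (s-has : Has ρ s p) (y-has : Has ρ y q) where

      private
        c = mkℚᵘ (ℤ.+ 2) 0

        sum : Has ρ (s ⊕ y) (p ℚ.+ q)
        sum = has-⊕ {s} {y} {p} {q} s-has y-has

        product : Has ρ (s ⊗ y) (p ℚ.* q)
        product = has-⊗ {s} {y} {p} {q} s-has y-has

        square : Has ρ (s ⊗ s) (p ℚ.* p)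
        square = has-⊗ {s} {s} {p} {p} s-has s-has

        square′ : Has ρ (y ⊗ y) (q ℚ.* q)
        square′ = has-⊗ {y} {y} {q} {q} y-has y-has

        sum₃ : Has ρ ((s ⊕ y) ⊕ (s ⊗ y)) (p ℚ.+ q ℚ.+ p ℚ.* q)
        sum₃ = has-⊕ {s ⊕ y} {s ⊗ y} {p ℚ.+ q} {p ℚ.* q} sum product

        left-term : Has ρ ((s ⊕ y) ⊗ ((s ⊕ y) ⊕ (s ⊗ y))) ((p ℚ.+ q) ℚ.* (p ℚ.+ q ℚ.+ p ℚ.* q))
        left-term = has-⊗ {s ⊕ y} {(s ⊕ y) ⊕ (s ⊗ y)} {p ℚ.+ q} {p ℚ.+ q ℚ.+ p ℚ.* q} sum sum₃

        cubic : Has ρ ((s ⊗ s) ⊗ y) (p ℚ.* p ℚ.* q)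
        cubic = has-⊗ {s ⊗ s} {y} {p ℚ.* p} {q} square y-has

        quartic : Has ρ ((s ⊗ s) ⊗ (y ⊗ y)) (p ℚ.* p ℚ.* (q ℚ.* q))
        quartic = has-⊗ {s ⊗ s} {y ⊗ y} {p ℚ.* p} {q ℚ.* q} square square′

        right-term : Has ρ (const (mkℚᵘ (ℤ.+ 2) 0) ⊗ ((s ⊗ s) ⊗ y)) (mkℚᵘ (ℤ.+ 2) 0 ℚ.* (p ℚ.* p ℚ.* q))
        right-term = has-⊗ {const (mkℚᵘ (ℤ.+ 2) 0)} {(s ⊗ s) ⊗ y} {mkℚᵘ (ℤ.+ 2) 0} {p ℚ.* p ℚ.* q} (has-const (mkℚᵘ (ℤ.+ 2) 0)) cubic

      opaque
        unfolding α

        has-α : Has ρ (α s y) (αℚ p q)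
        has-α = subst (Has ρ (α s y)) (sym (αℚ-def p q))
          (has-⊕ {(s ⊕ y) ⊗ ((s ⊕ y) ⊕ (s ⊗ y))} {const (mkℚᵘ (ℤ.+ 2) 0) ⊗ ((s ⊗ s) ⊗ y)}
            {(p ℚ.+ q) ℚ.* (p ℚ.+ q ℚ.+ p ℚ.* q)} {mkℚᵘ (ℤ.+ 2) 0 ℚ.* (p ℚ.* p ℚ.* q)} left-term right-term)

        has-β : Has ρ (β s y) (βℚ p q)
        has-β = subst (Has ρ (β s y)) (sym (βℚ-def p q))
          (has-⊗ {const (mkℚᵘ (ℤ.+ 2) 0)} {(s ⊗ s) ⊗ (y ⊗ y)} {mkℚᵘ (ℤ.+ 2) 0} {p ℚ.* p ℚ.* (q ℚ.* q)}
            (has-const (mkℚᵘ (ℤ.+ 2) 0)) quartic)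

      module _ {C : ℚᵘ} (sol : Solves (αℚ p q) (βℚ p q) C) {r : Term n} where
        private
          rA : ⟦ r ⊗ α s y ⟧ ρ ≋ ⟦ r ⟧ ρ * fromℚ (αℚ p q)
          rA = ⊗-elim r (α s y) {⟦ r ⟧ ρ} {fromℚ (αℚ p q)} ≋-refl (has-elim has-α)

          rAD : ⟦ r ⟧ ρ * fromℚ (αℚ p q) * fromℚ (Solves.inverse sol) ≋ ⟦ r ⟧ ρ
          rAD = scale-cancel {⟦ r ⟧ ρ} {αℚ p q} {Solves.inverse sol} (Solves.inverts sol)

          BD : fromℚ (βℚ p q) * fromℚ (Solves.inverse sol) ≋ fromℚ C
          BD = ≋-trans {y = fromℚ (βℚ p q ℚ.* Solves.inverse sol)} (*-value {fromℚ (βℚ p q)} {fromℚ (Solves.inverse sol)} {βℚ p q} {Solves.inverse sol} ≋-refl ≋-refl) (≋-fromℚ (Solves.solution sol))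

        solution-upper : Le ρ (r ⊗ α s y) (β s y) → ⟦ r ⟧ ρ ≼ fromℚ C
        solution-upper (le l) = ≼-trans (≋⇒≼ (≋-sym rAD)) (≼-trans {y = fromℚ (βℚ p q) * fromℚ (Solves.inverse sol)}
          (≼-*ʳ {⟦ r ⟧ ρ * fromℚ (αℚ p q)} {fromℚ (βℚ p q)} (Solves.inverse sol) (Solves.nonneg sol) (≼-trans (≋⇒≼ (≋-sym rA)) (≼-trans l (≋⇒≼ (has-elim has-β)))))
          (≋⇒≼ BD))

        solution-lower : Le ρ (β s y) (r ⊗ α s y) → fromℚ C ≼ ⟦ r ⟧ ρ
        solution-lower (le l) = ≼-trans (≋⇒≼ (≋-sym BD)) (≼-trans {y = ⟦ r ⟧ ρ * fromℚ (αℚ p q) * fromℚ (Solves.inverse sol)}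
          (≼-*ʳ {fromℚ (βℚ p q)} {⟦ r ⟧ ρ * fromℚ (αℚ p q)} (Solves.inverse sol) (Solves.nonneg sol) (≼-trans (≋⇒≼ (≋-sym (has-elim has-β))) (≼-trans l (≋⇒≼ rA))))
          (≋⇒≼ rAD))

        solution-holds : Has ρ r C → ⟦ r ⊗ α s y ⟧ ρ ≋ ⟦ β s y ⟧ ρ
        solution-holds (has e) = ≋-trans {y = fromℚ (C ℚ.* αℚ p q)} (has-elim (has-⊗ {r} {α s y} {C} {αℚ p q} (has e) has-α))
          (≋-trans {y = fromℚ (βℚ p q)} (≋-fromℚ (Solves.satisfies sol)) (≋-sym (has-elim has-β)))

        solution-≤ : Has ρ r C → Le ρ (r ⊗ α s y) (β s y)
        solution-≤ h = le (≋⇒≼ (solution-holds h))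

        solution-≥ : Has ρ r C → Le ρ (β s y) (r ⊗ α s y)
        solution-≥ h = le (≋⇒≼ (≋-sym (solution-holds h)))

        scaled-≤ : Has ρ r C → Le ρ (y ⊗ (r ⊗ α s y)) (y ⊗ β s y)
        scaled-≤ h = le (≋⇒≼ (⊗-cong {r ⊗ α s y} {β s y} {y} (solution-holds h)))

        scaled-≥ : Has ρ r C → Le ρ (y ⊗ β s y) (y ⊗ (r ⊗ α s y))
        scaled-≥ h = le (≋⇒≼ (⊗-cong {β s y} {r ⊗ α s y} {y} (≋-sym (solution-holds h))))

    opaque
      unfolding halfSquare

      half-square : ∀ t → ⟦ halfSquare t ⟧ ρ ≋ fromℚ ½ * (⟦ t ⟧ ρ * ⟦ t ⟧ ρ)
      half-square t = ⊗-elim (const ½) (t ⊗ t) {fromℚ ½} {⟦ t ⟧ ρ * ⟦ t ⟧ ρ} ≋-refl (⊗-elim t t {⟦ t ⟧ ρ} {⟦ t ⟧ ρ} ≋-refl ≋-refl)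

    module _ {V : FunctionSymbol} {r : ℕ → ℕ} (detects : Detects (function V) r) {t : Term n} where
      detect-peak : ∀ {K} → r (suc K) ≢ 0 → Has ρ t (unit K) → Le ρ (halfSquare t) (app V t)
      detect-peak rK (has e) = le (≼-trans (≋⇒≼ (half-square t)) (proj₁ detects {⟦ t ⟧ ρ} rK e))

      detect-only : fromℚ 0ℚᵘ ≼ ⟦ t ⟧ ρ → Le ρ (halfSquare t) (app V t) → ¬ Has ρ t 0ℚᵘ →
        ¬ (∀ K → r (suc K) ≢ 0 → ¬ Has ρ t (unit K))
      detect-only 0≤t (le l) t≢0 no = proj₂ detects {⟦ t ⟧ ρ} 0≤t (≼-trans (≋⇒≼ (≋-sym (half-square t))) l)
        (λ e → t≢0 (has e)) (λ K rK e → no K rK (has e))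

  -- Variable 2 is 1 / K for the history K, or 0 if the existential player has forfeited.
  record Expresses {n : ℕ} (φ : BoundedFormula (3 ℕ.+ n)) (P : Pred ℕ 0ℓ) : Set where
    field
      at   : ∀ ρ K → Has ρ x₂ (unit K) → Sat ρ φ ⇔ P (suc K)
      lost : ∀ ρ → Has ρ x₂ 0ℚᵘ → ¬ Sat ρ φ

  suc-child : ∀ K x → suc (child K x) ≡ pair (suc K) (suc x)
  suc-child K x = sym (pair-def (suc K) (suc x))

  -- An existential move confines the new history to [ 0 , s ]; the intended value lies there
  -- because pairing does not decrease its first argument.
  child≤ : ∀ K x → unit (child K x) ℚ.≤ unit K
  child≤ K x = unit-mono (ℕ.s≤s⁻¹ (first≤pair (suc K) (suc x)))

  0≼unit : ∀ K → fromℚ 0ℚᵘ ≼ fromℚ (unit K)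
  0≼unit K = ≼-fromℚ (ℚₚ.<⇒≤ (0<unit K))

  unit≼1 : ∀ K → fromℚ (unit K) ≼ fromℚ 1ℚᵘ
  unit≼1 K = ≼-fromℚ (unit≤1 K)

  module _ {V : FunctionSymbol} (detects : Detects (function V) (λ _ → 1)) where

    module _ {n : ℕ} {φ : BoundedFormula (8 ℕ.+ n)} {P : Pred ℕ 0ℓ} (expresses : Expresses φ P) where
      open Expresses expresses

      module _ (a b s : ℝ) (ρ : Vec ℝ n) where

        exMove-complete : ∀ K → Has (a ∷ b ∷ s ∷ ρ) x₂ (unit K) → Some P (suc K) → Sat (a ∷ b ∷ s ∷ ρ) (exMove V φ)
        exMove-complete K (has e) some =
          ∃-intro λ f → some λ x px →
          let y = fromℚ (unit x)
              r = fromℚ (unit (child K x))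
          in f y (within (0≼unit x) (unit≼1 x)) (∃-intro λ f →
             f _ (at-lower (detect-peak {V = V} {λ _ → 1} detects {x₀} {x} (λ ()) (has ≋-refl))) (∃-intro λ f →
             f r (within (0≼unit (child K x)) (≼-trans (≼-fromℚ (child≤ K x)) (≋⇒≼ (≋-sym e)))) (∃-intro λ f →
             f _ (at-lower (solution-≤ {s = x₅} {x₂} (has e) (has {p = unit x} ≋-refl) (solves-child K x) {x₀} (has ≋-refl))) (∃-intro λ f →
             f _ (at-lower (solution-≥ {s = x₆} {x₃} (has e) (has {p = unit x} ≋-refl) (solves-child K x) {x₁} (has ≋-refl)))
             (from (at _ (child K x) (has ≋-refl)) (subst P (sym (suc-child K x)) px))))))

        exMove-analyse : (∀ y z r z₁ z₂ → fromℚ 0ℚᵘ ≼ y → Le (y ∷ a ∷ b ∷ s ∷ ρ) (halfSquare x₀) (app V x₀) → fromℚ 0ℚᵘ ≼ r → r ≼ s →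
          Le (r ∷ z ∷ y ∷ a ∷ b ∷ s ∷ ρ) (x₀ ⊗ α x₅ x₂) (β x₅ x₂) → Le (z₁ ∷ r ∷ z ∷ y ∷ a ∷ b ∷ s ∷ ρ) (β x₆ x₃) (x₁ ⊗ α x₆ x₃) →
          ¬ Sat (z₂ ∷ z₁ ∷ r ∷ z ∷ y ∷ a ∷ b ∷ s ∷ ρ) φ) → ¬ Sat (a ∷ b ∷ s ∷ ρ) (exMove V φ)
        exMove-analyse refute h =
          ∃-elim h λ y wy h → ∃-elim h λ z wz h → ∃-elim h λ r wr h → ∃-elim h λ z₁ w₁ h → ∃-elim h λ z₂ w₂ h →
          refute y z r z₁ z₂ (lower wy) (interval wz) (lower wr) (upper wr) (interval w₁) (interval w₂) h

        exMove-sound : ∀ K → Has (a ∷ b ∷ s ∷ ρ) x₂ (unit K) → Sat (a ∷ b ∷ s ∷ ρ) (exMove V φ) → Some P (suc K)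
        exMove-sound K (has e) h f = exMove-analyse (λ y z r z₁ z₂ 0≤y valid 0≤r r≤s l l′ h →
          detect-only {V = V} {λ _ → 1} detects {x₀} 0≤y valid
            (λ (has y≋0) → lost _ (has (≼-antisym (solution-upper {s = x₅} {x₂} (has e) (has y≋0) (solves-forfeit K) {x₀} l)
              (solution-lower {s = x₆} {x₃} (has e) (has y≋0) (solves-forfeit K) {x₁} l′))) h)
            (λ x _ (has y≋x) → f x (subst P (suc-child K x)
              (to (at _ (child K x) (has (≼-antisym (solution-upper {s = x₅} {x₂} (has e) (has y≋x) (solves-child K x) {x₀} l)
                (solution-lower {s = x₆} {x₃} (has e) (has y≋x) (solves-child K x) {x₁} l′)))) h)))) h

        exMove-lost : Has (a ∷ b ∷ s ∷ ρ) x₂ 0ℚᵘ → ¬ Sat (a ∷ b ∷ s ∷ ρ) (exMove V φ)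
        exMove-lost (has e) = exMove-analyse λ y z r z₁ z₂ 0≤y valid 0≤r r≤s l l′ →
          -- If s and y are both 0 then α and β vanish and the equation leaves r free. The upper end
          -- s of the interval of r covers this case.
          lost _ (has (≼-antisym (≼-trans r≤s (≋⇒≼ e)) 0≤r))

        -- A universal move 0 leaves r free; 1 / 4 stands for the history pair 1 1 = 4 won by the existential player.
        allMove-complete : P (pair 1 1) → ∀ K → Has (a ∷ b ∷ s ∷ ρ) x₂ (unit K) → Every P (suc K) → Sat (a ∷ b ∷ s ∷ ρ) (allMove V φ)
        allMove-complete won K (has e) every =
          ∀-intro λ y wy → ∀-intro λ z wz → ∃-intro λ f → detect-only {V = V} {λ _ → 1} detects {x₀} (lower wy) (interval wz)
            (λ (has y≋0) → f (fromℚ (unit 3)) (within (0≼unit 3) (unit≼1 3)) (∃-intro λ f →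
              f _ (at-lower (Le-zero (has y≋0))) (∃-intro λ f →
              f _ (at-lower (Le-zero (has y≋0))) (from (at _ 3 (has ≋-refl)) (subst P (pair-def 1 1) won)))))
            (λ x _ (has y≋x) → f (fromℚ (unit (child K x))) (within (0≼unit (child K x)) (unit≼1 (child K x))) (∃-intro λ f →
              f _ (at-lower (scaled-≤ {s = x₅} {x₂} (has e) (has y≋x) (solves-child K x) {x₀} (has ≋-refl))) (∃-intro λ f →
              f _ (at-lower (scaled-≥ {s = x₆} {x₃} (has e) (has y≋x) (solves-child K x) {x₁} (has ≋-refl)))
              (from (at _ (child K x) (has ≋-refl)) (subst P (sym (suc-child K x)) (every x))))))

        allMove-analyse : ∀ x → let y = fromℚ (unit x) in (∀ z r z₁ z₂ →
          Le (r ∷ z ∷ y ∷ a ∷ b ∷ s ∷ ρ) (x₀ ⊗ α x₅ x₂) (β x₅ x₂) → Le (z₁ ∷ r ∷ z ∷ y ∷ a ∷ b ∷ s ∷ ρ) (β x₆ x₃) (x₁ ⊗ α x₆ x₃) →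
          ¬ Sat (z₂ ∷ z₁ ∷ r ∷ z ∷ y ∷ a ∷ b ∷ s ∷ ρ) φ) → ¬ Sat (a ∷ b ∷ s ∷ ρ) (allMove V φ)
        allMove-analyse x refute h =
          ∃-elim (∀-elim (∀-elim h (fromℚ (unit x)) (within (0≼unit x) (unit≼1 x))) _
              (at-lower (detect-peak {V = V} {λ _ → 1} detects {x₀} {x} (λ ()) (has ≋-refl))))
            λ r wr h → ∃-elim h λ z₁ w₁ h → ∃-elim h λ z₂ w₂ h → refute _ r z₁ z₂
              (Le-unscale {y = x₂} {q = unit x} (has ≋-refl) (0≤frac (suc x) 0) (unit-nat x) (interval w₁))
              (Le-unscale {y = x₃} {q = unit x} (has ≋-refl) (0≤frac (suc x) 0) (unit-nat x) (interval w₂)) h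

        -- The choice of r by the existential player can be opened only towards a contradiction, so
        -- P itself is recovered from its double negation.
        allMove-sound : Stable P → ∀ K → Has (a ∷ b ∷ s ∷ ρ) x₂ (unit K) → Sat (a ∷ b ∷ s ∷ ρ) (allMove V φ) → Every P (suc K)
        allMove-sound stable K (has e) h x = stable _ λ ¬p → allMove-analyse x (λ z r z₁ z₂ l l′ h →
          ¬p (subst P (suc-child K x) (to (at _ (child K x) (has (≼-antisym
            (solution-upper {s = x₅} {x₂} (has e) (has {p = unit x} ≋-refl) (solves-child K x) {x₀} l)
            (solution-lower {s = x₆} {x₃} (has e) (has {p = unit x} ≋-refl) (solves-child K x) {x₁} l′)))) h))) h

        allMove-lost : Has (a ∷ b ∷ s ∷ ρ) x₂ 0ℚᵘ → ¬ Sat (a ∷ b ∷ s ∷ ρ) (allMove V φ)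
        allMove-lost (has e) = allMove-analyse 0 λ z r z₁ z₂ l l′ →
          lost _ (has (≼-antisym (solution-upper {s = x₅} {x₂} (has e) (has {p = unit 0} ≋-refl) solves-lost {x₀} l)
            (solution-lower {s = x₆} {x₃} (has e) (has {p = unit 0} ≋-refl) solves-lost {x₁} l′)))

      exMove-expresses : Expresses (exMove V φ) (Some P)
      exMove-expresses = record
        { at   = λ { (a ∷ b ∷ s ∷ ρ) K e → mk⇔ (exMove-sound a b s ρ K e) (exMove-complete a b s ρ K e) }
        ; lost = λ { (a ∷ b ∷ s ∷ ρ) e → exMove-lost a b s ρ e }
        }

      allMove-expresses : Stable P → P (pair 1 1) → Expresses (allMove V φ) (Every P)
      allMove-expresses stable won = record
        { at   = λ { (a ∷ b ∷ s ∷ ρ) K e → mk⇔ (allMove-sound a b s ρ stable K e) (allMove-complete a b s ρ won K e) }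
        ; lost = λ { (a ∷ b ∷ s ∷ ρ) e → allMove-lost a b s ρ e }
        }

-- Truth of a sentence depends on its code only

module Invariance where

  open import Data.Bool.Base using (true; false)
  open import Data.Fin.Base using (Fin; toℕ)
  import Data.Fin.Properties as Fin
  open import Data.Integer.Base as ℤ using (ℤ)
  open import Data.List.Base using ([]; _∷_; map)
  open import Data.List.Properties using (∷-injective)
  open import Data.List.Relation.Unary.All using (All; []; _∷_)
  open import Data.Maybe.Base using (nothing)
  open import Data.Maybe.Properties using (just-injective)
  open import Data.Nat.Base as ℕ using (ℕ; suc)
  import Data.Nat.Properties as ℕₚ
  open import Data.Product.Base using (∃-syntax; _×_; _,_; proj₁; proj₂)
  open import Data.Rational.Unnormalised.Base as ℚ using (ℚᵘ; mkℚᵘ)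
  import Data.Rational.Unnormalised.Properties as ℚₚ
  open import Data.Vec.Base using (Vec; []; _∷_; lookup)
  open import Relation.Binary.Construct.Closure.ReflexiveTransitive using (Star; ε; _◅_)
  open import Relation.Binary.PropositionalEquality hiding (inspect)
  open import Relation.Nullary using (¬_)
  open import Defs
  open Pairing using (⟨⟩-injective; codeList-injective)
  open Reals using (swap-∣-∣; 0≤½^; close⇒≈; eventually-map; _and_; <-resp)
  open Truth using (_≋_; ≋-intro; ≋-elim; ≋-refl; ≋-sym; ≋-trans; ≋-+; ≋-*; ≋⇒≼; ≼-intro; ≼-elim; ≼-trans)
  open CauchyLemmas using (half+half)

  ⟨⟩-injective′ : ∀ m n m′ n′ → ⟨ m , n ⟩ ≡ ⟨ m′ , n′ ⟩ → m ≡ m′ × n ≡ n′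
  ⟨⟩-injective′ m n m′ n′ = ⟨⟩-injective {m} {n} {m′} {n′}

  codeBool-injective : ∀ {a b} → codeBool a ≡ codeBool b → a ≡ b
  codeBool-injective {false} {false} _ = refl
  codeBool-injective {true}  {true}  _ = refl

  codeMove-injective : ∀ {a b} → codeMove a ≡ codeMove b → a ≡ b
  codeMove-injective {L}    {L}    _ = refl
  codeMove-injective {R}    {R}    _ = refl
  codeMove-injective {stay} {stay} _ = refl

  codeAction-injective : ∀ a b → codeAction a ≡ codeAction b → a ≡ b
  codeAction-injective (action w m q) (action w′ m′ q′) eq
    with ⟨⟩-injective′ (codeBool w) ⟨ codeMove m , q ⟩ (codeBool w′) ⟨ codeMove m′ , q′ ⟩ eq
  ... | e , eq′ with ⟨⟩-injective′ (codeMove m) q (codeMove m′) q′ eq′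
  ...   | e′ , refl rewrite codeBool-injective {w} {w′} e | codeMove-injective {m} {m′} e′ = refl

  codeRow-injective : ∀ {k} (r s : Row k) → codeRow r ≡ codeRow s → r ≡ s
  codeRow-injective (query q) (query q′) eq = cong query (proj₂ (⟨⟩-injective′ 1 q 1 q′ eq))
  codeRow-injective (query q) (inspect t a b) eq with () ← proj₁ (⟨⟩-injective′ 1 q 0 ⟨ toℕ t , ⟨ codeAction a , codeAction b ⟩ ⟩ eq)
  codeRow-injective (inspect t a b) (query q) eq with () ← proj₁ (⟨⟩-injective′ 0 ⟨ toℕ t , ⟨ codeAction a , codeAction b ⟩ ⟩ 1 q eq)
  codeRow-injective (inspect t a b) (inspect t′ a′ b′) eq
    with ⟨⟩-injective′ 0 ⟨ toℕ t , ⟨ codeAction a , codeAction b ⟩ ⟩ 0 ⟨ toℕ t′ , ⟨ codeAction a′ , codeAction b′ ⟩ ⟩ eq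
  ... | _ , eq′ with ⟨⟩-injective′ (toℕ t) ⟨ codeAction a , codeAction b ⟩ (toℕ t′) ⟨ codeAction a′ , codeAction b′ ⟩ eq′
  ...   | et , eq″ with ⟨⟩-injective′ (codeAction a) (codeAction b) (codeAction a′) (codeAction b′) eq″
  ...     | ea , eb rewrite Fin.toℕ-injective et | codeAction-injective a a′ ea | codeAction-injective b b′ eb = refl

  map-injective : ∀ {A : Set} {f : A → ℕ} → (∀ a b → f a ≡ f b → a ≡ b) → ∀ xs ys → map f xs ≡ map f ys → xs ≡ ys
  map-injective inj []       []       eq = refl
  map-injective inj (x ∷ xs) (y ∷ ys) eq with ∷-injective eq
  ... | e , es = cong₂ _∷_ (inj x y e) (map-injective inj xs ys es)

  index-injective : ∀ M N → index M ≡ index N → M ≡ N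
  index-injective (machine k rs) (machine l ss) eq
    with ⟨⟩-injective′ k (codeList (map codeRow rs)) l (codeList (map codeRow ss)) eq
  ... | refl , eq′ = cong (machine k) (map-injective codeRow-injective rs ss (codeList-injective eq′))

  codeℤ-injective : ∀ i j → codeℤ i ≡ codeℤ j → i ≡ j
  codeℤ-injective (ℤ.+ m)      (ℤ.+ n)      eq = cong ℤ.+_ (ℕₚ.*-cancelˡ-≡ m n 2 eq)
  codeℤ-injective (ℤ.-[1+ m ]) (ℤ.-[1+ n ]) eq = cong ℤ.-[1+_] (ℕₚ.*-cancelˡ-≡ m n 2 (ℕₚ.suc-injective eq))
  codeℤ-injective (ℤ.+ m)      (ℤ.-[1+ n ]) eq with () ← ℕₚ.even≢odd m n eq
  codeℤ-injective (ℤ.-[1+ m ]) (ℤ.+ n)      eq with () ← ℕₚ.even≢odd n m (sym eq)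

  codeℚ-injective : ∀ p q → codeℚ p ≡ codeℚ q → p ≡ q
  codeℚ-injective (mkℚᵘ m d) (mkℚᵘ n e) eq with ⟨⟩-injective′ (codeℤ m) d (codeℤ n) e eq
  ... | eq′ , refl = cong (λ i → mkℚᵘ i d) (codeℤ-injective m n eq′)

  module _ {M : Machine} (p : ℕ → ℕ) where

    step-deterministic : ∀ {c d e} → Step M (graph p) c d → Step M (graph p) c e → d ≡ e
    step-deterministic (inspecting row) (inspecting row′) with just-injective (trans (sym row) row′)
    ... | refl = refl
    step-deterministic (inspecting row) (querying row′ _) with () ← just-injective (trans (sym row) row′)
    step-deterministic (querying row _) (inspecting row′) with () ← just-injective (trans (sym row) row′)
    step-deterministic (querying row refl) (querying row′ refl) with just-injective (trans (sym row) row′)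
    ... | refl = refl

    halted-stops : ∀ {c d} → rowAt (table M) (state c) ≡ nothing → ¬ Step M (graph p) c d
    halted-stops halt (inspecting row) with () ← trans (sym row) halt
    halted-stops halt (querying row _) with () ← trans (sym row) halt

    star-deterministic : ∀ {c d e} → Star (Step M (graph p)) c d → Star (Step M (graph p)) c e →
      rowAt (table M) (state d) ≡ nothing → rowAt (table M) (state e) ≡ nothing → d ≡ e
    star-deterministic ε        ε          hd he = refl
    star-deterministic ε        (s ◅ _)    hd he with () ← halted-stops hd s
    star-deterministic (s ◅ _)  ε          hd he with () ← halted-stops he s
    star-deterministic (s ◅ ss) (s′ ◅ ss′) hd he with step-deterministic s s′
    ... | refl = star-deterministic ss ss′ hd he

    ⇓-deterministic : ∀ {i a b} → M [ graph p ] i ⇓ a → M [ graph p ] i ⇓ b → a ≡ b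
    ⇓-deterministic (_ , ss , h , v) (_ , ss′ , h′ , v′) with star-deterministic ss ss′ h h′
    ... | refl = trans (sym v) v′

  -- One binary digit more than asked for, which leaves the margin for the strict inequality in
  -- names.
  name : ℝ → ℕ → ℚᵘ
  name x i = seq x (proj₁ (cauchy x (suc i)))

  name-correct : ∀ x → name x IsNameOf x
  name-correct x i with cauchy x (suc i)
  ... | N , h = suc i , N , λ n N≤n → begin
      ℚ.∣ seq x N ℚ.- seq x n ∣ ℚ.+ ½^ suc i   ≤⟨ ℚₚ.+-monoˡ-≤ (½^ suc i) (h N n ℕₚ.≤-refl N≤n) ⟩
      ½^ suc i ℚ.+ ½^ suc i                    ≃⟨ half+half (½^ i) ⟩
      ½^ i                                     ∎
      where open ℚₚ.≤-Reasoning

  -- Both functions are evaluated on one and the same name of x. The machine being deterministic,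
  -- the outputs coincide as rationals, and a single sequence cannot name two different reals.
  same-program : ∀ f g → program f ≡ program g → ∀ x → function f x ≋ function g x
  same-program f g eq x with computes f x (name x) (name-correct x)
                           | subst (λ M → Computes M (function g)) (sym eq) (computes g) x (name x) (name-correct x)
  ... | q , q-name , q-runs | r , r-name , r-runs = ≋-intro (close⇒≈ {function f x} {function g x} λ k →
          eventually-map (λ n (l , l′) → close n k l l′) (near {function f x} {q (suc k)} {suc k} (q-name (suc k)) and near′ k))
      where
      open ℚₚ.≤-Reasoning
      near : ∀ {y p i} → ∣ fromℚ p - y ∣ < fromℚ (½^ i) → ∃[ N ] ∀ n → N ℕ.≤ n → ℚ.∣ p ℚ.- seq y n ∣ ℚ.≤ ½^ i
      near {y} {p} {i} (j , e) = eventually-map (λ n l → begin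
          ℚ.∣ p ℚ.- seq y n ∣              ≃⟨ ℚₚ.+-identityʳ ℚ.∣ p ℚ.- seq y n ∣ ⟨
          ℚ.∣ p ℚ.- seq y n ∣ ℚ.+ ℚ.0ℚᵘ    ≤⟨ ℚₚ.+-monoʳ-≤ ℚ.∣ p ℚ.- seq y n ∣ (0≤½^ j) ⟩
          ℚ.∣ p ℚ.- seq y n ∣ ℚ.+ ½^ j     ≤⟨ l ⟩
          ½^ i                             ∎) e
      same : ∀ i → r i ≡ q i
      same i = codeℚ-injective (r i) (q i) (⇓-deterministic {program f} (λ n → codeℚ (name x n)) (r-runs i) (q-runs i))
      near′ : ∀ k → ∃[ N ] ∀ n → N ℕ.≤ n → ℚ.∣ q (suc k) ℚ.- seq (function g x) n ∣ ℚ.≤ ½^ suc k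
      near′ k = subst (λ p → ∃[ N ] ∀ n → N ℕ.≤ n → ℚ.∣ p ℚ.- seq (function g x) n ∣ ℚ.≤ ½^ suc k) (same (suc k))
        (near {function g x} {r (suc k)} {suc k} (r-name (suc k)))
      close : ∀ n k → ℚ.∣ q (suc k) ℚ.- seq (function f x) n ∣ ℚ.≤ ½^ suc k → ℚ.∣ q (suc k) ℚ.- seq (function g x) n ∣ ℚ.≤ ½^ suc k →
        ℚ.∣ seq (function f x) n ℚ.- seq (function g x) n ∣ ℚ.≤ ½^ k
      close n k l l′ = begin
          ℚ.∣ a ℚ.- b ∣
            ≃⟨ ℚₚ.∣-∣-cong (solve 3 (λ a b c → a :- b := (a :- c) :+ (c :- b)) ℚₚ.≃-refl a b c) ⟩
          ℚ.∣ (a ℚ.- c) ℚ.+ (c ℚ.- b) ∣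
            ≤⟨ ℚₚ.∣p+q∣≤∣p∣+∣q∣ (a ℚ.- c) (c ℚ.- b) ⟩
          ℚ.∣ a ℚ.- c ∣ ℚ.+ ℚ.∣ c ℚ.- b ∣
            ≤⟨ ℚₚ.+-mono-≤ (ℚₚ.≤-trans (ℚₚ.≤-reflexive (swap-∣-∣ a c)) l) l′ ⟩
          ½^ suc k ℚ.+ ½^ suc k
            ≃⟨ half+half (½^ k) ⟩
          ½^ k ∎
          where
          open import Data.Rational.Unnormalised.Solver using (module +-*-Solver)
          open +-*-Solver using (solve; _:+_; _:-_; _:=_)
          a = seq (function f x) n
          b = seq (function g x) n
          c = q (suc k)

  ≡⇒≋ : ∀ {x y} → x ≡ y → x ≋ y
  ≡⇒≋ refl = ≋-refl

  module _ {n : ℕ} (ρ : Vec ℝ n) where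

    -- With the tag split off, terms of different shape are ruled out by the equality of tags and
    -- only matching constructors remain to be compared.
    term-tag term-body : Term n → ℕ
    term-tag (var i)   = 0
    term-tag (const q) = 1
    term-tag (s ⊕ t)   = 2
    term-tag (s ⊗ t)   = 3
    term-tag (app f t) = 4
    term-body (var i)   = toℕ i
    term-body (const q) = codeℚ q
    term-body (s ⊕ t)   = ⟨ codeTerm s , codeTerm t ⟩
    term-body (s ⊗ t)   = ⟨ codeTerm s , codeTerm t ⟩
    term-body (app f t) = ⟨ index (program f) , codeTerm t ⟩

    codeTerm-split : ∀ t → codeTerm t ≡ ⟨ term-tag t , term-body t ⟩
    codeTerm-split (var i)   = refl
    codeTerm-split (const q) = refl
    codeTerm-split (s ⊕ t)   = refl
    codeTerm-split (s ⊗ t)   = refl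
    codeTerm-split (app f t) = refl

    same-term : ∀ t u → codeTerm t ≡ codeTerm u → ⟦ t ⟧ ρ ≋ ⟦ u ⟧ ρ
    same-body : ∀ t u → term-tag t ≡ term-tag u → term-body t ≡ term-body u → ⟦ t ⟧ ρ ≋ ⟦ u ⟧ ρ
    same-term t u eq =
      let e , e′ = ⟨⟩-injective′ (term-tag t) (term-body t) (term-tag u) (term-body u)
                     (trans (sym (codeTerm-split t)) (trans eq (codeTerm-split u)))
      in same-body t u e e′
    same-body (var i)   (var j)   _ e = ≡⇒≋ (cong (lookup ρ) (Fin.toℕ-injective e))
    same-body (const p) (const q) _ e = ≡⇒≋ (cong fromℚ (codeℚ-injective p q e))
    same-body (s ⊕ t) (s′ ⊕ t′) _ e =
      let e₁ , e₂ = ⟨⟩-injective′ (codeTerm s) (codeTerm t) (codeTerm s′) (codeTerm t′) e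
      in ≋-+ {⟦ s ⟧ ρ} {⟦ s′ ⟧ ρ} {⟦ t ⟧ ρ} {⟦ t′ ⟧ ρ} (same-term s s′ e₁) (same-term t t′ e₂)
    same-body (s ⊗ t) (s′ ⊗ t′) _ e =
      let e₁ , e₂ = ⟨⟩-injective′ (codeTerm s) (codeTerm t) (codeTerm s′) (codeTerm t′) e
      in ≋-* {⟦ s ⟧ ρ} {⟦ s′ ⟧ ρ} {⟦ t ⟧ ρ} {⟦ t′ ⟧ ρ} (same-term s s′ e₁) (same-term t t′ e₂)
    same-body (app f t) (app g u) _ e =
      let e₁ , e₂ = ⟨⟩-injective′ (index (program f)) (codeTerm t) (index (program g)) (codeTerm u) e
      in ≋-trans {function f (⟦ t ⟧ ρ)} {function f (⟦ u ⟧ ρ)} {function g (⟦ u ⟧ ρ)}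
           (≋-intro (function-cong f {⟦ t ⟧ ρ} {⟦ u ⟧ ρ} (≋-elim (same-term t u e₂))))
           (same-program f g (index-injective (program f) (program g) e₁) (⟦ u ⟧ ρ))

    resp-≤ : ∀ {x x′ y y′} → x ≋ x′ → y ≋ y′ → x ≤ y → x′ ≤ y′
    resp-≤ {x} {x′} {y} {y′} e e′ l = ≼-elim (≼-trans {x′} {x} {y′} (≋⇒≼ (≋-sym e)) (≼-trans {x} {y} {y′} (≼-intro l) (≋⇒≼ e′)))

    atom-tag atom-body : Atom n → ℕ
    atom-tag (s ≐ t)  = 0
    atom-tag (s ≥′ t) = 1
    atom-tag (s >′ t) = 2
    atom-body (s ≐ t)  = ⟨ codeTerm s , codeTerm t ⟩
    atom-body (s ≥′ t) = ⟨ codeTerm s , codeTerm t ⟩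
    atom-body (s >′ t) = ⟨ codeTerm s , codeTerm t ⟩

    codeAtom-split : ∀ a → codeAtom a ≡ ⟨ atom-tag a , atom-body a ⟩
    codeAtom-split (s ≐ t)  = refl
    codeAtom-split (s ≥′ t) = refl
    codeAtom-split (s >′ t) = refl

    same-atom : ∀ a b → codeAtom a ≡ codeAtom b → TrueAtom ρ a → TrueAtom ρ b
    same-atom a b eq =
      let e , e′ = ⟨⟩-injective′ (atom-tag a) (atom-body a) (atom-tag b) (atom-body b)
                     (trans (sym (codeAtom-split a)) (trans eq (codeAtom-split b)))
      in go a b e e′
      where
      terms : ∀ s t s′ t′ → ⟨ codeTerm s , codeTerm t ⟩ ≡ ⟨ codeTerm s′ , codeTerm t′ ⟩ → ⟦ s ⟧ ρ ≋ ⟦ s′ ⟧ ρ × ⟦ t ⟧ ρ ≋ ⟦ t′ ⟧ ρ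
      terms s t s′ t′ e =
        let e₁ , e₂ = ⟨⟩-injective′ (codeTerm s) (codeTerm t) (codeTerm s′) (codeTerm t′) e
        in same-term s s′ e₁ , same-term t t′ e₂
      go : ∀ a b → atom-tag a ≡ atom-tag b → atom-body a ≡ atom-body b → TrueAtom ρ a → TrueAtom ρ b
      go (s ≐ t)  (s′ ≐ t′)  _ e (l , l′) = let e₁ , e₂ = terms s t s′ t′ e in resp-≤ e₁ e₂ l , resp-≤ e₂ e₁ l′
      go (s ≥′ t) (s′ ≥′ t′) _ e l = let e₁ , e₂ = terms s t s′ t′ e in resp-≤ e₂ e₁ l
      go (s >′ t) (s′ >′ t′) _ e l =
        let e₁ , e₂ = terms s t s′ t′ e
        in <-resp {⟦ t ⟧ ρ} {⟦ t′ ⟧ ρ} {⟦ s ⟧ ρ} {⟦ s′ ⟧ ρ} (≋-elim e₂) (≋-elim e₁) l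

    same-literal : ∀ l m → codeLiteral l ≡ codeLiteral m → TrueLiteral ρ l → TrueLiteral ρ m
    same-literal (pos a) (pos b) eq h   = same-atom a b (proj₂ (⟨⟩-injective′ 0 (codeAtom a) 0 (codeAtom b) eq)) h
    same-literal (neg a) (neg b) eq h h′ = h (same-atom b a (sym (proj₂ (⟨⟩-injective′ 1 (codeAtom a) 1 (codeAtom b) eq))) h′)
    same-literal (pos a) (neg b) eq h with () ← proj₁ (⟨⟩-injective′ 0 (codeAtom a) 1 (codeAtom b) eq)
    same-literal (neg a) (pos b) eq h with () ← proj₁ (⟨⟩-injective′ 1 (codeAtom a) 0 (codeAtom b) eq)

    same-all : ∀ {A : Set} {f : A → ℕ} {P : A → Set} → (∀ a b → f a ≡ f b → P a → P b) →
      ∀ xs ys → map f xs ≡ map f ys → All P xs → All P ys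
    same-all inv []       []       eq []       = []
    same-all inv (x ∷ xs) (y ∷ ys) eq (p ∷ ps) with ∷-injective eq
    ... | e , es = inv x y e p ∷ same-all inv xs ys es ps

    same-clause : ∀ c d → codeClause c ≡ codeClause d → TrueClause ρ c → TrueClause ρ d
    same-clause c d eq h none = h (same-all (λ l m e ¬l m-true → ¬l (same-literal m l (sym e) m-true)) d c
      (sym (codeList-injective eq)) none)

  formula-tag formula-body : ∀ {n} → BoundedFormula n → ℕ
  formula-tag (matrix ψ)     = 0
  formula-tag (∃[ a , b ] φ) = 1
  formula-tag (∀[ a , b ] φ) = 2
  formula-body (matrix ψ)     = codeList (map codeClause ψ)
  formula-body (∃[ a , b ] φ) = ⟨ codeTerm a , ⟨ codeTerm b , codeFormula φ ⟩ ⟩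
  formula-body (∀[ a , b ] φ) = ⟨ codeTerm a , ⟨ codeTerm b , codeFormula φ ⟩ ⟩

  codeFormula-split : ∀ {n} (φ : BoundedFormula n) → codeFormula φ ≡ ⟨ formula-tag φ , formula-body φ ⟩
  codeFormula-split (matrix ψ)     = refl
  codeFormula-split (∃[ a , b ] φ) = refl
  codeFormula-split (∀[ a , b ] φ) = refl

  same-formula : ∀ {n} (φ ψ : BoundedFormula n) → codeFormula φ ≡ codeFormula ψ → ∀ ρ → ρ ⊨ φ → ρ ⊨ ψ
  same-parts : ∀ {n} (φ ψ : BoundedFormula n) → formula-tag φ ≡ formula-tag ψ → formula-body φ ≡ formula-body ψ →
    ∀ ρ → ρ ⊨ φ → ρ ⊨ ψ
  same-formula φ ψ eq =
    let e , e′ = ⟨⟩-injective′ (formula-tag φ) (formula-body φ) (formula-tag ψ) (formula-body ψ)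
                   (trans (sym (codeFormula-split φ)) (trans eq (codeFormula-split ψ)))
    in same-parts φ ψ e e′
  same-parts (matrix ψ) (matrix ψ′) _ e ρ h = same-all ρ (same-clause ρ) ψ ψ′ (codeList-injective e) h
  same-parts (∃[ a , b ] φ) (∃[ a′ , b′ ] φ′) _ e ρ h f =
    let e₁ , e′ = ⟨⟩-injective′ (codeTerm a) ⟨ codeTerm b , codeFormula φ ⟩ (codeTerm a′) ⟨ codeTerm b′ , codeFormula φ′ ⟩ e
        e₂ , e₃ = ⟨⟩-injective′ (codeTerm b) (codeFormula φ) (codeTerm b′) (codeFormula φ′) e′
    in h λ y (l , u , k) → f y
         (resp-≤ ρ (same-term ρ a a′ e₁) (≋-refl {y}) l , resp-≤ ρ (≋-refl {y}) (same-term ρ b b′ e₂) u , same-formula φ φ′ e₃ (y ∷ ρ) k)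
  same-parts (∀[ a , b ] φ) (∀[ a′ , b′ ] φ′) _ e ρ h y (l , u) =
    let e₁ , e′ = ⟨⟩-injective′ (codeTerm a) ⟨ codeTerm b , codeFormula φ ⟩ (codeTerm a′) ⟨ codeTerm b′ , codeFormula φ′ ⟩ e
        e₂ , e₃ = ⟨⟩-injective′ (codeTerm b) (codeFormula φ) (codeTerm b′) (codeFormula φ′) e′
    in same-formula φ φ′ e₃ (y ∷ ρ) (h y
         (resp-≤ ρ (≋-sym (same-term ρ a a′ e₁)) (≋-refl {y}) l , resp-≤ ρ (≋-refl {y}) (≋-sym (same-term ρ b b′ e₂)) u))

-- The sentences, their codes and the reduction

module Reduction where

  open import Data.Fin.Base using (Fin; zero; suc; toℕ)
  open import Data.Integer.Base as ℤ using (ℤ)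
  open import Data.List.Base using ([]; _∷_)
  open import Data.List.Relation.Unary.All using ([]; _∷_)
  open import Data.Nat.Base as ℕ using (ℕ; zero; suc; pred)
  import Data.Nat.Properties as ℕₚ
  open import Data.Product.Base using (∃-syntax; _,_; proj₁; proj₂)
  open import Data.Rational.Unnormalised.Base as ℚ using (mkℚᵘ; 0ℚᵘ; 1ℚᵘ; *≤*)
  import Data.Rational.Unnormalised.Properties as ℚₚ
  open import Data.Vec.Base using (Vec; []; _∷_)
  open import Function.Bundles using (_⇔_; mk⇔; module Equivalence)
  open import Relation.Binary.PropositionalEquality using (_≡_; _≢_; refl; sym; trans; cong; cong₂; subst)
  open import Relation.Nullary using (¬_)
  open import Defs
  open Pairing using (pair; pair-def; pair-surjective; loop)
  open Program using (lit; iter)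
  open Machines
  open Functions
  open Reals using (unit; 0<unit; fromℚ-<; <-resp; <-irrefl; fromℚ-≤⁻¹)
  open TentProgram using (envelopeSymbol; isEnvelope)
  open Game
  open Formula
  open Truth
  open Invariance using (same-formula)
  open Equivalence using (to; from)

  unit-≤⁻¹ : ∀ {K M} → unit M ℚ.≤ unit K → K ℕ.≤ M
  unit-≤⁻¹ {K} {M} (*≤* (ℤ.+≤+ (ℕ.s≤s l))) = ℕₚ.+-cancelʳ-≤ 0 K M l

  unit-injective : ∀ {K M} → fromℚ (unit K) ≋ fromℚ (unit M) → K ≡ M
  unit-injective {K} {M} e = ℕₚ.≤-antisym
    (unit-≤⁻¹ (fromℚ-≤⁻¹ {unit M} {unit K} (proj₂ (≋-elim e)))) (unit-≤⁻¹ (fromℚ-≤⁻¹ {unit K} {unit M} (proj₁ (≋-elim e))))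

  unit≢0 : ∀ {K} → ¬ (fromℚ (unit K) ≋ fromℚ 0ℚᵘ)
  unit≢0 {K} e = ℚₚ.<-irrefl ℚₚ.≃-refl (ℚₚ.<-≤-trans (0<unit K) (fromℚ-≤⁻¹ {unit K} {0ℚᵘ} (proj₁ (≋-elim e))))

  opaque
    unfolding positive

    positive-true : ∀ {n} {ρ : Vec ℝ n} t → TrueClause ρ (positive t) ⇔ (¬ ¬ (fromℚ 0ℚᵘ < ⟦ t ⟧ ρ))
    positive-true t = mk⇔ (λ c n → c (n ∷ [])) (λ c → λ { (n ∷ []) → c n })

    detected-true : ∀ {n} {ρ : Vec ℝ n} G t → TrueClause ρ (detected G t) ⇔ (¬ ¬ Le ρ (halfSquare t) (app G t))
    detected-true G t = mk⇔ (λ c n → c ((λ l → n (le (≼-intro l))) ∷ [])) (λ c → λ { (n ∷ []) → c λ l → n (≼-elim (le-elim l)) })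

  module _ {G : FunctionSymbol} (detectG : Detects (function G) verdictC) where

    -- The clause `detected` holds at 0 for any envelope, as both sides of ½ y² ≤ F y are then
    -- nonnegative and the left one is 0; `positive` is what makes a forfeited history false.
    final-expresses : ∀ {n} → Expresses (final {n} G) (Winning 0)
    final-expresses {n} = record { at = λ ρ K e → mk⇔ (sound ρ K e) (complete ρ K e) ; lost = lost }
      where
      sound : ∀ ρ K → Has ρ x₂ (unit K) → Sat ρ (final G) → verdictC (suc K) ≢ 0
      sound ρ K (has e) (sat (_ ∷ c ∷ [])) eq = to (detected-true G x₂) c λ l →
        detect-only {V = G} {verdictC} detectG {x₂} (≼-trans (0≼unit K) (≋⇒≼ (≋-sym e))) l
          (λ (has z) → unit≢0 (≋-trans (≋-sym e) z))
          (λ M vM (has m) → vM (trans (cong (λ i → verdictC (suc i)) (unit-injective (≋-trans (≋-sym m) e))) eq))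
      complete : ∀ ρ K → Has ρ x₂ (unit K) → verdictC (suc K) ≢ 0 → Sat ρ (final G)
      complete ρ K (has e) v = sat (
        from (positive-true x₂) (λ no → no (<-resp {fromℚ 0ℚᵘ} {fromℚ 0ℚᵘ} {fromℚ (unit K)} {⟦ x₂ ⟧ ρ}
          (≋-elim (≋-refl {fromℚ 0ℚᵘ})) (≋-elim (≋-sym e)) (fromℚ-< (0<unit K)))) ∷
        from (detected-true G x₂) (λ no → no (detect-peak {V = G} {verdictC} detectG {x₂} {K} v (has e))) ∷ [])
      lost : ∀ ρ → Has ρ x₂ 0ℚᵘ → ¬ Sat ρ (final G)
      lost ρ (has e) (sat (c ∷ _)) = to (positive-true x₂) c λ l → <-irrefl {fromℚ 0ℚᵘ}
        (<-resp {fromℚ 0ℚᵘ} {fromℚ 0ℚᵘ} {⟦ x₂ ⟧ ρ} {fromℚ 0ℚᵘ} (≋-elim (≋-refl {fromℚ 0ℚᵘ})) (≋-elim e) l)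

  module _ (V G : FunctionSymbol) where

    -- A move binds five variables and leaves the new history in position 2 again, so a round of
    -- three moves enlarges the context by 15.
    rounds : ∀ (j n : ℕ) → BoundedFormula (3 ℕ.+ n)
    rounds zero    n = final G
    rounds (suc j) n = exMove V (allMove V (exMove V (rounds j (15 ℕ.+ n))))

    start : ℕ → ℕ
    start m = pred ⟨ 1 , 2 ℕ.+ m ⟩

    -- The degenerate first interval fixes the initial history as a constant. The two idle
    -- quantifiers over the point 0 push it to position 2, where the moves look for it.
    sentence : ℕ → BoundedSentence
    sentence m = ∃[ const (unit (start m)) , const (unit (start m)) ] ∃[ const 0ℚᵘ , const 0ℚᵘ ] ∃[ const 0ℚᵘ , const 0ℚᵘ ] rounds m 0

  module _ {V G : FunctionSymbol} (detectV : Detects (function V) (λ _ → 1)) (detectG : Detects (function G) verdictC) where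

    winning-stable : ∀ j → Stable (Winning j)
    winning-stable zero    K nn eq = nn λ f → f eq
    winning-stable (suc j) K nn f  = nn λ g → g f

    rounds-express : ∀ (j : ℕ) {n : ℕ} → Expresses (rounds V G j n) (Winning j)
    rounds-express zero    = final-expresses detectG
    rounds-express (suc j) = exMove-expresses detectV (allMove-expresses detectV (exMove-expresses detectV (rounds-express j))
      -- After a universal forfeit the history is `pair 1 1` and one existential move of the round
      -- is still due; any move keeps the game won, and 0 is taken.
      (λ K nn f → nn λ g → g f) (λ f → f 0 (winning-won j (extend 0 root))))

    sentence-true : ∀ m → ([] ⊨ sentence V G m) ⇔ Winning m (pair 1 (2 ℕ.+ m))
    sentence-true m = mk⇔
      (λ h → winning-stable m _ λ ¬w →
        ∃-elim (sat {φ = sentence V G m} h) λ y wy h → ∃-elim h λ z₁ _ h → ∃-elim h λ z₂ _ h →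
        ¬w (subst (Winning m) suc-start (to (Expresses.at (rounds-express m) _ (start V G m)
          (has (≼-antisym (Within.upper wy) (Within.lower wy)))) h)))
      (λ w → sat-elim {φ = sentence V G m} (∃-intro λ f → f (fromℚ (unit (start V G m))) (within ≼-refl ≼-refl)
        (∃-intro λ f → f (fromℚ 0ℚᵘ) (within ≼-refl ≼-refl)
        (∃-intro λ f → f (fromℚ 0ℚᵘ) (within ≼-refl ≼-refl)
        (from (Expresses.at (rounds-express m) _ (start V G m) (has ≋-refl)) (subst (Winning m) (sym suc-start) w))))))
      where
      suc-start : suc (start V G m) ≡ pair 1 (2 ℕ.+ m)
      suc-start = sym (pair-def 1 (2 ℕ.+ m))

  opaque
    detector : ∀ {r} → Fun₁ r → ∃[ f ] Detects (function f) r
    detector rF = envelopeSymbol rF , envelope-detects (isEnvelope rF)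

  -- Rounds live in ever larger contexts, but codes of de Bruijn terms do not see the context.
  -- Comparing terms across contexts shows that each round transforms the code in the same way, so
  -- the reduction is a plain iteration of `roundCode`.
  record Same {n m : ℕ} (t : Term n) (u : Term m) : Set where
    constructor same
    field same-code : codeTerm t ≡ codeTerm u
  open Same

  module _ {n m : ℕ} where

    same-var : ∀ {i : Fin n} {j : Fin m} → toℕ i ≡ toℕ j → Same (var i) (var j)
    same-var e = same (cong (λ i → ⟨ 0 , i ⟩) e)

    same-const : ∀ q → Same {n} {m} (const q) (const q)
    same-const q = same refl

    same-⊕ : ∀ {s t : Term n} {s′ t′ : Term m} → Same s s′ → Same t t′ → Same (s ⊕ t) (s′ ⊕ t′)
    same-⊕ (same e) (same e′) = same (cong₂ (λ a b → ⟨ 2 , ⟨ a , b ⟩ ⟩) e e′)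

    same-⊗ : ∀ {s t : Term n} {s′ t′ : Term m} → Same s s′ → Same t t′ → Same (s ⊗ t) (s′ ⊗ t′)
    same-⊗ (same e) (same e′) = same (cong₂ (λ a b → ⟨ 3 , ⟨ a , b ⟩ ⟩) e e′)

    same-app : ∀ {t : Term n} {t′ : Term m} f → Same t t′ → Same (app f t) (app f t′)
    same-app f (same e) = same (cong (λ a → ⟨ 4 , ⟨ index (program f) , a ⟩ ⟩) e)

    opaque
      unfolding α

      same-α : ∀ {s y : Term n} {s′ y′ : Term m} → Same s s′ → Same y y′ → Same (α s y) (α s′ y′)
      same-α e e′ = same-⊕ (same-⊗ (same-⊕ e e′) (same-⊕ (same-⊕ e e′) (same-⊗ e e′)))
        (same-⊗ (same-const (mkℚᵘ (ℤ.+ 2) 0)) (same-⊗ (same-⊗ e e) e′))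

      same-β : ∀ {s y : Term n} {s′ y′ : Term m} → Same s s′ → Same y y′ → Same (β s y) (β s′ y′)
      same-β e e′ = same-⊗ (same-const (mkℚᵘ (ℤ.+ 2) 0)) (same-⊗ (same-⊗ e e) (same-⊗ e′ e′))

      same-halfSquare : ∀ {y : Term n} {y′ : Term m} → Same y y′ → Same (halfSquare y) (halfSquare y′)
      same-halfSquare e = same-⊗ (same-const ℚ.½) (same-⊗ e e)

  same-atom : ∀ {n m} (a : Atom n) (b : Atom m) → codeAtom a ≡ codeAtom b → codeClause (pos a ∷ []) ≡ codeClause (pos b ∷ [])
  same-atom a b = cong (λ c → suc ⟨ ⟨ 0 , c ⟩ , 0 ⟩)

  same-≥ : ∀ {n m} {s t : Term n} {s′ t′ : Term m} → Same s s′ → Same t t′ → codeAtom (s ≥′ t) ≡ codeAtom (s′ ≥′ t′)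
  same-≥ (same e) (same e′) = cong₂ (λ a b → ⟨ 1 , ⟨ a , b ⟩ ⟩) e e′

  same-> : ∀ {n m} {s t : Term n} {s′ t′ : Term m} → Same s s′ → Same t t′ → codeAtom (s >′ t) ≡ codeAtom (s′ >′ t′)
  same-> (same e) (same e′) = cong₂ (λ a b → ⟨ 2 , ⟨ a , b ⟩ ⟩) e e′

  opaque
    unfolding positive

    same-positive : ∀ {n m} {s : Term n} {s′ : Term m} → Same s s′ → codeClause (positive s) ≡ codeClause (positive s′)
    same-positive {s = s} {s′} e = same-atom (s >′ const 0ℚᵘ) (s′ >′ const 0ℚᵘ)
      (same-> {s = s} {const 0ℚᵘ} {s′} {const 0ℚᵘ} e (same-const 0ℚᵘ))

    same-detected : ∀ {n m} {s : Term n} {s′ : Term m} G → Same s s′ → codeClause (detected G s) ≡ codeClause (detected G s′)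
    same-detected {s = s} {s′} G e = same-atom (app G s ≥′ halfSquare s) (app G s′ ≥′ halfSquare s′)
      (same-≥ {s = app G s} {halfSquare s} {app G s′} {halfSquare s′} (same-app G e) (same-halfSquare e))

  quantifier : ℕ → ℕ → ℕ → ℕ → ℕ
  quantifier t a b x = pair t (pair a (pair b x))

  quantifier-def : ∀ t a b x → quantifier t a b x ≡ ⟨ t , ⟨ a , ⟨ b , x ⟩ ⟩ ⟩
  quantifier-def t a b x = trans (pair-def t _) (cong (λ y → ⟨ t , y ⟩) (trans (pair-def a _) (cong (λ y → ⟨ a , y ⟩) (pair-def b x))))

  -- Codes do not depend on the context, so those of the bounds of the moves are taken in context 7.
  bounded : ℕ → Term 7 → Term 7 → ℕ → ℕ
  bounded t a b = quantifier t (codeTerm a) (codeTerm b)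

  boundedF : ∀ t a b → Fun₁ (bounded t a b)
  boundedF t a b = fun₁ (pairF $₂ (lit t , pairF $₂ (lit (codeTerm a) , pairF $₂ (lit (codeTerm b) , v0)))) (λ _ → refl)

  record Coded {n : ℕ} (φ : BoundedFormula n) (x : ℕ) : Set where
    constructor coded
    field code-eq : codeFormula φ ≡ x
  open Coded

  module _ {n : ℕ} {a b : Term n} {φ : BoundedFormula (suc n)} {x : ℕ} where

    code-∃ : ∀ a′ b′ → Same a a′ → Same b b′ → Coded φ x → Coded (∃[ a , b ] φ) (bounded 1 a′ b′ x)
    code-∃ a′ b′ (same e) (same e′) (coded refl) = coded (
      trans (cong₂ (λ a b → ⟨ 1 , ⟨ a , ⟨ b , codeFormula φ ⟩ ⟩ ⟩) e e′) (sym (quantifier-def 1 (codeTerm a′) (codeTerm b′) (codeFormula φ))))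

    code-∀ : ∀ a′ b′ → Same a a′ → Same b b′ → Coded φ x → Coded (∀[ a , b ] φ) (bounded 2 a′ b′ x)
    code-∀ a′ b′ (same e) (same e′) (coded refl) = coded (
      trans (cong₂ (λ a b → ⟨ 2 , ⟨ a , ⟨ b , codeFormula φ ⟩ ⟩ ⟩) e e′) (sym (quantifier-def 2 (codeTerm a′) (codeTerm b′) (codeFormula φ))))

  code-opening : ∀ q {c x} {φ : BoundedFormula 3} → codeTerm {7} (const q) ≡ c → Coded φ x →
    Coded (∃[ const q , const q ] ∃[ const 0ℚᵘ , const 0ℚᵘ ] ∃[ const 0ℚᵘ , const 0ℚᵘ ] φ)
      (quantifier 1 c c (bounded 1 (const 0ℚᵘ) (const 0ℚᵘ) (bounded 1 (const 0ℚᵘ) (const 0ℚᵘ) x)))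
  code-opening q refl e =
    code-∃ (const q) (const q) (same-const q) (same-const q) (
    code-∃ (const 0ℚᵘ) (const 0ℚᵘ) (same-const 0ℚᵘ) (same-const 0ℚᵘ) (
    code-∃ (const 0ℚᵘ) (const 0ℚᵘ) (same-const 0ℚᵘ) (same-const 0ℚᵘ) e))

  existsF : Fun₃ (quantifier 1)
  existsF = fun₃ (pairF $₂ (lit 1 , pairF $₂ (v0 , pairF $₂ (v1 , v2)))) (λ _ _ _ → refl)

  module _ (V G : FunctionSymbol) where

    exCode allCode roundCode : ℕ → ℕ
    exCode x =
      bounded 1 (const 0ℚᵘ) (const 1ℚᵘ) (bounded 1 (halfSquare x₀) (app V x₀) (
      bounded 1 (const 0ℚᵘ) x₄ (bounded 1 (x₀ ⊗ α x₅ x₂) (β x₅ x₂) (bounded 1 (β x₆ x₃) (x₁ ⊗ α x₆ x₃) x))))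
    allCode x =
      bounded 2 (const 0ℚᵘ) (const 1ℚᵘ) (bounded 2 (halfSquare x₀) (app V x₀) (
      bounded 1 (const 0ℚᵘ) (const 1ℚᵘ) (bounded 1 (x₂ ⊗ (x₀ ⊗ α x₅ x₂)) (x₂ ⊗ β x₅ x₂) (
      bounded 1 (x₃ ⊗ β x₆ x₃) (x₃ ⊗ (x₁ ⊗ α x₆ x₃)) x))))
    roundCode x = exCode (allCode (exCode x))

    code-exMove : ∀ {n} {φ : BoundedFormula (8 ℕ.+ n)} {x} → Coded φ x → Coded (exMove V φ) (exCode x)
    code-exMove e =
      code-∃ (const 0ℚᵘ) (const 1ℚᵘ) (same-const 0ℚᵘ) (same-const 1ℚᵘ) (
      code-∃ (halfSquare x₀) (app V x₀) (same-halfSquare (same-var refl)) (same-app V (same-var refl)) (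
      code-∃ (const 0ℚᵘ) x₄ (same-const 0ℚᵘ) (same-var refl) (
      code-∃ (x₀ ⊗ α x₅ x₂) (β x₅ x₂) (same-⊗ (same-var refl) (same-α (same-var refl) (same-var refl))) (same-β (same-var refl) (same-var refl)) (
      code-∃ (β x₆ x₃) (x₁ ⊗ α x₆ x₃) (same-β (same-var refl) (same-var refl)) (same-⊗ (same-var refl) (same-α (same-var refl) (same-var refl))) e))))

    code-allMove : ∀ {n} {φ : BoundedFormula (8 ℕ.+ n)} {x} → Coded φ x → Coded (allMove V φ) (allCode x)
    code-allMove e =
      code-∀ (const 0ℚᵘ) (const 1ℚᵘ) (same-const 0ℚᵘ) (same-const 1ℚᵘ) (
      code-∀ (halfSquare x₀) (app V x₀) (same-halfSquare (same-var refl)) (same-app V (same-var refl)) (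
      code-∃ (const 0ℚᵘ) (const 1ℚᵘ) (same-const 0ℚᵘ) (same-const 1ℚᵘ) (
      code-∃ (x₂ ⊗ (x₀ ⊗ α x₅ x₂)) (x₂ ⊗ β x₅ x₂)
        (same-⊗ (same-var refl) (same-⊗ (same-var refl) (same-α (same-var refl) (same-var refl))))
        (same-⊗ (same-var refl) (same-β (same-var refl) (same-var refl))) (
      code-∃ (x₃ ⊗ β x₆ x₃) (x₃ ⊗ (x₁ ⊗ α x₆ x₃))
        (same-⊗ (same-var refl) (same-β (same-var refl) (same-var refl)))
        (same-⊗ (same-var refl) (same-⊗ (same-var refl) (same-α (same-var refl) (same-var refl)))) e))))

    exCodeF : Fun₁ exCode
    exCodeF = fun₁ (boundedF 1 (const 0ℚᵘ) (const 1ℚᵘ) $₁ (boundedF 1 (halfSquare x₀) (app V x₀) $₁ (boundedF 1 (const 0ℚᵘ) x₄ $₁ (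
      boundedF 1 (x₀ ⊗ α x₅ x₂) (β x₅ x₂) $₁ (boundedF 1 (β x₆ x₃) (x₁ ⊗ α x₆ x₃) $₁ v0))))) (λ _ → refl)

    allCodeF : Fun₁ allCode
    allCodeF = fun₁ (boundedF 2 (const 0ℚᵘ) (const 1ℚᵘ) $₁ (boundedF 2 (halfSquare x₀) (app V x₀) $₁ (boundedF 1 (const 0ℚᵘ) (const 1ℚᵘ) $₁ (
      boundedF 1 (x₂ ⊗ (x₀ ⊗ α x₅ x₂)) (x₂ ⊗ β x₅ x₂) $₁ (boundedF 1 (x₃ ⊗ β x₆ x₃) (x₃ ⊗ (x₁ ⊗ α x₆ x₃)) $₁ v0))))) (λ _ → refl)

    code-final : ∀ n → codeFormula (final {n} G) ≡ codeFormula (final {0} G)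
    code-final n = cong₂ (λ a b → ⟨ 0 , suc ⟨ a , suc ⟨ b , 0 ⟩ ⟩ ⟩) (same-positive {3 ℕ.+ n} {3} (same-var refl))
      (same-detected {3 ℕ.+ n} {3} G (same-var refl))

    base : ℕ
    base = codeFormula (final {0} G)

    code-rounds : ∀ j n → Coded (rounds V G j n) (loop j base (λ _ → roundCode))
    code-rounds zero    n = coded (code-final n)
    code-rounds (suc j) n = subst (Coded (rounds V G (suc j) n)) (sym (loop-last j base roundCode))
      (code-exMove (code-allMove (code-exMove (code-rounds j (15 ℕ.+ n)))))

    -- The outer 1 is the tag of a constant, 2 is the code of the numerator 1, and the last entry is
    -- the denominator ⟨ 1 , 2 + m ⟩ less one.
    startCode : ℕ → ℕ
    startCode m = pair 1 (pair 2 (pred (pair 1 (2 ℕ.+ m))))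

    reduction : ℕ → ℕ
    reduction m = quantifier 1 (startCode m) (startCode m) (bounded 1 (const 0ℚᵘ) (const 0ℚᵘ)
      (bounded 1 (const 0ℚᵘ) (const 0ℚᵘ) (loop m base (λ _ → roundCode))))

    startCodeF : Fun₁ startCode
    startCodeF = fun₁ (pairF $₂ (lit 1 , pairF $₂ (lit 2 , predF $₁ (pairF $₂ (lit 1 , addF $₂ (lit 2 , v0)))))) (λ _ → refl)

    loopF : Fun₁ (λ m → loop m base (λ _ → roundCode))
    loopF = fun₁ (iter v0 (lit base) (exCodeF $₁ (allCodeF $₁ (exCodeF $₁ v0)))) (λ _ → refl)

    reductionF : Fun₁ reduction
    reductionF = fun₁ (existsF $₃ (startCodeF $₁ v0 , startCodeF $₁ v0 , boundedF 1 (const 0ℚᵘ) (const 0ℚᵘ) $₁ (boundedF 1 (const 0ℚᵘ) (const 0ℚᵘ) $₁ (loopF $₁ v0)))) (λ _ → refl)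

    code-start : ∀ m → codeTerm {7} (const (unit (start V G m))) ≡ startCode m
    code-start m = sym (trans (pair-def 1 _) (cong (λ y → ⟨ 1 , y ⟩) (trans (pair-def 2 _)
      (cong (λ y → ⟨ 2 , y ⟩) (cong pred (pair-def 1 (2 ℕ.+ m)))))))

    code-sentence : ∀ m → Coded (sentence V G m) (reduction m)
    code-sentence m = code-opening (unit (start V G m)) (code-start m) (code-rounds m 0)

  module _ {V G : FunctionSymbol} (detectV : Detects (function V) (λ _ → 1)) (detectG : Detects (function G) verdictC) where

    sentence⇔jump : ∀ n k → ([] ⊨ sentence V G (pair n k)) ⇔ 𝟎^⟨ k ⟩ n
    sentence⇔jump n k = sentence-true detectV detectG (pair n k) ▸ winning⇔jump n k

    jump⇒true : ∀ m → 𝟎^ω m → Th-B (reduction V G m)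
    jump⇒true m (n , k , m≡ , h) = sentence V G m , code-eq {φ = sentence V G m} {reduction V G m} (code-sentence V G m) ,
      subst (λ m → [] ⊨ sentence V G m) (trans (pair-def n k) (sym m≡)) (from (sentence⇔jump n k) h)

    true⇒jump : ∀ m → Th-B (reduction V G m) → 𝟎^ω m
    true⇒jump m (φ , eq , h) =
      let n , k , m≡ = pair-surjective m
      in n , k , trans m≡ (pair-def n k) , to (sentence⇔jump n k) (subst (λ m → [] ⊨ sentence V G m) m≡
        (same-formula φ (sentence V G m)
          (trans eq (sym (code-eq {φ = sentence V G m} {reduction V G m} (code-sentence V G m)))) [] h))

    reduces : ∀ m → 𝟎^ω m ⇔ Th-B (reduction V G m)
    reduces m = mk⇔ (jump⇒true m) (true⇒jump m)

  oneF : Fun₁ (λ _ → 1)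
  oneF = fun₁ (lit 1) (λ _ → refl)

open import Defs
open import Data.Product.Base using (_,_)
open Machines using (computable)
open Game using (verdictF)
open Reduction

theorem5p14 : 𝟎^ω ≤ₘ Th-B
theorem5p14 =
  let V , detectV = detector oneF
      G , detectG = detector verdictF
  in reduction V G , computable (reductionF V G) , reduces {V} {G} detectV detectG
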